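{- Let $m\ge 7$. If there is a balanced triangle design in $\mathbb{F}_2^m$, then there is a balanced triangle design in $\mathbb{F}_2^{m+6}$.
   Context: For a vector space $V$ over $\mathbb{F}_q$, a triangle is a set $\{\langle a,b\rangle,\langle b,c\rangle,\langle c,a\rangle\}$ of three $2$-dimensional subspaces, where $a,b,c\in V$ are linearly independent and $\langle\cdot\rangle$ denotes linear span over $\mathbb{F}_q$. A triangle design in $V$ is a set $\mathcal{T}$ of triangles in $V$ such that every $2$-dimensional subspace of $V$ is one of the three subspaces of exactly one triangle in $\mathcal{T}$. A triangle covers a nonzero vector $x$ if $x$ lies in at least one of its three $2$-dimensional subspaces. A triangle design is balanced if every nonzero vector of $V$ is covered by the same number of triangles of the design. -}

module Defs where

open import Data.Bool using (Bool; true; false; _xor_)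
open import Data.Bool.Properties using () renaming (_≟_ to _≟ᵇ_)
open import Data.Nat using (ℕ)
open import Data.Vec using (Vec; replicate; zipWith)
open import Data.Vec.Properties using (≡-dec)
open import Data.List using (List; length; filter)
open import Data.List.Membership.Propositional using (_∈_)
open import Data.List.Relation.Unary.AllPairs using (AllPairs)
open import Data.Product using (Σ; ∃; _×_; _,_)
open import Data.Sum using (_⊎_; inj₁; inj₂)
open import Relation.Nullary using (¬_; Dec)
open import Relation.Nullary.Decidable using (_⊎-dec_; map′)
open import Relation.Binary.PropositionalEquality using (_≡_)

-- The vector space F_2^m, with F_2 = Bool (false = 0, true = 1, xor = +).
V : ℕ → Set
V m = Vec Bool m

0v : ∀ {m} → V m
0v = replicate _ false

infixl 6 _⊕_
_⊕_ : ∀ {m} → V m → V m → V m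
_⊕_ = zipWith _xor_

_·_ : ∀ {m} → Bool → V m → V m
true  · v = v
false · v = 0v

_≟V_ : ∀ {m} (x y : V m) → Dec (x ≡ y)
_≟V_ = ≡-dec _≟ᵇ_

LinIndep₂ : ∀ {m} → V m → V m → Set
LinIndep₂ a b = ∀ (λ₁ λ₂ : Bool) → λ₁ · a ⊕ λ₂ · b ≡ 0v → (λ₁ ≡ false × λ₂ ≡ false)

LinIndep₃ : ∀ {m} → V m → V m → V m → Set
LinIndep₃ a b c = ∀ (λ₁ λ₂ λ₃ : Bool) → λ₁ · a ⊕ λ₂ · b ⊕ λ₃ · c ≡ 0v →
                  (λ₁ ≡ false × λ₂ ≡ false × λ₃ ≡ false)

_∈⟨_,_⟩ : ∀ {m} → V m → V m → V m → Set
x ∈⟨ a , b ⟩ = Σ Bool λ λ₁ → Σ Bool λ λ₂ → x ≡ λ₁ · a ⊕ λ₂ · b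

_∈⟨_,_⟩? : ∀ {m} (x a b : V m) → Dec (x ∈⟨ a , b ⟩)
x ∈⟨ a , b ⟩? = map′ to from (dec false false ⊎-dec (dec false true ⊎-dec (dec true false ⊎-dec dec true true)))
  where
  dec : ∀ l₁ l₂ → Dec (x ≡ l₁ · a ⊕ l₂ · b)
  dec l₁ l₂ = x ≟V (l₁ · a ⊕ l₂ · b)
  to : (x ≡ false · a ⊕ false · b) ⊎ ((x ≡ false · a ⊕ true · b) ⊎
       ((x ≡ true · a ⊕ false · b) ⊎ (x ≡ true · a ⊕ true · b))) → x ∈⟨ a , b ⟩
  to (inj₁ e) = false , false , e
  to (inj₂ (inj₁ e)) = false , true , e
  to (inj₂ (inj₂ (inj₁ e))) = true , false , e
  to (inj₂ (inj₂ (inj₂ e))) = true , true , e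
  from : x ∈⟨ a , b ⟩ → (x ≡ false · a ⊕ false · b) ⊎ ((x ≡ false · a ⊕ true · b) ⊎
       ((x ≡ true · a ⊕ false · b) ⊎ (x ≡ true · a ⊕ true · b)))
  from (false , false , e) = inj₁ e
  from (false , true , e) = inj₂ (inj₁ e)
  from (true , false , e) = inj₂ (inj₂ (inj₁ e))
  from (true , true , e) = inj₂ (inj₂ (inj₂ e))

SameSpan : ∀ {m} → V m → V m → V m → V m → Set
SameSpan a b c d = ∀ x → (x ∈⟨ a , b ⟩ → x ∈⟨ c , d ⟩) × (x ∈⟨ c , d ⟩ → x ∈⟨ a , b ⟩)

-- A triangle {⟨a,b⟩,⟨b,c⟩,⟨c,a⟩}, presented by linearly independent a, b, c.
record Triangle (m : ℕ) : Set where
  constructor triangle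
  field
    a b c : V m
    indep : LinIndep₃ a b c

open Triangle public

IsSideOf : ∀ {m} → V m → V m → Triangle m → Set
IsSideOf u v t = SameSpan u v (a t) (b t) ⊎ (SameSpan u v (b t) (c t) ⊎ SameSpan u v (c t) (a t))

SameTriangle : ∀ {m} → Triangle m → Triangle m → Set
SameTriangle s t =
  (IsSideOf (a s) (b s) t × IsSideOf (b s) (c s) t × IsSideOf (c s) (a s) t) ×
  (IsSideOf (a t) (b t) s × IsSideOf (b t) (c t) s × IsSideOf (c t) (a t) s)

-- A set of triangles is represented by a list whose entries are pairwise distinct triangles.
-- It is a triangle design if every 2-dim subspace ⟨u,v⟩ (u, v linearly independent)
-- is a side of exactly one triangle of the set.
IsTriangleDesign : ∀ {m} → List (Triangle m) → Set
IsTriangleDesign {m} T =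
  AllPairs (λ s t → ¬ SameTriangle s t) T ×
  (∀ (u v : V m) → LinIndep₂ u v →
     Σ (Triangle m) λ t → (t ∈ T × IsSideOf u v t) ×
       (∀ t′ → t′ ∈ T → IsSideOf u v t′ → SameTriangle t t′))

Covers : ∀ {m} → V m → Triangle m → Set
Covers x t = x ∈⟨ a t , b t ⟩ ⊎ (x ∈⟨ b t , c t ⟩ ⊎ x ∈⟨ c t , a t ⟩)

covers? : ∀ {m} (x : V m) (t : Triangle m) → Dec (Covers x t)
covers? x t = (x ∈⟨ a t , b t ⟩?) ⊎-dec ((x ∈⟨ b t , c t ⟩?) ⊎-dec (x ∈⟨ c t , a t ⟩?))

coverCount : ∀ {m} → V m → List (Triangle m) → ℕ
coverCount x T = length (filter (covers? x) T)

IsBalanced : ∀ {m} → List (Triangle m) → Set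
IsBalanced {m} T = Σ ℕ λ r → ∀ (x : V m) → ¬ x ≡ 0v → coverCount x T ≡ r

HasBalancedTriangleDesign : ℕ → Set
HasBalancedTriangleDesign m = Σ (List (Triangle m)) λ T → IsTriangleDesign T × IsBalanced T

{-# OPTIONS --safe #-}

-- A balanced design in F₂ᵐ forces m = 6k + 1, by counting lines and covered points modulo 9. Write
-- F₂ᵐ⁺⁶ as F₂ × F₆₄ᵏ × F₆₄; the given design takes care of the lines with vanishing last coordinate, and
-- a₀ is the point (1, 0, 0). The other lines are of three kinds.
-- * Those in one of the 7-dimensional subspaces {(e, b i, b)}, i ∈ F₆₄ᵏ, which share only a₀ and cover
--   every other point outside the given subspace once: each subspace receives a copy of a balanced design of
--   F₂⁷, the orbit of seven triangles under F₁₂₈*.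
-- * Those through a point (e, a, 0), a ≠ 0, and a point over b ≠ 0. The differences a, γa, γ²a are grouped so
--   that lines of direction a are bases of triangles whose apex has direction γa or γ²a; which of the
--   three is the base depends on b through a cubic character, so that every direction is a base equally often.
-- * Those lifting a line {b₁, b₂, b₁ + b₂} of F₆₄ with determinant D = b₂x₁ + b₁x₂ ≠ 0. A triangle with
--   vertices over the three points of this line has sides of determinants d, αd, βd, where α and β can be chosen
--   such that 1, α, β represent the cosets of the cubes in F₆₄*.
-- Every line lies on some triangle, and the number of triangles is a third of the number of lines.

module Submission where

open import Defs
open import Data.Bool using (Bool; true; false; if_then_else_; not; _xor_; _∧_)
open import Data.Bool.Properties
  using (xor-comm; xor-assoc; xor-identityˡ; xor-identityʳ; xor-same; not-involutive; ¬-not)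
  renaming (_≟_ to _≟ᵇ_)
open import Data.Empty using (⊥; ⊥-elim)
open import Data.Fin using (Fin; zero; suc; #_)
import Data.Fin.Properties as Finₚ
open import Data.List as List using (List; []; _∷_; map; concatMap; filter; length; cartesianProduct; concat)
open import Data.List.Membership.Propositional using (_∈_; _∉_; find; lose)
open import Data.List.Membership.Propositional.Properties
open import Data.List.Membership.Propositional.Properties.WithK using (unique∧set⇒bag)
open import Data.List.Properties using (map-cong; map-∘; map-++; length-map; length-++)
open import Data.List.Relation.Binary.BagAndSetEquality using (∼bag⇒↭)
open import Data.List.Relation.Binary.Disjoint.Propositional using (Disjoint)
open import Data.List.Relation.Binary.Permutation.Propositional using (_↭_)
open import Data.List.Relation.Binary.Permutation.Propositional.Properties using (map⁺; ↭-length)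
open import Data.List.Relation.Unary.All as All using (All; []; _∷_)
import Data.List.Relation.Unary.All.Properties as Allₚ
open import Data.List.Relation.Unary.AllPairs as AllPairs using (AllPairs; []; _∷_)
import Data.List.Relation.Unary.AllPairs.Properties as AllPairsₚ
open import Data.List.Relation.Unary.Any as Any using (Any; here; there)
open import Data.List.Relation.Unary.Unique.Propositional using (Unique)
import Data.List.Relation.Unary.Unique.Propositional.Properties as Uniq
open import Data.Nat using (ℕ; zero; suc; _+_; _*_; _^_; _≤_; _<_; z≤n; s≤s; s≤s⁻¹; _%_; _/_; _≡ᵇ_)
open import Data.Nat.DivMod using (m≡m%n+[m/n]*n; m%n<n; [m+kn]%n≡m%n)
open import Data.Nat.Divisibility using (_∣_; divides; ∣m+n∣m⇒∣n; m∣m*n)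
open import Data.Nat.ListAction using (sum)
open import Data.Nat.ListAction.Properties using (sum-++; sum-↭)
open import Data.Nat.Properties
open import Data.Nat.Solver using (module +-*-Solver)
open import Data.Product using (Σ; ∃; _×_; _,_; proj₁; proj₂)
import Data.Product.Properties as Prodₚ
open import Data.Sum using (_⊎_; inj₁; inj₂; [_,_]′)
open import Data.Unit using (⊤; tt)
open import Data.Vec as Vec using (Vec; []; _∷_; _++_; lookup; head; tail; take; drop; splitAt)
open import Data.Vec.Properties
  using ( ∷-injectiveʳ; zipWith-comm; zipWith-assoc; zipWith-identityˡ; zipWith-identityʳ
        ; lookup-zipWith; take-zipWith; drop-zipWith; take++drop≡id; ++-injective )
open import Function using (_∘_; id; mk⇔)
open import Relation.Binary.PropositionalEquality
  using (_≡_; _≢_; refl; sym; trans; cong; cong₂; subst; module ≡-Reasoning)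
open import Relation.Nullary using (¬_; Dec; yes; no; does)
open import Relation.Nullary.Decidable using (map′; _×-dec_; _⊎-dec_; _→-dec_; ¬?)
open import Relation.Unary using (Decidable)
open +-*-Solver using (solve; _:+_; _:*_; _:=_; con)
open ≡-Reasoning

-- The obstacle is balance rather than covering. With q = 64ᵏ = 3K + 1 the given design covers each
-- of its points 2K times, and the new one must cover every point 128K + 42 = 2K + 42q times, so
-- each old point needs 42q further triangles. In a triangle of the second kind the direction of the
-- base is covered for the sake of a single line, but the apex for the sake of two. A direction
-- therefore gains q from each b for which it is a base, and only q/2 from each b for which it is an
-- apex. With 21 of the 63 values of b in each of the three roles the gain is 21q + 42(q/2) = 42q;
-- the point a₀ gains the same from the q copies of the seven-dimensional design. Hence three
-- scalars and a character of order three. For points over distinct nonzero b₁, b₂ the determinant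
-- is the obstruction to lying in a common subspace of the first kind, so the first and third kinds
-- complement each other. All sides of a triangle of the third kind lie over the same line of F₆₄;
-- letting d run through one class makes d, αd and βd run through all nonzero determinants.

⊕-comm : ∀ {n} (x y : V n) → x ⊕ y ≡ y ⊕ x
⊕-comm = zipWith-comm xor-comm

⊕-assoc : ∀ {n} (x y z : V n) → (x ⊕ y) ⊕ z ≡ x ⊕ (y ⊕ z)
⊕-assoc = zipWith-assoc xor-assoc

⊕-identityˡ : ∀ {n} (x : V n) → 0v ⊕ x ≡ x
⊕-identityˡ = zipWith-identityˡ xor-identityˡ

⊕-identityʳ : ∀ {n} (x : V n) → x ⊕ 0v ≡ x
⊕-identityʳ = zipWith-identityʳ xor-identityʳ

⊕-self : ∀ {n} (x : V n) → x ⊕ x ≡ 0v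
⊕-self []      = refl
⊕-self (s ∷ x) = cong₂ _∷_ (xor-same s) (⊕-self x)

-- A solver for identities in elementary abelian 2-groups: a term is determined by the parities of its variables.

lc : ∀ {k n} → V k → Vec (V n) k → V n
lc []      []      = 0v
lc (s ∷ c) (x ∷ ρ) = s · x ⊕ lc c ρ

·-xor : ∀ {n} (s t : Bool) (x : V n) → (s xor t) · x ≡ s · x ⊕ t · x
·-xor true  true  x = sym (⊕-self x)
·-xor true  false x = sym (⊕-identityʳ x)
·-xor false t     x = sym (⊕-identityˡ (t · x))

⊕-interchange : ∀ {n} (x y z w : V n) → (x ⊕ y) ⊕ (z ⊕ w) ≡ (x ⊕ z) ⊕ (y ⊕ w)
⊕-interchange x y z w = begin
  (x ⊕ y) ⊕ (z ⊕ w)  ≡⟨ ⊕-assoc x y (z ⊕ w) ⟩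
  x ⊕ (y ⊕ (z ⊕ w))  ≡⟨ cong (x ⊕_) (sym (⊕-assoc y z w)) ⟩
  x ⊕ ((y ⊕ z) ⊕ w)  ≡⟨ cong (λ u → x ⊕ (u ⊕ w)) (⊕-comm y z) ⟩
  x ⊕ ((z ⊕ y) ⊕ w)  ≡⟨ cong (x ⊕_) (⊕-assoc z y w) ⟩
  x ⊕ (z ⊕ (y ⊕ w))  ≡⟨ sym (⊕-assoc x z (y ⊕ w)) ⟩
  (x ⊕ z) ⊕ (y ⊕ w)  ∎

lc-⊕ : ∀ {k n} (c d : V k) (ρ : Vec (V n) k) → lc (c ⊕ d) ρ ≡ lc c ρ ⊕ lc d ρ
lc-⊕ []      []      []      = sym (⊕-identityˡ 0v)
lc-⊕ (s ∷ c) (t ∷ d) (x ∷ ρ) =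
  trans (cong₂ _⊕_ (·-xor s t x) (lc-⊕ c d ρ)) (⊕-interchange (s · x) (t · x) (lc c ρ) (lc d ρ))

lc-0 : ∀ {k n} (ρ : Vec (V n) k) → lc 0v ρ ≡ 0v
lc-0 []      = refl
lc-0 (x ∷ ρ) = trans (⊕-identityˡ _) (lc-0 ρ)

infixl 6 _⊞_
data Term (k : ℕ) : Set where
  var : Fin k → Term k
  _⊞_ : Term k → Term k → Term k
  𝟘   : Term k

⟦_⟧ : ∀ {k n} → Term k → Vec (V n) k → V n
⟦ var i ⟧ ρ = lookup ρ i
⟦ s ⊞ t ⟧ ρ = ⟦ s ⟧ ρ ⊕ ⟦ t ⟧ ρ
⟦ 𝟘 ⟧     ρ = 0v

basis : ∀ {k} → Fin k → V k
basis zero    = true ∷ 0v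
basis (suc i) = false ∷ basis i

parity : ∀ {k} → Term k → V k
parity (var i) = basis i
parity (s ⊞ t) = parity s ⊕ parity t
parity 𝟘       = 0v

lc-parity : ∀ {k n} (t : Term k) (ρ : Vec (V n) k) → lc (parity t) ρ ≡ ⟦ t ⟧ ρ
lc-parity (var i) ρ = go i ρ
  where
  go : ∀ {k n} (i : Fin k) (ρ : Vec (V n) k) → lc (basis i) ρ ≡ lookup ρ i
  go zero    (x ∷ ρ) = trans (cong (x ⊕_) (lc-0 ρ)) (⊕-identityʳ x)
  go (suc i) (x ∷ ρ) = trans (⊕-identityˡ _) (go i ρ)
lc-parity (s ⊞ t) ρ = trans (lc-⊕ (parity s) (parity t) ρ) (cong₂ _⊕_ (lc-parity s ρ) (lc-parity t ρ))
lc-parity 𝟘       ρ = lc-0 ρ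

⊕-solve : ∀ {k n} (s t : Term k) → parity s ≡ parity t → (ρ : Vec (V n) k) → ⟦ s ⟧ ρ ≡ ⟦ t ⟧ ρ
⊕-solve s t eq ρ = trans (sym (lc-parity s ρ)) (trans (cong (λ c → lc c ρ) eq) (lc-parity t ρ))

v₀ : ∀ {k} → Term (suc k)
v₀ = var zero
v₁ : ∀ {k} → Term (suc (suc k))
v₁ = var (suc zero)
v₂ : ∀ {k} → Term (suc (suc (suc k)))
v₂ = var (suc (suc zero))
⊕-involutive : ∀ {n} (a x : V n) → (x ⊕ a) ⊕ a ≡ x
⊕-involutive a x = ⊕-solve (v₁ ⊞ v₀ ⊞ v₀) v₁ refl (a ∷ x ∷ [])

⊕-≡0⇒≡ : ∀ {n} {x y : V n} → x ⊕ y ≡ 0v → x ≡ y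
⊕-≡0⇒≡ {x = x} {y} eq = trans (sym (⊕-involutive y x)) (trans (cong (_⊕ y) eq) (⊕-identityˡ y))

≡⇒⊕-≡0 : ∀ {n} {x y : V n} → x ≡ y → x ⊕ y ≡ 0v
≡⇒⊕-≡0 {x = x} refl = ⊕-self x

·-distrib : ∀ {n} s (x y : V n) → s · (x ⊕ y) ≡ s · x ⊕ s · y
·-distrib true  x y = refl
·-distrib false x y = sym (⊕-identityˡ 0v)

Additive : ∀ {m n} → (V m → V n) → Set
Additive L = ∀ x y → L (x ⊕ y) ≡ L x ⊕ L y

additive-0 : ∀ {m n} {L : V m → V n} → Additive L → L 0v ≡ 0v
additive-0 {L = L} add = begin
  L 0v                    ≡⟨ sym (⊕-involutive (L 0v) (L 0v)) ⟩
  (L 0v ⊕ L 0v) ⊕ L 0v    ≡⟨ cong (_⊕ L 0v) (sym (add 0v 0v)) ⟩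
  L (0v ⊕ 0v) ⊕ L 0v      ≡⟨ cong (λ z → L z ⊕ L 0v) (⊕-self 0v) ⟩
  L 0v ⊕ L 0v             ≡⟨ ⊕-self (L 0v) ⟩
  0v                      ∎

additive-· : ∀ {m n} {L : V m → V n} → Additive L → ∀ s x → L (s · x) ≡ s · L x
additive-· add true  x = refl
additive-· add false x = additive-0 add

additive-injective : ∀ {m n} {L : V m → V n} → Additive L → (∀ {x} → L x ≡ 0v → x ≡ 0v) →
                     ∀ {x y} → L x ≡ L y → x ≡ y
additive-injective add ker {x} {y} eq = ⊕-≡0⇒≡ (ker (trans (add x y) (≡⇒⊕-≡0 eq)))

-- Finite sums

∑ : ∀ {A : Set} → List A → (A → ℕ) → ℕ
∑ xs f = sum (map f xs)

infix 9 𝟙_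
𝟙_ : ∀ {P : Set} → Dec P → ℕ
𝟙 d = if does d then 1 else 0

𝟙-yes : ∀ {P : Set} (d : Dec P) → P → 𝟙 d ≡ 1
𝟙-yes (yes _) p = refl
𝟙-yes (no ¬p) p = ⊥-elim (¬p p)

𝟙-no : ∀ {P : Set} (d : Dec P) → ¬ P → 𝟙 d ≡ 0
𝟙-no (yes p) ¬p = ⊥-elim (¬p p)
𝟙-no (no _)  ¬p = refl

𝟙-cong : ∀ {P Q : Set} (d : Dec P) (e : Dec Q) → (P → Q) → (Q → P) → 𝟙 d ≡ 𝟙 e
𝟙-cong (yes p) e f g = sym (𝟙-yes e (f p))
𝟙-cong (no ¬p) e f g = sym (𝟙-no e (¬p ∘ g))

∑-cong : ∀ {A : Set} (xs : List A) {f g : A → ℕ} → (∀ x → f x ≡ g x) → ∑ xs f ≡ ∑ xs g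
∑-cong xs eq = cong sum (map-cong eq xs)

∑-cong-∈ : ∀ {A : Set} (xs : List A) {f g : A → ℕ} → (∀ {x} → x ∈ xs → f x ≡ g x) → ∑ xs f ≡ ∑ xs g
∑-cong-∈ []       eq = refl
∑-cong-∈ (x ∷ xs) eq = cong₂ _+_ (eq (here refl)) (∑-cong-∈ xs (eq ∘ there))

∑-++ : ∀ {A : Set} (xs ys : List A) (f : A → ℕ) → ∑ (xs List.++ ys) f ≡ ∑ xs f + ∑ ys f
∑-++ xs ys f = trans (cong sum (map-++ f xs ys)) (sum-++ (map f xs) (map f ys))

∑-map : ∀ {A B : Set} (g : A → B) (xs : List A) (f : B → ℕ) → ∑ (map g xs) f ≡ ∑ xs (f ∘ g)
∑-map g xs f = cong sum (sym (map-∘ xs))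

∑-concatMap : ∀ {A B : Set} (g : A → List B) (xs : List A) (f : B → ℕ) →
              ∑ (concatMap g xs) f ≡ ∑ xs (λ x → ∑ (g x) f)
∑-concatMap g []       f = refl
∑-concatMap g (x ∷ xs) f = trans (∑-++ (g x) (concatMap g xs) f) (cong (∑ (g x) f +_) (∑-concatMap g xs f))

+-interchange : ∀ a b c d → (a + b) + (c + d) ≡ (a + c) + (b + d)
+-interchange a b c d = begin
  (a + b) + (c + d)  ≡⟨ +-assoc a b (c + d) ⟩
  a + (b + (c + d))  ≡⟨ cong (a +_) (sym (+-assoc b c d)) ⟩
  a + ((b + c) + d)  ≡⟨ cong (λ u → a + (u + d)) (+-comm b c) ⟩
  a + ((c + b) + d)  ≡⟨ cong (a +_) (+-assoc c b d) ⟩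
  a + (c + (b + d))  ≡⟨ sym (+-assoc a c (b + d)) ⟩
  (a + c) + (b + d)  ∎

∑-+ : ∀ {A : Set} (xs : List A) (f g : A → ℕ) → ∑ xs (λ x → f x + g x) ≡ ∑ xs f + ∑ xs g
∑-+ []       f g = refl
∑-+ (x ∷ xs) f g = trans (cong (f x + g x +_) (∑-+ xs f g)) (+-interchange (f x) (g x) (∑ xs f) (∑ xs g))

∑-const : ∀ {A : Set} (xs : List A) c → ∑ xs (λ _ → c) ≡ length xs * c
∑-const []       c = refl
∑-const (x ∷ xs) c = cong (c +_) (∑-const xs c)

∑-0 : ∀ {A : Set} (xs : List A) → ∑ xs (λ _ → 0) ≡ 0
∑-0 xs = trans (∑-const xs 0) (*-zeroʳ (length xs))

∑-*ˡ : ∀ {A : Set} (xs : List A) c (f : A → ℕ) → ∑ xs (λ x → c * f x) ≡ c * ∑ xs f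
∑-*ˡ []       c f = sym (*-zeroʳ c)
∑-*ˡ (x ∷ xs) c f = trans (cong (c * f x +_) (∑-*ˡ xs c f)) (sym (*-distribˡ-+ c (f x) (∑ xs f)))

∑-*ʳ : ∀ {A : Set} (xs : List A) c (f : A → ℕ) → ∑ xs (λ x → f x * c) ≡ ∑ xs f * c
∑-*ʳ xs c f = trans (∑-cong xs (λ x → *-comm (f x) c)) (trans (∑-*ˡ xs c f) (*-comm c (∑ xs f)))

∑-swap : ∀ {A B : Set} (xs : List A) (ys : List B) (f : A → B → ℕ) →
         ∑ xs (λ x → ∑ ys (f x)) ≡ ∑ ys (λ y → ∑ xs (λ x → f x y))
∑-swap []       ys f = sym (∑-0 ys)
∑-swap (x ∷ xs) ys f = trans (cong (∑ ys (f x) +_) (∑-swap xs ys f)) (sym (∑-+ ys (f x) (λ y → ∑ xs (λ x → f x y))))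

∑-filter : ∀ {A : Set} {P : A → Set} (P? : Decidable P) (xs : List A) (f : A → ℕ) →
           ∑ (filter P? xs) f ≡ ∑ xs (λ x → 𝟙 (P? x) * f x)
∑-filter P? []       f = refl
∑-filter P? (x ∷ xs) f with does (P? x)
... | true  = cong₂ _+_ (sym (+-identityʳ (f x))) (∑-filter P? xs f)
... | false = ∑-filter P? xs f

length-∑ : ∀ {A : Set} (xs : List A) → length xs ≡ ∑ xs (λ _ → 1)
length-∑ xs = sym (trans (∑-const xs 1) (*-identityʳ (length xs)))

length-filter-∑ : ∀ {A : Set} {P : A → Set} (P? : Decidable P) (xs : List A) →
                  length (filter P? xs) ≡ ∑ xs (λ x → 𝟙 (P? x))
length-filter-∑ P? xs =
  trans (length-∑ (filter P? xs)) (trans (∑-filter P? xs (λ _ → 1)) (∑-cong xs (λ x → *-identityʳ (𝟙 (P? x)))))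

length-concatMap : ∀ {A B : Set} (g : A → List B) (xs : List A) →
                   length (concatMap g xs) ≡ ∑ xs (λ x → length (g x))
length-concatMap g xs =
  trans (length-∑ (concatMap g xs)) (trans (∑-concatMap g xs (λ _ → 1)) (∑-cong xs (λ x → sym (length-∑ (g x)))))

-- Enumeration of F₂ⁿ

allV : ∀ n → List (V n)
allV zero    = [] ∷ []
allV (suc n) = map (false ∷_) (allV n) List.++ map (true ∷_) (allV n)

∈-allV : ∀ {n} (x : V n) → x ∈ allV n
∈-allV []          = here refl
∈-allV (false ∷ x) = ∈-++⁺ˡ (∈-map⁺ (false ∷_) (∈-allV x))
∈-allV {suc n} (true ∷ x) = ∈-++⁺ʳ (map (false ∷_) (allV n)) (∈-map⁺ (true ∷_) (∈-allV x))

allV-unique : ∀ n → Unique (allV n)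
allV-unique zero    = [] ∷ []
allV-unique (suc n) = Uniq.++⁺ (Uniq.map⁺ ∷-injectiveʳ (allV-unique n)) (Uniq.map⁺ ∷-injectiveʳ (allV-unique n)) disjoint
  where
  disjoint : ∀ {x} → x ∈ map (false ∷_) (allV n) × x ∈ map (true ∷_) (allV n) → ⊥
  disjoint (p , q) with ∈-map⁻ (false ∷_) p | ∈-map⁻ (true ∷_) q
  ... | _ , _ , refl | _ , _ , ()

length-allV : ∀ n → length (allV n) ≡ 2 ^ n
length-allV n = trans (length-∑ (allV n)) (go n)
  where
  go : ∀ n → ∑ (allV n) (λ _ → 1) ≡ 2 ^ n
  go zero    = refl
  go (suc n) = trans (∑-++ (map (false ∷_) (allV n)) _ _)
    (trans (cong₂ _+_ (trans (∑-map (false ∷_) (allV n) _) (go n)) (trans (∑-map (true ∷_) (allV n) _) (go n)))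
           (cong (2 ^ n +_) (sym (+-identityʳ (2 ^ n)))))

unique-set⇒↭ : ∀ {A : Set} {xs ys : List A} → Unique xs → Unique ys →
               (∀ {x} → x ∈ xs → x ∈ ys) → (∀ {x} → x ∈ ys → x ∈ xs) → xs ↭ ys
unique-set⇒↭ ux uy f g = ∼bag⇒↭ (unique∧set⇒bag ux uy (mk⇔ f g))

∑-bij : ∀ {m n} (f : V m → V n) (g : V n → V m) → (∀ x → f (g x) ≡ x) → (∀ x → g (f x) ≡ x) →
        (h : V n → ℕ) → ∑ (allV m) (h ∘ f) ≡ ∑ (allV n) h
∑-bij {m} {n} f g fg gf h = trans (sym (∑-map f (allV m) h)) (sum-↭ (map⁺ h perm))
  where
  f-inj : ∀ {x y} → f x ≡ f y → x ≡ y
  f-inj {x} {y} eq = trans (sym (gf x)) (trans (cong g eq) (gf y))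
  perm : map f (allV m) ↭ allV n
  perm = unique-set⇒↭ (Uniq.map⁺ f-inj (allV-unique m)) (allV-unique n) (λ {x} _ → ∈-allV x)
           (λ {x} _ → subst (_∈ map f (allV m)) (fg x) (∈-map⁺ f (∈-allV (g x))))

-- All counts below are sums of this symbol, so that sums can be exchanged and then collapsed.
δ : ∀ {n} → V n → V n → ℕ
δ x y = 𝟙 (x ≟V y)

∑-δ-notin : ∀ {n} (y : V n) (xs : List (V n)) (h : V n → ℕ) → y ∉ xs → ∑ xs (λ x → δ y x * h x) ≡ 0
∑-δ-notin y xs h y∉ = trans (∑-cong-∈ xs (λ {x} x∈ → cong (_* h x) (𝟙-no (y ≟V x) (λ { refl → y∉ x∈ })))) (∑-0 xs)

∑-δ-unique : ∀ {n} (y : V n) {xs : List (V n)} (h : V n → ℕ) → Unique xs → y ∈ xs →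
             ∑ xs (λ x → δ y x * h x) ≡ h y
∑-δ-unique y {x ∷ xs} h (x∉ ∷ u) (here refl) =
  trans (cong₂ _+_ (trans (cong (_* h y) (𝟙-yes (y ≟V y) refl)) (+-identityʳ (h y)))
                   (∑-δ-notin y xs h (λ y∈ → All.lookup x∉ y∈ refl)))
        (+-identityʳ (h y))
∑-δ-unique y {x ∷ xs} h (x∉ ∷ u) (there y∈) =
  trans (cong (λ z → z * h x + ∑ xs (λ x → δ y x * h x)) (𝟙-no (y ≟V x) (λ { refl → All.lookup x∉ y∈ refl })))
        (∑-δ-unique y h u y∈)

∑-δ : ∀ {n} (y : V n) (h : V n → ℕ) → ∑ (allV n) (λ x → δ y x * h x) ≡ h y
∑-δ {n} y h = ∑-δ-unique y h (allV-unique n) (∈-allV y)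

∑-δ-bij : ∀ {m n} (f : V m → V n) (g : V n → V m) → (∀ x → f (g x) ≡ x) → (∀ x → g (f x) ≡ x) →
          (y : V n) (h : V m → ℕ) → ∑ (allV m) (λ x → δ y (f x) * h x) ≡ h (g y)
∑-δ-bij {m} {n} f g fg gf y h = trans (∑-cong (allV m) (λ x → cong (_* h x) (lem x))) (∑-δ (g y) h)
  where
  lem : ∀ x → δ y (f x) ≡ δ (g y) x
  lem x = 𝟙-cong (y ≟V f x) (g y ≟V x) (λ { refl → gf x }) (λ { refl → sym (fg y) })

-- Exhaustive checks over F₂ⁿ

∀? : ∀ n {P : V n → Set} → Decidable P → Dec (∀ x → P x)
∀? zero    P? = map′ (λ { p [] → p }) (λ f → f []) (P? [])
∀? (suc n) P? = map′ (λ { (f , g) (false ∷ x) → f x ; (f , g) (true ∷ x) → g x }) (λ f → (f ∘ (false ∷_)) , (f ∘ (true ∷_)))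
                     (∀? n (P? ∘ (false ∷_)) ×-dec ∀? n (P? ∘ (true ∷_)))

does-true : ∀ {P : Set} (d : Dec P) → does d ≡ true → P
does-true (yes p) _ = p

check : ∀ n {P : V n → Set} (P? : Decidable P) → does (∀? n P?) ≡ true → ∀ x → P x
check n P? = does-true (∀? n P?)

-- Polynomials in a linear operator, binary fields and their vector spaces

-- horner T c x is p(T) x for the polynomial p with coefficient vector c.
horner : ∀ {d n} → (V n → V n) → V d → V n → V n
horner T []      x = 0v
horner T (s ∷ c) x = s · x ⊕ T (horner T c x)

module _ {n} {T : V n → V n} (T-add : Additive T) where

  horner-⊕ˡ : ∀ {d} (c e : V d) x → horner T (c ⊕ e) x ≡ horner T c x ⊕ horner T e x
  horner-⊕ˡ []      []      x = sym (⊕-identityˡ 0v)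
  horner-⊕ˡ (s ∷ c) (t ∷ e) x = trans
    (cong₂ _⊕_ (·-xor s t x) (trans (cong T (horner-⊕ˡ c e x)) (T-add (horner T c x) (horner T e x))))
    (⊕-interchange (s · x) (t · x) (T (horner T c x)) (T (horner T e x)))

  -- Induction on the coefficients. Most of the algebra below is an instance: `L` = `_• x` gives
  -- associativity, `L` = `e •_` commutativity of scalars, and `L` a projection the linearity of
  -- coordinates.
  horner-intertwine : ∀ {m d} {S : V m → V m} {L : V m → V n} → Additive L → (∀ x → L (S x) ≡ T (L x)) →
                      (c : V d) → ∀ x → L (horner S c x) ≡ horner T c (L x)
  horner-intertwine L-add LS []      x = additive-0 L-add
  horner-intertwine {S = S} L-add LS (s ∷ c) x = trans (L-add (s · x) (S (horner S c x)))
    (cong₂ _⊕_ (additive-· L-add s x) (trans (LS (horner S c x)) (cong T (horner-intertwine L-add LS c x))))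

horner-⊕ʳ : ∀ {d n} {T : V n → V n} → Additive T → (c : V d) → Additive (horner T c)
horner-⊕ʳ T-add []      x y = sym (⊕-identityˡ 0v)
horner-⊕ʳ {T = T} T-add (s ∷ c) x y = trans
  (cong₂ _⊕_ (·-distrib s x y) (trans (cong T (horner-⊕ʳ T-add c x y)) (T-add (horner T c x) (horner T c y))))
  (⊕-interchange (s · x) (s · y) (T (horner T c x)) (T (horner T c y)))

-- A binary field F₂[S]: S is multiplication by a root of the defining polynomial.
record BinaryField (d : ℕ) : Set where
  field
    S       : V d → V d
    S-add   : Additive S
    one     : V d
    one-S   : ∀ x → horner S one x ≡ x
    S-one   : ∀ c → horner S c one ≡ c
    S-shift : ∀ c x → horner S (S c) x ≡ S (horner S c x)
    inv     : V d → V d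
    inv-one : ∀ c → c ≢ 0v → horner S (inv c) c ≡ one
    one≢0   : one ≢ 0v

-- The whole scalar action is encoded by the operator `T` of the generator: the scalar `c` acts as
-- the polynomial c(T). `T-shift` says that `T` respects the reduction which `S` performs on
-- coefficients, that is, `T` satisfies the defining polynomial of the field.
record VectorSpace {d} (F : BinaryField d) (n : ℕ) : Set where
  open BinaryField F
  field
    T       : V n → V n
    T-add   : Additive T
    one-T   : ∀ x → horner T one x ≡ x
    T-shift : ∀ c x → horner T (S c) x ≡ T (horner T c x)

  infixr 7 _•_
  _•_ : V d → V n → V n
  c • x = horner T c x

  •-distribʳ : ∀ c e x → (c ⊕ e) • x ≡ c • x ⊕ e • x
  •-distribʳ c e x = horner-⊕ˡ T-add c e x

  •-distribˡ : ∀ c x y → c • (x ⊕ y) ≡ c • x ⊕ c • y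
  •-distribˡ c = horner-⊕ʳ T-add c

  •-zeroʳ : ∀ c → c • 0v ≡ 0v
  •-zeroʳ c = additive-0 (•-distribˡ c)

  •-zeroˡ : ∀ x → 0v • x ≡ 0v
  •-zeroˡ x = additive-0 {L = _• x} (λ c e → •-distribʳ c e x)

  •-assoc : ∀ c e x → horner S c e • x ≡ c • (e • x)
  •-assoc c e x = horner-intertwine T-add {L = _• x} (λ c e → •-distribʳ c e x) (λ c → T-shift c x) c e

  •-comm : ∀ c e x → c • (e • x) ≡ e • (c • x)
  •-comm c e x = sym (horner-intertwine T-add (•-distribˡ e)
    (λ x → sym (horner-intertwine T-add T-add (λ _ → refl) e x)) c x)

  •-inverse : ∀ {c} → c ≢ 0v → ∀ x → inv c • (c • x) ≡ x
  •-inverse {c} c≢0 x = trans (sym (•-assoc (inv c) c x)) (trans (cong (_• x) (inv-one c c≢0)) (one-T x))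

  •-inverseʳ : ∀ {c} → c ≢ 0v → ∀ x → c • (inv c • x) ≡ x
  •-inverseʳ {c} c≢0 x = trans (•-comm c (inv c) x) (•-inverse c≢0 x)

  •-nonzero : ∀ {c x} → c ≢ 0v → x ≢ 0v → c • x ≢ 0v
  •-nonzero {c} {x} c≢0 x≢0 eq = x≢0 (trans (sym (•-inverse c≢0 x)) (trans (cong (inv c •_) eq) (•-zeroʳ (inv c))))

  •-injective : ∀ {c x y} → c ≢ 0v → c • x ≡ c • y → x ≡ y
  •-injective {c} {x} {y} c≢0 eq = trans (sym (•-inverse c≢0 x)) (trans (cong (inv c •_) eq) (•-inverse c≢0 y))

  •-injectiveˡ : ∀ {c e x} → x ≢ 0v → c • x ≡ e • x → c ≡ e
  •-injectiveˡ {c} {e} {x} x≢0 eq with c ≟V e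
  ... | yes c≡e = c≡e
  ... | no  c≢e = ⊥-elim (•-nonzero (c≢e ∘ ⊕-≡0⇒≡) x≢0 (trans (•-distribʳ c e x) (≡⇒⊕-≡0 eq)))

module FieldLaws {d} (F : BinaryField d) where
  open BinaryField F

  self : VectorSpace F d
  self = record { T = S ; T-add = S-add ; one-T = one-S ; T-shift = S-shift }

  open VectorSpace self public using () renaming
    ( _•_ to _⊙_ ; •-distribʳ to ⊙-distribʳ ; •-distribˡ to ⊙-distribˡ ; •-zeroʳ to ⊙-zeroʳ ; •-zeroˡ to ⊙-zeroˡ
    ; •-assoc to ⊙-assoc ; •-comm to ⊙-comm₃ ; •-inverse to ⊙-inverse ; •-inverseʳ to ⊙-inverseʳ
    ; •-nonzero to ⊙-nonzero ; •-injective to ⊙-injective )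

  ⊙-comm : ∀ c e → c ⊙ e ≡ e ⊙ c
  ⊙-comm c e = trans (cong (c ⊙_) (sym (S-one e))) (trans (⊙-comm₃ c e one) (cong (e ⊙_) (S-one c)))

  inv-nonzero : ∀ {c} → c ≢ 0v → inv c ≢ 0v
  inv-nonzero {c} c≢0 eq = one≢0 (trans (sym (inv-one c c≢0)) (trans (cong (_⊙ c) eq) (⊙-zeroˡ c)))

-- The fields F₆₄ and F₁₂₈

-- F₆₄ = F₂[γ] with γ⁶ = γ + 1, and multiplication by γ on F₆₄ᵏ.
γ* : ∀ k → V (k * 6) → V (k * 6)
γ* zero    []                              = []
γ* (suc k) (a ∷ b ∷ c ∷ d ∷ e ∷ f ∷ x) = f ∷ (a xor f) ∷ b ∷ c ∷ d ∷ e ∷ γ* k x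

-- F₁₂₈ = F₂[η] with η⁷ = η + 1.
η* : V 7 → V 7
η* (a ∷ b ∷ c ∷ d ∷ e ∷ f ∷ g ∷ []) = g ∷ (a xor g) ∷ b ∷ c ∷ d ∷ e ∷ f ∷ []

xor-interchange : ∀ a b f g → ((a xor b) xor (f xor g)) ≡ ((a xor f) xor (b xor g))
xor-interchange false false f g = refl
xor-interchange false true false g = refl
xor-interchange false true true false = refl
xor-interchange false true true true = refl
xor-interchange true false false g = refl
xor-interchange true false true false = refl
xor-interchange true false true true = refl
xor-interchange true true false false = refl
xor-interchange true true false true = refl
xor-interchange true true true g = refl

γ*-add : ∀ k → Additive (γ* k)
γ*-add zero    []                          []                                = refl
γ*-add (suc k) (a ∷ b ∷ c ∷ d ∷ e ∷ f ∷ x) (a′ ∷ b′ ∷ c′ ∷ d′ ∷ e′ ∷ f′ ∷ x′) =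
  cong₂ (λ s y → (f xor f′) ∷ s ∷ (b xor b′) ∷ (c xor c′) ∷ (d xor d′) ∷ (e xor e′) ∷ y)
        (xor-interchange a a′ f f′) (γ*-add k x x′)

η*-add : Additive η*
η*-add (a ∷ b ∷ c ∷ d ∷ e ∷ f ∷ g ∷ []) (a′ ∷ b′ ∷ c′ ∷ d′ ∷ e′ ∷ f′ ∷ g′ ∷ []) =
  cong (λ s → (g xor g′) ∷ s ∷ (b xor b′) ∷ (c xor c′) ∷ (d xor d′) ∷ (e xor e′) ∷ (f xor f′) ∷ [])
       (xor-interchange a a′ g g′)

iterate : ∀ {n} → (V n → V n) → ℕ → V n → V n
iterate T zero    x = x
iterate T (suc i) x = T (iterate T i x)

-- The relation γ⁶ = γ + 1 is checked on the 64 values of one block; `γ*` acts block by block.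
γ*-minimal : ∀ k x → iterate (γ* k) 6 x ≡ x ⊕ γ* k x
γ*-minimal zero    []                          = refl
γ*-minimal (suc k) (a ∷ b ∷ c ∷ d ∷ e ∷ f ∷ x) =
  cong₂ _++_ (check 6 (λ h → iterate (γ* 1) 6 h ≟V (h ⊕ γ* 1 h)) refl (a ∷ b ∷ c ∷ d ∷ e ∷ f ∷ [])) (γ*-minimal k x)

e₀ : ∀ {d} → V (suc d)
e₀ = true ∷ 0v

horner-0 : ∀ {n} {T : V n → V n} → Additive T → ∀ d x → horner T (0v {d}) x ≡ 0v
horner-0 T-add zero    x = refl
horner-0 {T = T} T-add (suc d) x =
  trans (⊕-identityˡ _) (trans (cong T (horner-0 T-add d x)) (additive-0 T-add))

horner-one : ∀ {n} {T : V n → V n} → Additive T → ∀ d x → horner T (e₀ {d}) x ≡ x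
horner-one {T = T} T-add d x =
  trans (cong (λ y → x ⊕ T y) (horner-0 T-add d x)) (trans (cong (x ⊕_) (additive-0 T-add)) (⊕-identityʳ x))

powers : ∀ {n} → (V n → V n) → ∀ d → V n → Vec (V n) d
powers T zero    x = []
powers T (suc d) x = x ∷ powers T d (T x)

horner-powers : ∀ {d n} {T : V n → V n} → Additive T → (c : V d) → ∀ x → horner T c x ≡ lc c (powers T d x)
horner-powers T-add []      x = refl
horner-powers {T = T} T-add (s ∷ c) x =
  cong (s · x ⊕_) (trans (horner-intertwine T-add T-add (λ _ → refl) c x) (horner-powers T-add c (T x)))

-- On the left the top coefficient `c₅` reappears in degrees 0 and 1; on the right it multiplies
-- T⁶x, which is x + Tx. The other coefficients just move up by one degree.
γ*-shift : ∀ {n} {T : V n → V n} → Additive T → (∀ x → iterate T 6 x ≡ x ⊕ T x) →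
           ∀ c x → horner T (γ* 1 c) x ≡ T (horner T c x)
γ*-shift {T = T} T-add T-min c@(c₀ ∷ c₁ ∷ c₂ ∷ c₃ ∷ c₄ ∷ c₅ ∷ []) x = begin
  horner T (γ* 1 c) x
    ≡⟨ horner-powers T-add (γ* 1 c) x ⟩
  lc (γ* 1 c) (powers T 6 x)
    ≡⟨ cong (λ z → c₅ · y₀ ⊕ (z ⊕ (c₁ · y₂ ⊕ (c₂ · y₃ ⊕ (c₃ · y₄ ⊕ (c₄ · y₅ ⊕ 0v)))))) (·-xor c₀ c₅ y₁) ⟩
  c₅ · y₀ ⊕ ((c₀ · y₁ ⊕ c₅ · y₁) ⊕ (c₁ · y₂ ⊕ (c₂ · y₃ ⊕ (c₃ · y₄ ⊕ (c₄ · y₅ ⊕ 0v)))))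
    ≡⟨ ⊕-solve (var (# 0) ⊞ ((var (# 1) ⊞ var (# 2)) ⊞ (var (# 3) ⊞ (var (# 4) ⊞ (var (# 5) ⊞ (var (# 6) ⊞ 𝟘))))))
               (var (# 1) ⊞ (var (# 3) ⊞ (var (# 4) ⊞ (var (# 5) ⊞ (var (# 6) ⊞ ((var (# 0) ⊞ var (# 2)) ⊞ 𝟘)))))) refl
               (c₅ · y₀ ∷ c₀ · y₁ ∷ c₅ · y₁ ∷ c₁ · y₂ ∷ c₂ · y₃ ∷ c₃ · y₄ ∷ c₄ · y₅ ∷ []) ⟩
  c₀ · y₁ ⊕ (c₁ · y₂ ⊕ (c₂ · y₃ ⊕ (c₃ · y₄ ⊕ (c₄ · y₅ ⊕ ((c₅ · y₀ ⊕ c₅ · y₁) ⊕ 0v)))))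
    ≡⟨ cong (λ z → c₀ · y₁ ⊕ (c₁ · y₂ ⊕ (c₂ · y₃ ⊕ (c₃ · y₄ ⊕ (c₄ · y₅ ⊕ (z ⊕ 0v))))))
         (trans (sym (·-distrib c₅ y₀ y₁)) (cong (c₅ ·_) (sym (T-min x)))) ⟩
  lc c (powers T 6 (T x))
    ≡⟨ sym (horner-powers T-add c (T x)) ⟩
  horner T c (T x)
    ≡⟨ sym (horner-intertwine T-add T-add (λ _ → refl) c x) ⟩
  T (horner T c x) ∎
  where
  y₀ = x
  y₁ = T y₀
  y₂ = T y₁
  y₃ = T y₂
  y₄ = T y₃
  y₅ = T y₄

η*-shift : ∀ {n} {T : V n → V n} → Additive T → (∀ x → iterate T 7 x ≡ x ⊕ T x) →
           ∀ c x → horner T (η* c) x ≡ T (horner T c x)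
η*-shift {T = T} T-add T-min c@(c₀ ∷ c₁ ∷ c₂ ∷ c₃ ∷ c₄ ∷ c₅ ∷ c₆ ∷ []) x = begin
  horner T (η* c) x
    ≡⟨ horner-powers T-add (η* c) x ⟩
  lc (η* c) (powers T 7 x)
    ≡⟨ cong (λ z → c₆ · y₀ ⊕ (z ⊕ (c₁ · y₂ ⊕ (c₂ · y₃ ⊕ (c₃ · y₄ ⊕ (c₄ · y₅ ⊕ (c₅ · y₆ ⊕ 0v))))))) (·-xor c₀ c₆ y₁) ⟩
  c₆ · y₀ ⊕ ((c₀ · y₁ ⊕ c₆ · y₁) ⊕ (c₁ · y₂ ⊕ (c₂ · y₃ ⊕ (c₃ · y₄ ⊕ (c₄ · y₅ ⊕ (c₅ · y₆ ⊕ 0v))))))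
    ≡⟨ ⊕-solve (var (# 0) ⊞ ((var (# 1) ⊞ var (# 2)) ⊞ (var (# 3) ⊞ (var (# 4) ⊞ (var (# 5) ⊞ (var (# 6) ⊞ (var (# 7) ⊞ 𝟘)))))))
               (var (# 1) ⊞ (var (# 3) ⊞ (var (# 4) ⊞ (var (# 5) ⊞ (var (# 6) ⊞ (var (# 7) ⊞ ((var (# 0) ⊞ var (# 2)) ⊞ 𝟘))))))) refl
               (c₆ · y₀ ∷ c₀ · y₁ ∷ c₆ · y₁ ∷ c₁ · y₂ ∷ c₂ · y₃ ∷ c₃ · y₄ ∷ c₄ · y₅ ∷ c₅ · y₆ ∷ []) ⟩
  c₀ · y₁ ⊕ (c₁ · y₂ ⊕ (c₂ · y₃ ⊕ (c₃ · y₄ ⊕ (c₄ · y₅ ⊕ (c₅ · y₆ ⊕ ((c₆ · y₀ ⊕ c₆ · y₁) ⊕ 0v))))))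
    ≡⟨ cong (λ z → c₀ · y₁ ⊕ (c₁ · y₂ ⊕ (c₂ · y₃ ⊕ (c₃ · y₄ ⊕ (c₄ · y₅ ⊕ (c₅ · y₆ ⊕ (z ⊕ 0v)))))))
         (trans (sym (·-distrib c₆ y₀ y₁)) (cong (c₆ ·_) (sym (T-min x)))) ⟩
  lc c (powers T 7 (T x))
    ≡⟨ sym (horner-powers T-add c (T x)) ⟩
  horner T c (T x)
    ≡⟨ sym (horner-intertwine T-add T-add (λ _ → refl) c x) ⟩
  T (horner T c x) ∎
  where
  y₀ = x
  y₁ = T y₀
  y₂ = T y₁
  y₃ = T y₂
  y₄ = T y₃
  y₅ = T y₄
  y₆ = T y₅

square : ∀ {n} → (V n → V n) → V n → V n
square T x = horner T x x

-- geometric T j c is c ^ (2 + 4 + … + 2ʲ), so j = d − 1 gives the Fermat inverse in a field of order 2ᵈ.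
geometric : ∀ {d} → (V (suc d) → V (suc d)) → ℕ → V (suc d) → V (suc d)
geometric T zero    c = e₀
geometric T (suc j) c = square T (horner T (geometric T j c) c)

F₆₄ : BinaryField 6
F₆₄ = record
  { S = γ* 1 ; S-add = γ*-add 1 ; one = e₀ ; one-S = horner-one (γ*-add 1) 5
  ; S-one = check 6 (λ c → horner (γ* 1) c e₀ ≟V c) refl
  ; S-shift = γ*-shift (γ*-add 1) (γ*-minimal 1)
  ; inv = geometric (γ* 1) 5
  ; inv-one = check 6 (λ c → ¬? (c ≟V 0v) →-dec (horner (γ* 1) (geometric (γ* 1) 5 c) c ≟V e₀)) refl
  ; one≢0 = λ () }

F₁₂₈ : BinaryField 7
F₁₂₈ = record
  { S = η* ; S-add = η*-add ; one = e₀ ; one-S = horner-one η*-add 6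
  ; S-one = check 7 (λ c → horner η* c e₀ ≟V c) refl
  ; S-shift = η*-shift η*-add (check 7 (λ x → iterate η* 7 x ≟V (x ⊕ η* x)) refl)
  ; inv = geometric η* 6
  ; inv-one = check 7 (λ c → ¬? (c ≟V 0v) →-dec (horner η* (geometric η* 6 c) c ≟V e₀)) refl
  ; one≢0 = λ () }

space : ∀ k → VectorSpace F₆₄ (k * 6)
space k = record { T = γ* k ; T-add = γ*-add k ; one-T = horner-one (γ*-add k) 5
                 ; T-shift = γ*-shift (γ*-add k) (γ*-minimal k) }

-- Triples of vertices, sides and covered points in coordinates

-- A triangle is given by the triple of its vertices; the points of its plane have coordinates in F₂³, and a
-- point lies on the side opposite to vertex i when its i-th coordinate vanishes.

Triple : ℕ → Set
Triple n = Vec (V n) 3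

Indep : ∀ {n} → Triple n → Set
Indep ρ = ∀ c → lc c ρ ≡ 0v → c ≡ 0v

record OnSide {n} (u v : V n) (ρ : Triple n) : Set where
  constructor onSide
  field
    side    : Fin 3
    cu cv   : V 3
    u≡      : u ≡ lc cu ρ
    v≡      : v ≡ lc cv ρ
    cu-zero : lookup cu side ≡ false
    cv-zero : lookup cv side ≡ false

-- Over F₂ this is linear independence, in a form decided by three comparisons.
Good : ∀ {n} → V n × V n → Set
Good (u , v) = u ≢ 0v × v ≢ 0v × u ≢ v

good? : ∀ {n} → Decidable (Good {n})
good? (u , v) = ¬? (u ≟V 0v) ×-dec (¬? (v ≟V 0v) ×-dec ¬? (u ≟V v))

onSide-swap : ∀ {n} {u v : V n} {ρ} → OnSide u v ρ → OnSide v u ρ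
onSide-swap (onSide i cu cv u≡ v≡ zu zv) = onSide i cv cu v≡ u≡ zv zu

onSide-add : ∀ {n} {u v : V n} {ρ} → OnSide u v ρ → OnSide u (u ⊕ v) ρ
onSide-add {ρ = ρ} (onSide i cu cv u≡ v≡ zu zv) = onSide i cu (cu ⊕ cv) u≡
  (trans (cong₂ _⊕_ u≡ v≡) (sym (lc-⊕ cu cv ρ))) zu
  (trans (lookup-zipWith _xor_ i cu cv) (cong₂ _xor_ zu zv))

lc-map : ∀ {m n k} {L : V m → V n} → Additive L → (c : V k) (ρ : Vec (V m) k) → L (lc c ρ) ≡ lc c (Vec.map L ρ)
lc-map L-add []      []      = additive-0 L-add
lc-map {L = L} L-add (s ∷ c) (x ∷ ρ) =
  trans (L-add (s · x) (lc c ρ)) (cong₂ _⊕_ (additive-· L-add s x) (lc-map L-add c ρ))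

onSide-map : ∀ {m n} {L : V m → V n} → Additive L → ∀ {u v ρ} → OnSide u v ρ → OnSide (L u) (L v) (Vec.map L ρ)
onSide-map L-add {ρ = ρ} (onSide i cu cv refl refl zu zv) =
  onSide i cu cv (lc-map L-add cu ρ) (lc-map L-add cv ρ) zu zv

indep-map : ∀ {m n} {L : V m → V n} → Additive L → (∀ {x} → L x ≡ 0v → x ≡ 0v) → ∀ {ρ} → Indep ρ → Indep (Vec.map L ρ)
indep-map L-add ker {ρ} ind c eq = ind c (ker (trans (lc-map L-add c ρ) eq))

indep-lc-injective : ∀ {n} {ρ : Triple n} → Indep ρ → ∀ {c e} → lc c ρ ≡ lc e ρ → c ≡ e
indep-lc-injective {ρ = ρ} ind = additive-injective {L = λ c → lc c ρ} (λ c e → lc-⊕ c e ρ) (λ {c} → ind c)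

vertex₀ : ∀ {n} (p q r : V n) → p ≡ lc (true ∷ false ∷ false ∷ []) (p ∷ q ∷ r ∷ [])
vertex₀ p q r = ⊕-solve v₀ (v₀ ⊞ (𝟘 ⊞ (𝟘 ⊞ 𝟘))) refl (p ∷ q ∷ r ∷ [])

vertex₁ : ∀ {n} (p q r : V n) → q ≡ lc (false ∷ true ∷ false ∷ []) (p ∷ q ∷ r ∷ [])
vertex₁ p q r = ⊕-solve v₁ (𝟘 ⊞ (v₁ ⊞ (𝟘 ⊞ 𝟘))) refl (p ∷ q ∷ r ∷ [])

vertex₂ : ∀ {n} (p q r : V n) → r ≡ lc (false ∷ false ∷ true ∷ []) (p ∷ q ∷ r ∷ [])
vertex₂ p q r = ⊕-solve v₂ (𝟘 ⊞ (𝟘 ⊞ (v₂ ⊞ 𝟘))) refl (p ∷ q ∷ r ∷ [])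

side₀₁ : ∀ {n} {p q r : V n} → OnSide p q (p ∷ q ∷ r ∷ [])
side₀₁ {p = p} {q} {r} = onSide (# 2) (true ∷ false ∷ false ∷ []) (false ∷ true ∷ false ∷ []) (vertex₀ p q r) (vertex₁ p q r) refl refl

side₁₂ : ∀ {n} {p q r : V n} → OnSide q r (p ∷ q ∷ r ∷ [])
side₁₂ {p = p} {q} {r} = onSide (# 0) (false ∷ true ∷ false ∷ []) (false ∷ false ∷ true ∷ []) (vertex₁ p q r) (vertex₂ p q r) refl refl

side₂₀ : ∀ {n} {p q r : V n} → OnSide r p (p ∷ q ∷ r ∷ [])
side₂₀ {p = p} {q} {r} = onSide (# 1) (false ∷ false ∷ true ∷ []) (true ∷ false ∷ false ∷ []) (vertex₂ p q r) (vertex₀ p q r) refl refl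

-- Six of the seven points of the Fano plane: the sum of all three vertices is the only one on no
-- side.
coveredPoints : List (V 3)
coveredPoints = filter (λ c → ¬? (c ≟V 0v) ×-dec ¬? (c ≟V (true ∷ true ∷ true ∷ []))) (allV 3)

occurrences : ∀ {n} → V n → Triple n → ℕ
occurrences x ρ = ∑ coveredPoints (λ c → δ x (lc c ρ))

SharedZero : V 3 × V 3 → Set
SharedZero (c , e) = ∃ λ i → lookup c i ≡ false × lookup e i ≡ false

sharedZero? : Decidable SharedZero
sharedZero? (c , e) = Finₚ.any? (λ i → (lookup c i ≟ᵇ false) ×-dec (lookup e i ≟ᵇ false))

sidePair? : Decidable (λ p → Good p × SharedZero p)
sidePair? p = good? p ×-dec sharedZero? p

-- There are 18 entries: three sides, each with the six ordered pairs of its three nonzero points.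
pairs₃ : List (V 3 × V 3)
pairs₃ = filter sidePair? (cartesianProduct (allV 3) (allV 3))

lc² : ∀ {n} → Triple n → V 3 × V 3 → V n × V n
lc² ρ (c , e) = lc c ρ , lc e ρ

sidePairs : ∀ {n} → Triple n → List (V n × V n)
sidePairs ρ = map (lc² ρ) pairs₃

goodPairs : ∀ n → List (V n × V n)
goodPairs n = filter good? (cartesianProduct (allV n) (allV n))

∈-goodPairs : ∀ {n} {p : V n × V n} → Good p → p ∈ goodPairs n
∈-goodPairs {p = u , v} g = ∈-filter⁺ good? (∈-cartesianProduct⁺ (∈-allV u) (∈-allV v)) g

goodPairs-unique : ∀ n → Unique (goodPairs n)
goodPairs-unique n = Uniq.filter⁺ good? (Uniq.cartesianProduct⁺ (allV-unique n) (allV-unique n))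

∈-goodPairs⁻ : ∀ {n} {p : V n × V n} → p ∈ goodPairs n → Good p
∈-goodPairs⁻ {n} p∈ = proj₂ (∈-filter⁻ good? {xs = cartesianProduct (allV n) (allV n)} p∈)

∑-cartesianProduct : ∀ {A B : Set} (xs : List A) (ys : List B) (f : A × B → ℕ) →
                     ∑ (cartesianProduct xs ys) f ≡ ∑ xs (λ x → ∑ ys (λ y → f (x , y)))
∑-cartesianProduct []       ys f = refl
∑-cartesianProduct (x ∷ xs) ys f = trans (∑-++ (map (x ,_) ys) _ f)
  (cong₂ _+_ (∑-map (x ,_) ys f) (∑-cartesianProduct xs ys f))

∑-δ₁ : ∀ {n} (y : V n) → ∑ (allV n) (δ y) ≡ 1
∑-δ₁ {n} y = trans (∑-cong (allV n) (λ x → sym (*-identityʳ (δ y x)))) (∑-δ y (λ _ → 1))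

∑-1 : ∀ n → ∑ (allV n) (λ _ → 1) ≡ 2 ^ n
∑-1 n = trans (sym (length-∑ (allV n))) (length-allV n)

-- The number of pairs is (N - 1)(N - 2) = N² - 3N + 2 for N = 2ⁿ; the term 3N stands on the left to
-- avoid subtraction.
length-goodPairs : ∀ n → length (goodPairs n) + (2 ^ n * 2 + 2 ^ n) ≡ 2 ^ n * 2 ^ n + 2
length-goodPairs n = begin
  length (goodPairs n) + (N * 2 + N)
    ≡⟨ cong₂ _+_ (trans (length-filter-∑ good? (cartesianProduct (allV n) (allV n))) (∑-cartesianProduct (allV n) (allV n) _))
                 (cong₂ _+_ (sym (trans (∑-const (allV n) 2) (cong (_* 2) (length-allV n))))
                            (sym (trans (∑-*ʳ (allV n) N (δ 0v)) (trans (cong (_* N) (∑-δ₁ {n} 0v)) (*-identityˡ N))))) ⟩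
  ∑ (allV n) (λ u → ∑ (allV n) (g u)) + (∑ (allV n) (λ _ → 2) + ∑ (allV n) (λ u → δ 0v u * N))
    ≡⟨ cong (∑ (allV n) (λ u → ∑ (allV n) (g u)) +_) (sym (∑-+ (allV n) _ _)) ⟩
  ∑ (allV n) (λ u → ∑ (allV n) (g u)) + ∑ (allV n) (λ u → 2 + δ 0v u * N)
    ≡⟨ sym (∑-+ (allV n) _ _) ⟩
  ∑ (allV n) (λ u → ∑ (allV n) (g u) + (2 + δ 0v u * N))
    -- For `u` ≠ 0 just the two vectors 0 and `u` are excluded, for `u` = 0 all N of them. The
    -- correction brings each fibre to N, with an excess of 2 at `u` = 0.
    ≡⟨ ∑-cong (allV n) fibre ⟩
  ∑ (allV n) (λ u → N + δ 0v u * 2)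
    ≡⟨ ∑-+ (allV n) _ _ ⟩
  ∑ (allV n) (λ _ → N) + ∑ (allV n) (λ u → δ 0v u * 2)
    ≡⟨ cong₂ _+_ (trans (∑-const (allV n) N) (cong (_* N) (length-allV n))) (∑-δ {n} 0v (λ _ → 2)) ⟩
  N * N + 2 ∎
  where
  N = 2 ^ n
  g : V n → V n → ℕ
  g u v = 𝟙 (good? (u , v))
  term : ∀ u v → u ≢ 0v → g u v + (δ 0v v + δ u v) ≡ 1
  term u v u≢0 = go (v ≟V 0v) (u ≟V v)
    where
    go : Dec (v ≡ 0v) → Dec (u ≡ v) → g u v + (δ 0v v + δ u v) ≡ 1
    go (yes refl) (yes refl) = ⊥-elim (u≢0 refl)
    go (yes refl) (no u≢v)   = cong₂ _+_ (𝟙-no (good? (u , 0v)) (λ g → proj₁ (proj₂ g) refl))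
                                         (cong₂ _+_ (𝟙-yes (0v {n} ≟V 0v) refl) (𝟙-no (u ≟V 0v) u≢v))
    go (no v≢0)   (yes refl) = cong₂ _+_ (𝟙-no (good? (u , u)) (λ g → proj₂ (proj₂ g) refl))
                                         (cong₂ _+_ (𝟙-no (0v ≟V u) (v≢0 ∘ sym)) (𝟙-yes (u ≟V u) refl))
    go (no v≢0)   (no u≢v)   = cong₂ _+_ (𝟙-yes (good? (u , v)) (u≢0 , v≢0 , u≢v))
                                         (cong₂ _+_ (𝟙-no (0v ≟V v) (v≢0 ∘ sym)) (𝟙-no (u ≟V v) u≢v))
  fibre : ∀ u → ∑ (allV n) (g u) + (2 + δ (0v {n}) u * N) ≡ N + δ (0v {n}) u * 2
  fibre u = go (u ≟V 0v)
    where
    go : Dec (u ≡ 0v) → ∑ (allV n) (g u) + (2 + δ (0v {n}) u * N) ≡ N + δ (0v {n}) u * 2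
    go (yes refl) = begin
      ∑ (allV n) (g (0v {n})) + (2 + δ (0v {n}) (0v {n}) * N)
        ≡⟨ cong₂ (λ s d → s + (2 + d * N))
             (trans (∑-cong (allV n) (λ v → 𝟙-no (good? (0v , v)) (λ g → proj₁ g refl))) (∑-0 (allV n)))
             (𝟙-yes (0v {n} ≟V 0v) refl) ⟩
      2 + (N + 0)
        ≡⟨ trans (cong (2 +_) (+-identityʳ N)) (+-comm 2 N) ⟩
      N + 1 * 2
        ≡⟨ cong (λ d → N + d * 2) (sym (𝟙-yes (0v {n} ≟V 0v) refl)) ⟩
      N + δ (0v {n}) (0v {n}) * 2 ∎
    go (no u≢0) = begin
      ∑ (allV n) (g u) + (2 + δ (0v {n}) u * N)
        ≡⟨ cong (λ d → ∑ (allV n) (g u) + (2 + d * N)) (𝟙-no (0v ≟V u) (u≢0 ∘ sym)) ⟩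
      ∑ (allV n) (g u) + 2
        ≡⟨ cong (∑ (allV n) (g u) +_) (sym (trans (∑-+ (allV n) (δ (0v {n})) (δ u)) (cong₂ _+_ (∑-δ₁ {n} 0v) (∑-δ₁ u)))) ⟩
      ∑ (allV n) (g u) + ∑ (allV n) (λ v → δ (0v {n}) v + δ u v)
        ≡⟨ sym (∑-+ (allV n) _ _) ⟩
      ∑ (allV n) (λ v → g u v + (δ (0v {n}) v + δ u v))
        ≡⟨ ∑-cong (allV n) (λ v → term u v u≢0) ⟩
      ∑ (allV n) (λ _ → 1)
        ≡⟨ ∑-1 n ⟩
      N ≡⟨ sym (+-identityʳ N) ⟩
      N + 0
        ≡⟨ cong (λ d → N + d * 2) (sym (𝟙-no (0v ≟V u) (u≢0 ∘ sym))) ⟩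
      N + δ (0v {n}) u * 2 ∎

onSide⇒∈ : ∀ {n} {u v : V n} {ρ} → Good (u , v) → OnSide u v ρ → (u , v) ∈ sidePairs ρ
onSide⇒∈ {ρ = ρ} (u≢0 , v≢0 , u≢v) (onSide i cu cv refl refl zu zv) =
  ∈-map⁺ (lc² ρ) (∈-filter⁺ sidePair? (∈-cartesianProduct⁺ (∈-allV cu) (∈-allV cv))
    (((λ { refl → u≢0 (lc-0 ρ) }) , (λ { refl → v≢0 (lc-0 ρ) }) , (λ { refl → u≢v refl })) , i , zu , zv))

∈⇒onSide : ∀ {n} {u v : V n} {ρ} → (u , v) ∈ sidePairs ρ → OnSide u v ρ
∈⇒onSide {ρ = ρ} p with ∈-map⁻ (lc² ρ) p
... | (cu , cv) , c∈ , refl with ∈-filter⁻ sidePair? {xs = cartesianProduct (allV 3) (allV 3)} c∈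
... | _ , (_ , i , zu , zv) = onSide i cu cv refl refl zu zv

∈⇒good : ∀ {n} {u v : V n} {ρ} → Indep ρ → (u , v) ∈ sidePairs ρ → Good (u , v)
∈⇒good {ρ = ρ} ind p with ∈-map⁻ (lc² ρ) p
... | (cu , cv) , c∈ , refl with ∈-filter⁻ sidePair? {xs = cartesianProduct (allV 3) (allV 3)} c∈
... | _ , ((cu≢0 , cv≢0 , cu≢cv) , _) = (λ eq → cu≢0 (ind cu eq)) , (λ eq → cv≢0 (ind cv eq)) , (λ eq → cu≢cv (indep-lc-injective ind eq))

sidePairs-unique : ∀ {n} {ρ : Triple n} → Indep ρ → Unique (sidePairs ρ)
sidePairs-unique {ρ = ρ} ind = Uniq.map⁺ inj (Uniq.filter⁺ sidePair? (Uniq.cartesianProduct⁺ (allV-unique 3) (allV-unique 3)))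
  where
  inj : ∀ {p q} → lc² ρ p ≡ lc² ρ q → p ≡ q
  inj {c , e} {c′ , e′} eq = cong₂ _,_ (indep-lc-injective ind (cong proj₁ eq)) (indep-lc-injective ind (cong proj₂ eq))

length-sidePairs : ∀ {n} (ρ : Triple n) → length (sidePairs ρ) ≡ 18
length-sidePairs ρ = length-map (lc² ρ) pairs₃

-- Pigeonhole

∈-remove : ∀ {A : Set} {x y : A} (as : List A) {bs} → y ≢ x → y ∈ as List.++ x ∷ bs → y ∈ as List.++ bs
∈-remove []       y≢x (here y≡x) = ⊥-elim (y≢x y≡x)
∈-remove []       y≢x (there y∈) = y∈
∈-remove (a ∷ as) y≢x (here y≡a) = here y≡a
∈-remove (a ∷ as) y≢x (there y∈) = there (∈-remove as y≢x y∈)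

length-insert : ∀ {A : Set} (as : List A) {x bs} → length (as List.++ x ∷ bs) ≡ suc (length (as List.++ bs))
length-insert []       = refl
length-insert (a ∷ as) = cong suc (length-insert as)

unique-⊆⇒length-≤ : ∀ {A : Set} {xs ys : List A} → Unique xs → (∀ {x} → x ∈ xs → x ∈ ys) → length xs ≤ length ys
unique-⊆⇒length-≤ {xs = []}     u        xs⊆ys = z≤n
unique-⊆⇒length-≤ {xs = x ∷ xs} (x∉ ∷ u) xs⊆ys with ∈-∃++ (xs⊆ys (here refl))
... | as , bs , refl = subst (suc (length xs) ≤_) (sym (length-insert as))
  (s≤s (unique-⊆⇒length-≤ u (λ y∈ → ∈-remove as (λ { refl → All.lookup x∉ y∈ refl }) (xs⊆ys (there y∈)))))

module _ {A : Set} (_≟_ : ∀ (x y : A) → Dec (x ≡ y)) where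

  -- If the head of `ys` occurred again, `xs` would be contained in the tail, which is too short.
  -- Otherwise the head is removed from both lists. This converts covering together with the right
  -- number of triangles into uniqueness.
  unique-of-length : ∀ {xs} (ys : List A) → Unique xs → (∀ {x} → x ∈ xs → x ∈ ys) → length ys ≤ length xs → Unique ys
  unique-of-length []       u xs⊆ys len = []
  unique-of-length {xs} (y ∷ ys) u xs⊆ys len =
    All.tabulate (λ z∈ → λ { refl → <-irrefl refl (≤-trans len (unique-⊆⇒length-≤ u (λ x∈ → drop-y z∈ (xs⊆ys x∈)))) }) ∷
    unique-of-length ys (Uniq.filter⁺ ≢y? u) xs′⊆ys (s≤s⁻¹ (≤-trans len (unique-⊆⇒length-≤ u xs⊆y∷xs′)))
    where
    ≢y? : Decidable (_≢ y)
    ≢y? x = ¬? (x ≟ y)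
    drop-y : ∀ {x} → y ∈ ys → x ∈ y ∷ ys → x ∈ ys
    drop-y y∈ (here refl) = y∈
    drop-y y∈ (there x∈)  = x∈
    xs′⊆ys : ∀ {x} → x ∈ filter ≢y? xs → x ∈ ys
    xs′⊆ys x∈ with ∈-filter⁻ ≢y? {xs = xs} x∈
    ... | x∈xs , x≢y with xs⊆ys x∈xs
    ... | here x≡y  = ⊥-elim (x≢y x≡y)
    ... | there x∈ys = x∈ys
    xs⊆y∷xs′ : ∀ {x} → x ∈ xs → x ∈ y ∷ filter ≢y? xs
    xs⊆y∷xs′ {x} x∈ with x ≟ y
    ... | yes x≡y = here x≡y
    ... | no  x≢y = there (∈-filter⁺ ≢y? x∈ x≢y)

unique-++⁻ : ∀ {A : Set} (xs : List A) {ys} → Unique (xs List.++ ys) → Unique ys × Disjoint xs ys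
unique-++⁻ []       u        = u , λ ()
unique-++⁻ (x ∷ xs) (x∉ ∷ u) with unique-++⁻ xs u
... | uy , disj = uy , λ { (here refl , z∈) → All.lookup x∉ (∈-++⁺ʳ xs z∈) refl ; (there z∈ , z∈′) → disj (z∈ , z∈′) }

unique-concat⁻ : ∀ {A : Set} (xss : List (List A)) → Unique (concat xss) → AllPairs Disjoint xss
unique-concat⁻ []         u = []
unique-concat⁻ (xs ∷ xss) u with unique-++⁻ xs u
... | u′ , disj = All.tabulate (λ ys∈ (z∈ , z∈′) → disj (z∈ , ∈-concat⁺′ z∈′ ys∈)) ∷ unique-concat⁻ xss u′

allPairs-map-∈ : ∀ {A : Set} {R S : A → A → Set} {xs : List A} → (∀ {x y} → x ∈ xs → y ∈ xs → R x y → S x y) →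
                 AllPairs R xs → AllPairs S xs
allPairs-map-∈ f []       = []
allPairs-map-∈ f (r ∷ rs) =
  All.tabulate (λ y∈ → f (here refl) (there y∈) (All.lookup r y∈)) ∷ allPairs-map-∈ (λ x∈ y∈ → f (there x∈) (there y∈)) rs

allPairs-lookup : ∀ {A : Set} {R : A → A → Set} {xs : List A} → AllPairs R xs →
                  ∀ {x y} → x ∈ xs → y ∈ xs → x ≡ y ⊎ (R x y ⊎ R y x)
allPairs-lookup (r ∷ rs) (here refl) (here refl) = inj₁ refl
allPairs-lookup (r ∷ rs) (here refl) (there y∈)  = inj₂ (inj₁ (All.lookup r y∈))
allPairs-lookup (r ∷ rs) (there x∈)  (here refl) = inj₂ (inj₂ (All.lookup r x∈))
allPairs-lookup (r ∷ rs) (there x∈)  (there y∈)  = allPairs-lookup rs x∈ y∈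

-- Translation between designs and lists of triples

vertices : ∀ {n} → Triangle n → Triple n
vertices t = a t ∷ b t ∷ c t ∷ []

good⇒indep₂ : ∀ {n} {u v : V n} → Good (u , v) → LinIndep₂ u v
good⇒indep₂ {u = u} {v} (u≢0 , v≢0 , u≢v) true  true  eq = ⊥-elim (u≢v (⊕-≡0⇒≡ eq))
good⇒indep₂ {u = u} {v} (u≢0 , v≢0 , u≢v) true  false eq = ⊥-elim (u≢0 (trans (sym (⊕-identityʳ u)) eq))
good⇒indep₂ {u = u} {v} (u≢0 , v≢0 , u≢v) false true  eq = ⊥-elim (v≢0 (trans (sym (⊕-identityˡ v)) eq))
good⇒indep₂ {u = u} {v} (u≢0 , v≢0 , u≢v) false false eq = refl , refl

indep₂⇒good : ∀ {n} {u v : V n} → LinIndep₂ u v → Good (u , v)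
indep₂⇒good {u = u} {v} ind =
  (λ { refl → case (proj₁ (ind true false (⊕-self 0v))) }) ,
  (λ { refl → case (proj₂ (ind false true (⊕-self 0v))) }) ,
  (λ { refl → case (proj₁ (ind true true (⊕-self _))) })
  where
  case : true ≡ false → ⊥
  case ()

lc-span : ∀ {n} s t (p q : V n) → s · p ⊕ t · q ≡ lc (s ∷ t ∷ []) (p ∷ q ∷ [])
lc-span s t p q = cong (s · p ⊕_) (sym (⊕-identityʳ (t · q)))

lc-· : ∀ {k n} s (c : V k) (ρ : Vec (V n) k) → lc (s · c) ρ ≡ s · lc c ρ
lc-· s c ρ = additive-· {L = λ c → lc c ρ} (λ c e → lc-⊕ c e ρ) s c

span-plane : ∀ (l m n : V 2) → Good (l , m) → n ∈⟨ l , m ⟩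
span-plane = does-true (∀? 2 λ l → ∀? 2 λ m → ∀? 2 λ n → good? (l , m) →-dec (n ∈⟨ l , m ⟩?)) refl

-- In coordinates `u` and `v` become two independent vectors of F₂², so every combination of `p` and
-- `q` is one of `u` and `v` by the finite check `span-plane`.
sameSpan : ∀ {n} {u v p q : V n} → Good (u , v) → u ∈⟨ p , q ⟩ → v ∈⟨ p , q ⟩ → SameSpan u v p q
sameSpan {u = u} {v} {p} {q} (u≢0 , v≢0 , u≢v) (l₁ , l₂ , u≡) (m₁ , m₂ , v≡) x = to , from
  where
  ρ = p ∷ q ∷ []
  l = l₁ ∷ l₂ ∷ []
  m = m₁ ∷ m₂ ∷ []
  u≡l : u ≡ lc l ρ
  u≡l = trans u≡ (lc-span l₁ l₂ p q)
  v≡m : v ≡ lc m ρ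
  v≡m = trans v≡ (lc-span m₁ m₂ p q)
  good : Good (l , m)
  good = (λ l≡0 → u≢0 (trans u≡l (trans (cong (λ z → lc z ρ) l≡0) (lc-0 ρ)))) ,
         (λ m≡0 → v≢0 (trans v≡m (trans (cong (λ z → lc z ρ) m≡0) (lc-0 ρ)))) ,
         (λ l≡m → u≢v (trans u≡l (trans (cong (λ z → lc z ρ) l≡m) (sym v≡m))))
  combine : ∀ s t → s · u ⊕ t · v ≡ lc (s · l ⊕ t · m) ρ
  combine s t = trans (cong₂ (λ y z → s · y ⊕ t · z) u≡l v≡m)
    (sym (trans (lc-⊕ (s · l) (t · m) ρ) (cong₂ _⊕_ (lc-· s l ρ) (lc-· t m ρ))))
  to : x ∈⟨ u , v ⟩ → x ∈⟨ p , q ⟩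
  to (s , t , x≡) = go (s · l ⊕ t · m) (combine s t)
    where
    go : ∀ z → s · u ⊕ t · v ≡ lc z ρ → x ∈⟨ p , q ⟩
    go (n₁ ∷ n₂ ∷ []) eq = n₁ , n₂ , trans x≡ (trans eq (sym (lc-span n₁ n₂ p q)))
  from : x ∈⟨ p , q ⟩ → x ∈⟨ u , v ⟩
  from (n₁ , n₂ , x≡) = go (span-plane l m (n₁ ∷ n₂ ∷ []) good)
    where
    go : (n₁ ∷ n₂ ∷ []) ∈⟨ l , m ⟩ → x ∈⟨ u , v ⟩
    go (s , t , n≡) = s , t , trans x≡ (trans (lc-span n₁ n₂ p q) (trans (cong (λ z → lc z ρ) n≡) (sym (combine s t))))

sameSpan⇒∈ : ∀ {n} {u v p q : V n} → SameSpan u v p q → u ∈⟨ p , q ⟩ × v ∈⟨ p , q ⟩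
sameSpan⇒∈ {u = u} {v} same =
  proj₁ (same u) (true , false , sym (⊕-identityʳ u)) , proj₁ (same v) (false , true , sym (⊕-identityˡ v))

sameSpan-trans : ∀ {n} {u v p q w z : V n} → SameSpan u v p q → SameSpan p q w z → SameSpan u v w z
sameSpan-trans f g x = proj₁ (g x) ∘ proj₁ (f x) , proj₂ (f x) ∘ proj₂ (g x)

sameSpan-refl : ∀ {n} {u v : V n} → SameSpan u v u v
sameSpan-refl x = id , id

span₀₁ : ∀ {n} s t (p q r : V n) → s · p ⊕ t · q ≡ lc (s ∷ t ∷ false ∷ []) (p ∷ q ∷ r ∷ [])
span₀₁ s t p q r = ⊕-solve (v₀ ⊞ v₁) (v₀ ⊞ (v₁ ⊞ (𝟘 ⊞ 𝟘))) refl (s · p ∷ t · q ∷ [])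

span₁₂ : ∀ {n} s t (p q r : V n) → s · q ⊕ t · r ≡ lc (false ∷ s ∷ t ∷ []) (p ∷ q ∷ r ∷ [])
span₁₂ s t p q r = ⊕-solve (v₀ ⊞ v₁) (𝟘 ⊞ (v₀ ⊞ (v₁ ⊞ 𝟘))) refl (s · q ∷ t · r ∷ [])

span₂₀ : ∀ {n} s t (p q r : V n) → s · r ⊕ t · p ≡ lc (t ∷ false ∷ s ∷ []) (p ∷ q ∷ r ∷ [])
span₂₀ s t p q r = ⊕-solve (v₀ ⊞ v₁) (v₁ ⊞ (𝟘 ⊞ (v₀ ⊞ 𝟘))) refl (s · r ∷ t · p ∷ [])

isSide⇒onSide : ∀ {n} {u v : V n} (t : Triangle n) → IsSideOf u v t → OnSide u v (vertices t)
isSide⇒onSide t (inj₁ same) with sameSpan⇒∈ same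
... | (s , s′ , u≡) , (r , r′ , v≡) =
  onSide (# 2) (s ∷ s′ ∷ false ∷ []) (r ∷ r′ ∷ false ∷ []) (trans u≡ (span₀₁ s s′ (a t) (b t) (c t))) (trans v≡ (span₀₁ r r′ (a t) (b t) (c t))) refl refl
isSide⇒onSide t (inj₂ (inj₁ same)) with sameSpan⇒∈ same
... | (s , s′ , u≡) , (r , r′ , v≡) =
  onSide (# 0) (false ∷ s ∷ s′ ∷ []) (false ∷ r ∷ r′ ∷ []) (trans u≡ (span₁₂ s s′ (a t) (b t) (c t))) (trans v≡ (span₁₂ r r′ (a t) (b t) (c t))) refl refl
isSide⇒onSide t (inj₂ (inj₂ same)) with sameSpan⇒∈ same
... | (s , s′ , u≡) , (r , r′ , v≡) =
  onSide (# 1) (s′ ∷ false ∷ s ∷ []) (r′ ∷ false ∷ r ∷ []) (trans u≡ (span₂₀ s s′ (a t) (b t) (c t))) (trans v≡ (span₂₀ r r′ (a t) (b t) (c t))) refl refl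

onSide⇒isSide : ∀ {n} {u v : V n} (t : Triangle n) → Good (u , v) → OnSide u v (vertices t) → IsSideOf u v t
onSide⇒isSide t g (onSide zero (_ ∷ s ∷ s′ ∷ []) (_ ∷ r ∷ r′ ∷ []) u≡ v≡ refl refl) =
  inj₂ (inj₁ (sameSpan g (s , s′ , trans u≡ (sym (span₁₂ s s′ (a t) (b t) (c t)))) (r , r′ , trans v≡ (sym (span₁₂ r r′ (a t) (b t) (c t))))))
onSide⇒isSide t g (onSide (suc zero) (s′ ∷ _ ∷ s ∷ []) (r′ ∷ _ ∷ r ∷ []) u≡ v≡ refl refl) =
  inj₂ (inj₂ (sameSpan g (s , s′ , trans u≡ (sym (span₂₀ s s′ (a t) (b t) (c t)))) (r , r′ , trans v≡ (sym (span₂₀ r r′ (a t) (b t) (c t))))))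
onSide⇒isSide t g (onSide (suc (suc zero)) (s ∷ s′ ∷ _ ∷ []) (r ∷ r′ ∷ _ ∷ []) u≡ v≡ refl refl) =
  inj₁ (sameSpan g (s , s′ , trans u≡ (sym (span₀₁ s s′ (a t) (b t) (c t)))) (r , r′ , trans v≡ (sym (span₀₁ r r′ (a t) (b t) (c t)))))

SidesOf : ∀ {n} → Triangle n → Triangle n → Set
SidesOf s t = IsSideOf (a s) (b s) t × IsSideOf (b s) (c s) t × IsSideOf (c s) (a s) t

isSide-trans : ∀ {n} {u v : V n} {s t : Triangle n} → IsSideOf u v s → SidesOf s t → IsSideOf u v t
isSide-trans {u = u} {v} {s} {t} side (f , g , h) = pick side
  where
  along : ∀ {p q} → SameSpan u v p q → IsSideOf p q t → IsSideOf u v t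
  along f (inj₁ g)        = inj₁ (sameSpan-trans f g)
  along f (inj₂ (inj₁ g)) = inj₂ (inj₁ (sameSpan-trans f g))
  along f (inj₂ (inj₂ g)) = inj₂ (inj₂ (sameSpan-trans f g))
  pick : IsSideOf u v s → IsSideOf u v t
  pick (inj₁ e)        = along e f
  pick (inj₂ (inj₁ e)) = along e g
  pick (inj₂ (inj₂ e)) = along e h

sidesOf-trans : ∀ {n} {r s t : Triangle n} → SidesOf r s → SidesOf s t → SidesOf r t
sidesOf-trans {r = r} {s} {t} (f , g , h) st =
  isSide-trans {s = s} {t} f st , isSide-trans {s = s} {t} g st , isSide-trans {s = s} {t} h st

sameTriangle-trans-sym : ∀ {n} {r s t : Triangle n} → SameTriangle r s → SameTriangle r t → SameTriangle s t
sameTriangle-trans-sym {r = r} {s} {t} (rs , sr) (rt , tr) =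
  sidesOf-trans {r = s} {r} {t} sr rt , sidesOf-trans {r = t} {r} {s} tr rs

sameTriangle-refl : ∀ {n} (t : Triangle n) → SameTriangle t t
sameTriangle-refl t = sides , sides
  where
  sides : SidesOf t t
  sides = inj₁ sameSpan-refl , inj₂ (inj₁ sameSpan-refl) , inj₂ (inj₂ sameSpan-refl)

lc₃ : ∀ {n} l m k (p q r : V n) → l · p ⊕ m · q ⊕ k · r ≡ lc (l ∷ m ∷ k ∷ []) (p ∷ q ∷ r ∷ [])
lc₃ l m k p q r = ⊕-solve (v₀ ⊞ v₁ ⊞ v₂) (v₀ ⊞ (v₁ ⊞ (v₂ ⊞ 𝟘))) refl (l · p ∷ m · q ∷ k · r ∷ [])

vertices-indep : ∀ {n} (t : Triangle n) → Indep (vertices t)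
vertices-indep t (l ∷ m ∷ k ∷ []) eq with indep t l m k (trans (lc₃ l m k (a t) (b t) (c t)) eq)
... | refl , refl , refl = refl

mkTriangle : ∀ {n} (ρ : Triple n) → Indep ρ → Triangle n
mkTriangle (p ∷ q ∷ r ∷ []) ind = triangle p q r λ l m k eq → comps l m k (ind (l ∷ m ∷ k ∷ []) (trans (sym (lc₃ l m k p q r)) eq))
  where
  comps : ∀ l m k → (l ∷ m ∷ k ∷ []) ≡ 0v → l ≡ false × m ≡ false × k ≡ false
  comps _ _ _ refl = refl , refl , refl

vertices-mkTriangle : ∀ {n} (ρ : Triple n) (ind : Indep ρ) → vertices (mkTriangle ρ ind) ≡ ρ
vertices-mkTriangle (p ∷ q ∷ r ∷ []) ind = refl

111v : V 3
111v = true ∷ true ∷ true ∷ []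

covered? : Decidable (λ (e : V 3) → e ≢ 0v × e ≢ 111v)
covered? e = ¬? (e ≟V 0v) ×-dec ¬? (e ≟V 111v)

covers⇒lc : ∀ {n} {x : V n} (t : Triangle n) → Covers x t → ∃ λ e → e ≢ 111v × x ≡ lc e (vertices t)
covers⇒lc t (inj₁ (s , s′ , eq))        = (s ∷ s′ ∷ false ∷ []) , (λ ()) , trans eq (span₀₁ s s′ (a t) (b t) (c t))
covers⇒lc t (inj₂ (inj₁ (s , s′ , eq))) = (false ∷ s ∷ s′ ∷ []) , (λ ()) , trans eq (span₁₂ s s′ (a t) (b t) (c t))
covers⇒lc t (inj₂ (inj₂ (s , s′ , eq))) = (s′ ∷ false ∷ s ∷ []) , (λ ()) , trans eq (span₂₀ s s′ (a t) (b t) (c t))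

lc⇒covers : ∀ {n} {x : V n} (t : Triangle n) e → e ≢ 111v → x ≡ lc e (vertices t) → Covers x t
lc⇒covers t (s ∷ s′ ∷ false ∷ [])        _  eq = inj₁ (s , s′ , trans eq (sym (span₀₁ s s′ (a t) (b t) (c t))))
lc⇒covers t (false ∷ s ∷ true ∷ [])      _  eq = inj₂ (inj₁ (s , true , trans eq (sym (span₁₂ s true (a t) (b t) (c t)))))
lc⇒covers t (true ∷ false ∷ true ∷ [])   _  eq = inj₂ (inj₂ (true , true , trans eq (sym (span₂₀ true true (a t) (b t) (c t)))))
lc⇒covers t (true ∷ true ∷ true ∷ [])    ne eq = ⊥-elim (ne refl)

-- Independence makes coordinates unique, so a covered point matches exactly one of the six
-- coordinate vectors.
occurrences-covers : ∀ {n} (x : V n) (t : Triangle n) → x ≢ 0v → occurrences x (vertices t) ≡ 𝟙 (covers? x t)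
occurrences-covers x t x≢0 = go (covers? x t)
  where
  ρ = vertices t
  once : ∀ e → e ≢ 0v × e ≢ 111v → ∑ coveredPoints (δ e) ≡ 1
  once = does-true (∀? 3 λ e → covered? e →-dec (∑ coveredPoints (δ e) ≟ 1)) refl
  go : Dec (Covers x t) → occurrences x ρ ≡ 𝟙 (covers? x t)
  go (yes cov) with covers⇒lc t cov
  ... | e , e≢111 , refl = trans
    (∑-cong coveredPoints (λ e′ → 𝟙-cong (lc e ρ ≟V lc e′ ρ) (e ≟V e′) (indep-lc-injective (vertices-indep t)) (cong (λ z → lc z ρ))))
    (trans (once e ((λ { refl → x≢0 (lc-0 ρ) }) , e≢111)) (sym (𝟙-yes (covers? (lc e ρ) t) cov)))
  go (no ¬cov) = trans
    (∑-cong-∈ coveredPoints (λ {e} e∈ → 𝟙-no (x ≟V lc e ρ) (λ eq → ¬cov (lc⇒covers t e (proj₂ (proj₂ (∈-filter⁻ covered? {xs = allV 3} e∈))) eq))))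
    (trans (∑-0 coveredPoints) (sym (𝟙-no (covers? x t) ¬cov)))

coverCount-∑ : ∀ {n} (x : V n) (T : List (Triangle n)) → x ≢ 0v → coverCount x T ≡ ∑ T (occurrences x ∘ vertices)
coverCount-∑ x T x≢0 = trans (length-filter-∑ (covers? x) T) (∑-cong T (λ t → sym (occurrences-covers x t x≢0)))

-- By the pigeonhole principle, uniqueness of the triangle through a line may be replaced by the number of triangles.
record Design n (L : List (Triple n)) (r : ℕ) : Set where
  field
    independent : ∀ {ρ} → ρ ∈ L → Indep ρ
    covering    : ∀ {u v} → Good (u , v) → ∃ λ ρ → ρ ∈ L × OnSide u v ρ
    size        : length L * 18 + (2 ^ n * 2 + 2 ^ n) ≡ 2 ^ n * 2 ^ n + 2
    balanced    : ∀ {x} → x ≢ 0v → ∑ L (occurrences x) ≡ r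

length-sides : ∀ {n} (L : List (Triple n)) → length (concatMap sidePairs L) ≡ length L * 18
length-sides L = trans (length-concatMap sidePairs L) (trans (∑-cong L length-sidePairs) (∑-const L 18))

_≟²_ : ∀ {n} (p q : V n × V n) → Dec (p ≡ q)
_≟²_ = Prodₚ.≡-dec _≟V_ _≟V_

mkTriangles : ∀ {n} (L : List (Triple n)) → (∀ {ρ} → ρ ∈ L → Indep ρ) → List (Triangle n)
mkTriangles []      ind = []
mkTriangles (ρ ∷ L) ind = mkTriangle ρ (ind (here refl)) ∷ mkTriangles L (ind ∘ there)

map-vertices : ∀ {n} (L : List (Triple n)) (ind : ∀ {ρ} → ρ ∈ L → Indep ρ) → map vertices (mkTriangles L ind) ≡ L
map-vertices []      ind = refl
map-vertices (ρ ∷ L) ind = cong₂ _∷_ (vertices-mkTriangle ρ (ind (here refl))) (map-vertices L (ind ∘ there))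

design⇒balanced : ∀ {n L r} → Design n L r → HasBalancedTriangleDesign n
design⇒balanced {n} {L} {r} D = T , (distinct , exactlyOne) , r , balance
  where
  open Design D
  T = mkTriangles L independent
  mapT : map vertices T ≡ L
  mapT = map-vertices L independent
  L′ : List (Triple n)
  L′ = map vertices T
  -- The list of all ordered pairs on sides contains every independent pair and is no longer than
  -- the list of these. Hence it has no repetition, and two entries of the design never share a
  -- side.
  sides-unique : Unique (concatMap sidePairs L′)
  sides-unique = unique-of-length _≟²_ (concatMap sidePairs L′) (goodPairs-unique n) sub
    (≤-reflexive (+-cancelʳ-≡ _ _ _ (trans (cong (_+ (2 ^ n * 2 + 2 ^ n)) (trans (length-sides L′) (cong (λ z → length z * 18) mapT)))
      (trans size (sym (length-goodPairs n))))))
    where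
    sub : ∀ {p} → p ∈ goodPairs n → p ∈ concatMap sidePairs L′
    sub {p} p∈ with covering (∈-goodPairs⁻ p∈)
    ... | ρ , ρ∈ , on = ∈-concatMap⁺ sidePairs (lose (subst (ρ ∈_) (sym mapT) ρ∈) (onSide⇒∈ (∈-goodPairs⁻ p∈) on))
  disjoint : AllPairs (λ s t → Disjoint (sidePairs (vertices s)) (sidePairs (vertices t))) T
  disjoint = AllPairsₚ.map⁻ (AllPairsₚ.map⁻ (unique-concat⁻ (map sidePairs L′) sides-unique))
  ∈sides : ∀ {u v} {t : Triangle n} → LinIndep₂ u v → IsSideOf u v t → (u , v) ∈ sidePairs (vertices t)
  ∈sides {t = t} ind side = onSide⇒∈ (indep₂⇒good ind) (isSide⇒onSide t side)
  indep-ab : ∀ (t : Triangle n) → LinIndep₂ (a t) (b t)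
  indep-ab t l m eq with indep t l m false (trans (⊕-identityʳ _) eq)
  ... | l≡ , m≡ , _ = l≡ , m≡
  distinct : AllPairs (λ s t → ¬ SameTriangle s t) T
  distinct = AllPairs.map (λ {s} {t} disj same →
    disj (∈sides {t = s} (indep-ab s) (inj₁ sameSpan-refl) , ∈sides {t = t} (indep-ab s) (proj₁ (proj₁ same)))) disjoint
  exactlyOne : ∀ u v → LinIndep₂ u v →
    Σ (Triangle n) λ t → (t ∈ T × IsSideOf u v t) × (∀ t′ → t′ ∈ T → IsSideOf u v t′ → SameTriangle t t′)
  exactlyOne u v ind with covering (indep₂⇒good ind)
  ... | ρ , ρ∈ , on with ∈-map⁻ vertices (subst (ρ ∈_) (sym mapT) ρ∈)
  ... | t , t∈ , refl = t , (t∈ , side) , unique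
    where
    side : IsSideOf u v t
    side = onSide⇒isSide t (indep₂⇒good ind) on
    unique : ∀ t′ → t′ ∈ T → IsSideOf u v t′ → SameTriangle t t′
    unique t′ t′∈ side′ with allPairs-lookup disjoint t∈ t′∈
    ... | inj₁ refl        = sameTriangle-refl t
    ... | inj₂ (inj₁ disj) = ⊥-elim (disj (∈sides {t = t} ind side , ∈sides {t = t′} ind side′))
    ... | inj₂ (inj₂ disj) = ⊥-elim (disj (∈sides {t = t′} ind side′ , ∈sides {t = t} ind side))
  balance : ∀ x → ¬ x ≡ 0v → coverCount x T ≡ r
  balance x x≢0 = trans (coverCount-∑ x T x≢0)
    (trans (sym (∑-map vertices T (occurrences x))) (trans (cong (λ z → ∑ z (occurrences x)) mapT) (balanced x≢0)))

-- Here the counting runs backwards: exact covering makes the list of ordered side pairs a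
-- permutation of all independent pairs, which yields `size`.
balanced⇒design : ∀ {n} → HasBalancedTriangleDesign n → ∃ λ L → ∃ λ r → Design n L r
balanced⇒design {n} (T , (distinct , exactlyOne) , r , balance) = L , r , record
  { independent = λ ρ∈ → independent′ (∈-map⁻ vertices ρ∈)
  ; covering = covering′
  ; size = trans (cong (_+ (2 ^ n * 2 + 2 ^ n)) (trans (sym (length-sides L)) (↭-length sides↭))) (length-goodPairs n)
  ; balanced = λ {x} x≢0 → trans (∑-map vertices T (occurrences x)) (trans (sym (coverCount-∑ x T x≢0)) (balance x x≢0)) }
  where
  L = map vertices T
  independent′ : ∀ {ρ} → (∃ λ t → t ∈ T × ρ ≡ vertices t) → Indep ρ
  independent′ (t , _ , refl) = vertices-indep t
  covering′ : ∀ {u v} → Good (u , v) → ∃ λ ρ → ρ ∈ L × OnSide u v ρ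
  covering′ {u} {v} g with exactlyOne u v (good⇒indep₂ g)
  ... | t , (t∈ , side) , _ = vertices t , ∈-map⁺ vertices t∈ , isSide⇒onSide t side
  isSide : ∀ {u v t} → (u , v) ∈ sidePairs (vertices t) → Good (u , v) × IsSideOf u v t
  isSide {t = t} p∈ = g , onSide⇒isSide t g (∈⇒onSide p∈)
    where g = ∈⇒good (vertices-indep t) p∈
  -- A shared pair spans a line on both triangles, and the uniqueness clause identifies both with
  -- the triangle `t₀` through it.
  disjoint : ∀ {s t} → s ∈ T → t ∈ T → ¬ SameTriangle s t → Disjoint (sidePairs (vertices s)) (sidePairs (vertices t))
  disjoint {s} {t} s∈ t∈ ¬same {u , v} (p∈s , p∈t) with isSide {t = s} p∈s | isSide {t = t} p∈t
  ... | g , side | _ , side′ with exactlyOne u v (good⇒indep₂ g)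
  ... | t₀ , _ , uniq = ¬same (sameTriangle-trans-sym {r = t₀} {s} {t} (uniq s s∈ side) (uniq t t∈ side′))
  sides-unique : Unique (concatMap sidePairs L)
  sides-unique = Uniq.concat⁺
    (Allₚ.map⁺ (Allₚ.map⁺ (All.tabulate (λ {t} _ → sidePairs-unique (vertices-indep t)))))
    (AllPairsₚ.map⁺ (AllPairsₚ.map⁺ (allPairs-map-∈ (λ {s} {t} → disjoint {s} {t}) distinct)))
  sides↭ : _
  sides↭ = unique-set⇒↭ sides-unique (goodPairs-unique n) into out
    where
    into : ∀ {p} → p ∈ concatMap sidePairs L → p ∈ goodPairs n
    into p∈ with find (∈-concatMap⁻ sidePairs {xs = L} p∈)
    ... | ρ , ρ∈ , p∈ρ = ∈-goodPairs (∈⇒good (independent′ (∈-map⁻ vertices ρ∈)) p∈ρ)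
    out : ∀ {p} → p ∈ goodPairs n → p ∈ concatMap sidePairs L
    out p∈ with covering′ (∈-goodPairs⁻ p∈)
    ... | ρ , ρ∈ , on = ∈-concatMap⁺ sidePairs (lose ρ∈ (onSide⇒∈ (∈-goodPairs⁻ p∈) on))

-- Arithmetic conditions on a balanced design

cover-sum : ∀ {n L r} → Design n L r → length L * 6 + r ≡ 2 ^ n * r
cover-sum {n} {L} {r} D = begin
  length L * 6 + r
    -- Double counting of incidences, six points per triangle. The zero vector lies on no side as a
    -- covered point and is credited with `r` separately, which makes the sum over all 2ⁿ vectors
    -- uniform.
    ≡⟨ cong₂ _+_ (sym (trans (∑-cong L six) (∑-const L 6))) (sym (∑-δ {n} 0v (λ _ → r))) ⟩
  ∑ L (λ ρ → ∑ (allV n) (λ x → occurrences x ρ)) + ∑ (allV n) (λ x → δ 0v x * r)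
    ≡⟨ cong (_+ _) (∑-swap L (allV n) (λ ρ x → occurrences x ρ)) ⟩
  ∑ (allV n) (λ x → ∑ L (occurrences x)) + ∑ (allV n) (λ x → δ 0v x * r)
    ≡⟨ sym (∑-+ (allV n) _ _) ⟩
  ∑ (allV n) (λ x → ∑ L (occurrences x) + δ 0v x * r)
    ≡⟨ ∑-cong (allV n) (λ x → point x (x ≟V 0v)) ⟩
  ∑ (allV n) (λ _ → r)
    ≡⟨ trans (∑-const (allV n) r) (cong (_* r) (length-allV n)) ⟩
  2 ^ n * r ∎
  where
  open Design D
  six : ∀ ρ → ∑ (allV n) (λ x → occurrences x ρ) ≡ 6
  six ρ = trans (∑-swap (allV n) coveredPoints (λ x e → δ x (lc e ρ))) (∑-cong coveredPoints {g = λ _ → 1} (λ c →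
    trans (∑-cong (allV n) (λ x → 𝟙-cong (x ≟V lc c ρ) (lc c ρ ≟V x) sym sym)) (∑-δ₁ (lc c ρ))))
  point : ∀ x → Dec (x ≡ 0v) → ∑ L (occurrences x) + δ 0v x * r ≡ r
  point x (yes refl) = cong₂ _+_
    (trans (∑-cong-∈ L none) (∑-0 L))
    (trans (cong (_* r) (𝟙-yes (0v {n} ≟V 0v) refl)) (*-identityˡ r))
    where
    zero-free : ∀ {ρ c} → ρ ∈ L → c ∈ coveredPoints → 0v ≢ lc c ρ
    zero-free {ρ} {c} ρ∈ c∈ eq with ∈-filter⁻ covered? {xs = allV 3} c∈
    ... | _ , c≢0 , _ = c≢0 (independent ρ∈ c (sym eq))
    none : ∀ {ρ} → ρ ∈ L → occurrences 0v ρ ≡ 0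
    none {ρ} ρ∈ = trans (∑-cong-∈ coveredPoints (λ {e} e∈ → 𝟙-no (0v ≟V lc e ρ) (zero-free {ρ} {e} ρ∈ e∈))) (∑-0 coveredPoints)
  point x (no x≢0) = trans (cong₂ _+_ (balanced x≢0) (cong (_* r) (𝟙-no (0v ≟V x) (λ eq → x≢0 (sym eq))))) (+-identityʳ r)

-- Counting lines and covered points gives 3r = 2ⁿ − 2 and 3 ∣ r, so 2ⁿ ≡ 2 modulo 9.
balance-value : ∀ {n L r} → 1 ≤ n → Design n L r → 2 ^ n ≡ 3 * r + 2
balance-value {suc n} {L} {r} (s≤s _) D = go (2 ^ suc n) (*-mono-≤ (≤-refl {2}) (m^n>0 2 n)) (Design.size D) (cover-sum D)
  where
  go : ∀ N → 2 ≤ N → length L * 18 + (N * 2 + N) ≡ N * N + 2 → length L * 6 + r ≡ N * r → N ≡ 3 * r + 2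
  -- With N = p + 2 the two counts combine to (N - 1)(N + 1) = (N - 1)(3r + 3), and the factor N - 1
  -- = `suc p` is cancelled.
  go (suc (suc p)) (s≤s (s≤s _)) e₁ e₂ = trans (cong (λ z → suc (suc z)) (+-cancelʳ-≡ 3 p (3 * r) (*-cancelˡ-≡ (p + 3) (3 * r + 3) (suc p)
    (+-cancelʳ-≡ (3 * r + 3) _ _ (begin
      suc p * (p + 3) + (3 * r + 3)
        ≡⟨ solve 2 (λ p r → (con 1 :+ p) :* (p :+ con 3) :+ (con 3 :* r :+ con 3) := (con 2 :+ p) :* (con 2 :+ p) :+ con 2 :+ con 3 :* r) refl p r ⟩
      (2 + p) * (2 + p) + 2 + 3 * r
        ≡⟨ cong (_+ 3 * r) (sym e₁) ⟩
      length L * 18 + ((2 + p) * 2 + (2 + p)) + 3 * r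
        ≡⟨ solve 3 (λ l p r → l :* con 18 :+ ((con 2 :+ p) :* con 2 :+ (con 2 :+ p)) :+ con 3 :* r
                   := con 3 :* (l :* con 6 :+ r) :+ con 3 :* (con 2 :+ p)) refl (length L) p r ⟩
      3 * (length L * 6 + r) + 3 * (2 + p)
        ≡⟨ cong (λ z → 3 * z + 3 * (2 + p)) e₂ ⟩
      3 * ((2 + p) * r) + 3 * (2 + p)
        ≡⟨ solve 2 (λ p r → con 3 :* ((con 2 :+ p) :* r) :+ con 3 :* (con 2 :+ p)
                   := (con 1 :+ p) :* (con 3 :* r :+ con 3) :+ (con 3 :* r :+ con 3)) refl p r ⟩
      suc p * (3 * r + 3) + (3 * r + 3) ∎))))) (+-comm 2 (3 * r))

-- Inserting N = 3r + 2 into the pair count 18 · `length L` = (N - 1)(N - 2) leaves 6 · `length L` =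
-- 3r² + r.
balance-divisible : ∀ {n L r} → 1 ≤ n → Design n L r → 3 ∣ r
balance-divisible {n} {L} {r} 1≤n D = ∣m+n∣m⇒∣n (divides (length L * 2) (trans key (solve 1 (λ l → l :* con 6 := l :* con 2 :* con 3) refl (length L)))) (m∣m*n (r * r))
  where
  key : 3 * (r * r) + r ≡ length L * 6
  key = *-cancelˡ-≡ (3 * (r * r) + r) (length L * 6) 3 (+-cancelʳ-≡ (9 * r + 6) _ _ (begin
    3 * (3 * (r * r) + r) + (9 * r + 6)
      ≡⟨ solve 1 (λ r → con 3 :* (con 3 :* (r :* r) :+ r) :+ (con 9 :* r :+ con 6) := (con 3 :* r :+ con 2) :* (con 3 :* r :+ con 2) :+ con 2) refl r ⟩
    (3 * r + 2) * (3 * r + 2) + 2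
      ≡⟨ cong (λ N → N * N + 2) (sym (balance-value 1≤n D)) ⟩
    2 ^ n * 2 ^ n + 2
      ≡⟨ sym (Design.size D) ⟩
    length L * 18 + (2 ^ n * 2 + 2 ^ n)
      ≡⟨ cong (λ N → length L * 18 + (N * 2 + N)) (balance-value 1≤n D) ⟩
    length L * 18 + ((3 * r + 2) * 2 + (3 * r + 2))
      ≡⟨ solve 2 (λ l r → l :* con 18 :+ ((con 3 :* r :+ con 2) :* con 2 :+ (con 3 :* r :+ con 2)) := con 3 :* (l :* con 6) :+ (con 9 :* r :+ con 6)) refl (length L) r ⟩
    3 * (length L * 6) + (9 * r + 6) ∎))

power-mod-9 : ∀ j k → 2 ^ (j + k * 6) % 9 ≡ 2 ^ j % 9
power-mod-9 j zero    = cong (λ z → 2 ^ z % 9) (+-identityʳ j)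
power-mod-9 j (suc k) = begin
  2 ^ (j + (6 + k * 6)) % 9      ≡⟨ cong (λ z → 2 ^ z % 9) (solve 2 (λ j k → j :+ (con 6 :+ k :* con 6) := con 6 :+ (j :+ k :* con 6)) refl j k) ⟩
  2 ^ (6 + (j + k * 6)) % 9      ≡⟨ cong (_% 9) (^-distribˡ-+-* 2 6 (j + k * 6)) ⟩
  64 * 2 ^ (j + k * 6) % 9       ≡⟨ cong (_% 9) (solve 1 (λ x → con 64 :* x := x :+ x :* con 7 :* con 9) refl (2 ^ (j + k * 6))) ⟩
  (2 ^ (j + k * 6) + 2 ^ (j + k * 6) * 7 * 9) % 9  ≡⟨ [m+kn]%n≡m%n (2 ^ (j + k * 6)) (2 ^ (j + k * 6) * 7) 9 ⟩
  2 ^ (j + k * 6) % 9            ≡⟨ power-mod-9 j k ⟩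
  2 ^ j % 9 ∎

-- The powers of 2 modulo 9 have period 6, and within a period only the exponent 1 gives the residue
-- 2.
exponent-mod-6 : ∀ n s → 2 ^ n ≡ 2 + s * 9 → ∃ λ k → n ≡ 1 + k * 6
exponent-mod-6 n s eq = n / 6 , trans (m≡m%n+[m/n]*n n 6) (cong (_+ n / 6 * 6) (pick (n % 6) (m%n<n n 6) mod))
  where
  mod : 2 ^ (n % 6) % 9 ≡ 2
  mod = trans (sym (power-mod-9 (n % 6) (n / 6)))
    (trans (cong (λ z → 2 ^ z % 9) (sym (m≡m%n+[m/n]*n n 6))) (trans (cong (_% 9) eq) ([m+kn]%n≡m%n 2 s 9)))
  pick : ∀ j → j < 6 → 2 ^ j % 9 ≡ 2 → j ≡ 1
  pick 1 _ _ = refl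
  pick 0 _ ()
  pick 2 _ ()
  pick 3 _ ()
  pick 4 _ ()
  pick 5 _ ()
  pick (suc (suc (suc (suc (suc (suc j)))))) (s≤s (s≤s (s≤s (s≤s (s≤s (s≤s ())))))) _

design-dimension : ∀ {n L r} → 1 ≤ n → Design n L r → ∃ λ k → n ≡ 1 + k * 6
design-dimension {n} {L} {r} 1≤n D = go (balance-divisible 1≤n D)
  where
  go : 3 ∣ r → ∃ λ k → n ≡ 1 + k * 6
  go (divides s r≡) = exponent-mod-6 n s (trans (balance-value 1≤n D)
    (trans (cong (λ z → 3 * z + 2) r≡) (solve 1 (λ s → con 3 :* (s :* con 3) :+ con 2 := con 2 :+ s :* con 9) refl s)))

-- Linear images of families of triangles, and the balanced design of F₂⁷

∈-concatMap : ∀ {A B : Set} (f : A → List B) {xs : List A} {x y} → x ∈ xs → y ∈ f x → y ∈ concatMap f xs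
∈-concatMap f x∈ y∈ = ∈-concatMap⁺ f (lose x∈ y∈)

∈-concatMap-inv : ∀ {A B : Set} (f : A → List B) {xs : List A} {y} → y ∈ concatMap f xs → ∃ λ x → x ∈ xs × y ∈ f x
∈-concatMap-inv f {xs} y∈ = find (∈-concatMap⁻ f {xs = xs} y∈)

≢0? : ∀ {n} → Decidable (λ (x : V n) → x ≢ 0v)
≢0? x = ¬? (x ≟V 0v)

nonzero : ∀ n → List (V n)
nonzero n = filter ≢0? (allV n)

∈-nonzero : ∀ {n} {x : V n} → x ≢ 0v → x ∈ nonzero n
∈-nonzero {x = x} x≢0 = ∈-filter⁺ ≢0? (∈-allV x) x≢0

∈-nonzero⁻ : ∀ {n} {x : V n} → x ∈ nonzero n → x ≢ 0v
∈-nonzero⁻ {n} x∈ = proj₂ (∈-filter⁻ ≢0? {xs = allV n} x∈)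

-- Least significant digit first.
binary : ∀ n → ℕ → V n
binary zero    i = []
binary (suc n) i = (i % 2 ≡ᵇ 1) ∷ binary n (i / 2)

-- The orbit of the first triangle under the Frobenius map. Its 21 sides represent the orbits of F₁₂₈* on lines.
baseTriangles : List (Triple 7)
baseTriangles = map (Vec.map (binary 7))
  ( (1 ∷ 2 ∷ 13 ∷ []) ∷ (1 ∷ 4 ∷ 81 ∷ []) ∷ (1 ∷ 16 ∷ 103 ∷ []) ∷ (1 ∷ 6 ∷ 109 ∷ [])
  ∷ (1 ∷ 20 ∷ 41 ∷ []) ∷ (1 ∷ 22 ∷ 89 ∷ []) ∷ (1 ∷ 18 ∷ 39 ∷ []) ∷ [])

indep? : ∀ {n} → Decidable (Indep {n})
indep? ρ = ∀? 3 λ e → (lc e ρ ≟V 0v) →-dec (e ≟V 0v)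

base-indep : ∀ {ρ} → ρ ∈ baseTriangles → Indep ρ
base-indep ρ∈ = All.lookup (does-true (All.all? indep? baseTriangles) refl) ρ∈

-- Serves three purposes: scaling by F₁₂₈*, embedding the given design, and placing copies of the
-- design of F₂⁷.
images : ∀ {I : Set} {m n} → (I → V m → V n) → List I → List (Triple m) → List (Triple n)
images L is ts = concatMap (λ i → map (Vec.map (L i)) ts) is

∈-images : ∀ {I : Set} {m n} (L : I → V m → V n) {is ts i ρ} → i ∈ is → ρ ∈ ts → Vec.map (L i) ρ ∈ images L is ts
∈-images L {i = i} i∈ ρ∈ = ∈-concatMap (λ i → map (Vec.map (L i)) _) i∈ (∈-map⁺ (Vec.map (L i)) ρ∈)

∈-images⁻ : ∀ {I : Set} {m n} (L : I → V m → V n) is ts {σ} → σ ∈ images L is ts →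
            ∃ λ i → ∃ λ ρ → i ∈ is × ρ ∈ ts × σ ≡ Vec.map (L i) ρ
∈-images⁻ L is ts σ∈ with ∈-concatMap-inv (λ i → map (Vec.map (L i)) ts) {xs = is} σ∈
... | i , i∈ , σ∈′ with ∈-map⁻ (Vec.map (L i)) σ∈′
... | ρ , ρ∈ , eq = i , ρ , i∈ , ρ∈ , eq

length-images : ∀ {I : Set} {m n} (L : I → V m → V n) is ts → length (images L is ts) ≡ length is * length ts
length-images L is ts = trans (length-concatMap (λ i → map (Vec.map (L i)) ts) is)
  (trans (∑-cong is (λ i → length-map (Vec.map (L i)) ts)) (∑-const is (length ts)))

-- Exchanging the sums isolates, for each covered point of each triangle, the number of maps that
-- send it to `x`; only this inner sum has to be evaluated later.
∑-images : ∀ {I : Set} {m n} (L : I → V m → V n) → (∀ i → Additive (L i)) → ∀ is ts x →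
           ∑ (images L is ts) (occurrences x) ≡ ∑ ts (λ ρ → ∑ coveredPoints (λ e → ∑ is (λ i → δ x (L i (lc e ρ)))))
∑-images L L-add is ts x = begin
  ∑ (images L is ts) (occurrences x)
    ≡⟨ ∑-concatMap (λ i → map (Vec.map (L i)) ts) is (occurrences x) ⟩
  ∑ is (λ i → ∑ (map (Vec.map (L i)) ts) (occurrences x))
    ≡⟨ ∑-cong is (λ i → ∑-map (Vec.map (L i)) ts (occurrences x)) ⟩
  ∑ is (λ i → ∑ ts (λ ρ → occurrences x (Vec.map (L i) ρ)))
    ≡⟨ ∑-swap is ts (λ i ρ → occurrences x (Vec.map (L i) ρ)) ⟩
  ∑ ts (λ ρ → ∑ is (λ i → occurrences x (Vec.map (L i) ρ)))
    ≡⟨ ∑-cong ts (λ ρ → at ρ coveredPoints) ⟩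
  ∑ ts (λ ρ → ∑ coveredPoints (λ e → ∑ is (λ i → δ x (L i (lc e ρ))))) ∎
  where
  at : ∀ ρ (es : List (V 3)) → ∑ is (λ i → ∑ es (λ e → δ x (lc e (Vec.map (L i) ρ)))) ≡ ∑ es (λ e → ∑ is (λ i → δ x (L i (lc e ρ))))
  at ρ es = trans (∑-swap is es (λ i e → δ x (lc e (Vec.map (L i) ρ))))
    (∑-cong es (λ e → ∑-cong is (λ i → cong (δ x) (sym (lc-map (L-add i) e ρ)))))

images-indep : ∀ {I : Set} {m n} (L : I → V m → V n) → (∀ i → Additive (L i)) → ∀ is ts →
               (∀ {i} → i ∈ is → ∀ {x} → L i x ≡ 0v → x ≡ 0v) → (∀ {ρ} → ρ ∈ ts → Indep ρ) →
               ∀ {σ} → σ ∈ images L is ts → Indep σ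
images-indep L L-add is ts ker ind σ∈ with ∈-images⁻ L is ts σ∈
... | i , ρ , i∈ , ρ∈ , refl = indep-map (L-add i) (ker i∈) (ind ρ∈)

covered-nonzero : ∀ {n} {ρ : Triple n} {e} → Indep ρ → e ∈ coveredPoints → lc e ρ ≢ 0v
covered-nonzero {e = e} ind e∈ eq = proj₁ (proj₂ (∈-filter⁻ covered? {xs = allV 3} e∈)) (ind e eq)

module SevenDimensional where
  open BinaryField F₁₂₈ using (one; inv; one-S; S-one)
  open FieldLaws F₁₂₈

  -- The ratio of an ordered pair is invariant under scaling. The 21 sides provide 21 · 6 = 126
  -- pairs, as many as there are ratios other than 0 and 1.
  base-ratio : ∀ τ → τ ≢ 0v × τ ≢ one → Any (λ ρ → Any (λ pq → proj₁ pq ⊙ τ ≡ proj₂ pq) (sidePairs ρ)) baseTriangles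
  base-ratio = does-true (∀? 7 λ τ → (≢0? τ ×-dec ¬? (τ ≟V one)) →-dec
    Any.any? (λ ρ → Any.any? (λ pq → (proj₁ pq ⊙ τ) ≟V proj₂ pq) (sidePairs ρ)) baseTriangles) refl

  triangles₇ : List (Triple 7)
  triangles₇ = images _⊙_ (nonzero 7) baseTriangles

  design₇ : Design 7 triangles₇ 42
  design₇ = record { independent = ind ; covering = cov ; size = refl ; balanced = bal }
    where
    ind : ∀ {ρ} → ρ ∈ triangles₇ → Indep ρ
    ind = images-indep _⊙_ ⊙-distribˡ (nonzero 7) baseTriangles
      (λ {s} s∈ eq → ⊙-injective (∈-nonzero⁻ s∈) (trans eq (sym (⊙-zeroʳ s)))) base-indep

    cov : ∀ {u v} → Good (u , v) → ∃ λ ρ → ρ ∈ triangles₇ × OnSide u v ρ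
    cov {u} {v} (u≢0 , v≢0 , u≢v) = build (find (base-ratio τ (⊙-nonzero (inv-nonzero u≢0) v≢0 , τ≢1)))
      where
      τ = inv u ⊙ v
      uτ : u ⊙ τ ≡ v
      uτ = ⊙-inverseʳ u≢0 v
      τ≢1 : τ ≢ one
      τ≢1 eq = u≢v (trans (sym (S-one u)) (trans (cong (u ⊙_) (sym eq)) uτ))
      build : (∃ λ ρ → ρ ∈ baseTriangles × Any (λ pq → proj₁ pq ⊙ τ ≡ proj₂ pq) (sidePairs ρ)) → ∃ λ ρ → ρ ∈ triangles₇ × OnSide u v ρ
      build (ρ , ρ∈ , any) with find any
      ... | (p , q) , pq∈ , eq = Vec.map (s ⊙_) ρ , ∈-images _⊙_ (∈-nonzero s≢0) ρ∈ ,
        subst (λ z → OnSide z v (Vec.map (s ⊙_) ρ)) sp≡u (subst (λ z → OnSide (s ⊙ p) z (Vec.map (s ⊙_) ρ)) sq≡v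
          (onSide-map (⊙-distribˡ s) (∈⇒onSide pq∈)))
        where
        p≢0 : p ≢ 0v
        p≢0 = proj₁ (∈⇒good (base-indep ρ∈) pq∈)
        -- The scalar moving `p` to `u` also moves `q` to `v`, because both pairs have the ratio
        -- `τ`.
        s = u ⊙ inv p
        s≢0 : s ≢ 0v
        s≢0 = ⊙-nonzero u≢0 (inv-nonzero p≢0)
        sp≡u : s ⊙ p ≡ u
        sp≡u = trans (⊙-assoc u (inv p) p) (trans (⊙-comm₃ u (inv p) p) (trans (cong (inv p ⊙_) (⊙-comm u p)) (⊙-inverse p≢0 u)))
        sq≡v : s ⊙ q ≡ v
        sq≡v = trans (cong (s ⊙_) (sym eq)) (trans (sym (⊙-assoc s p τ)) (trans (cong (_⊙ τ) sp≡u) uτ))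

    scale-once : ∀ {x y} → x ≢ 0v → y ≢ 0v → ∑ (nonzero 7) (λ s → δ x (s ⊙ y)) ≡ 1
    scale-once {x} {y} x≢0 y≢0 = trans (∑-filter ≢0? (allV 7) (λ s → δ x (s ⊙ y))) (trans
      (∑-cong (allV 7) (λ s → trans (*-comm (𝟙 ≢0? s) (δ x (s ⊙ y))) (cong (λ z → δ x z * 𝟙 ≢0? s) (⊙-comm s y))))
      (trans (∑-δ-bij (y ⊙_) (inv y ⊙_) (⊙-inverseʳ y≢0) (⊙-inverse y≢0) x (λ s → 𝟙 ≢0? s))
             (𝟙-yes (≢0? (inv y ⊙ x)) (⊙-nonzero (inv-nonzero y≢0) x≢0))))

    bal : ∀ {x} → x ≢ 0v → ∑ triangles₇ (occurrences x) ≡ 42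
    -- Each of the seven base triangles has six covered points, and exactly one scalar carries a
    -- given one of them to `x`: 42 = 7 · 6.
    bal {x} x≢0 = trans (∑-images _⊙_ ⊙-distribˡ (nonzero 7) baseTriangles x)
      (∑-cong-∈ baseTriangles {f = λ ρ → ∑ coveredPoints (λ e → ∑ (nonzero 7) (λ s → δ x (s ⊙ lc e ρ)))} {g = λ _ → 6} (λ {ρ} ρ∈ →
        ∑-cong-∈ coveredPoints {f = λ e → ∑ (nonzero 7) (λ s → δ x (s ⊙ lc e ρ))} {g = λ _ → 1} (λ {e} e∈ →
          scale-once x≢0 (covered-nonzero {ρ = ρ} {e} (base-indep ρ∈) e∈))))

open SevenDimensional using (triangles₇; design₇)

-- The cubic character of F₆₄ and the induced classes on F₆₄ᵏ

open BinaryField F₆₄ public using (one; inv; inv-one; one-S; S-one)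
open FieldLaws F₆₄ public

γ γ² : V 6
γ  = γ* 1 one
γ² = γ* 1 γ

-- The primitive cube roots of unity: `ω` = γ²¹ = γ⁵ + γ⁴ + γ³ + γ + 1 has the binary digits of 59,
-- and `ω²` = `ω` + 1.
ω ω² : V 6
ω  = binary 6 59
ω² = binary 6 58

sq : V 6 → V 6
sq c = c ⊙ c

⊙-interchange : ∀ a b c d → (a ⊙ b) ⊙ (c ⊙ d) ≡ (a ⊙ c) ⊙ (b ⊙ d)
⊙-interchange a b c d = begin
  (a ⊙ b) ⊙ (c ⊙ d)  ≡⟨ ⊙-assoc a b (c ⊙ d) ⟩
  a ⊙ (b ⊙ (c ⊙ d))  ≡⟨ cong (a ⊙_) (⊙-comm₃ b c d) ⟩
  a ⊙ (c ⊙ (b ⊙ d))  ≡⟨ sym (⊙-assoc a c (b ⊙ d)) ⟩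
  (a ⊙ c) ⊙ (b ⊙ d)  ∎

sq-⊙ : ∀ c e → sq (c ⊙ e) ≡ sq c ⊙ sq e
sq-⊙ c e = ⊙-interchange c e c e

fourth : V 6 → V 6
fourth c = sq (sq c)

fourth-⊙ : ∀ c e → fourth (c ⊙ e) ≡ fourth c ⊙ fourth e
fourth-⊙ c e = trans (cong sq (sq-⊙ c e)) (sq-⊙ (sq c) (sq e))

-- The norm c ↦ c²¹ from F₆₄* onto its subgroup {1, ω, ω²} of order 3.
norm : V 6 → V 6
norm c = (fourth (fourth c) ⊙ fourth c) ⊙ c

norm-⊙ : ∀ c e → norm (c ⊙ e) ≡ norm c ⊙ norm e
norm-⊙ c e = trans
  (cong (λ z → z ⊙ (c ⊙ e)) (trans (cong₂ _⊙_ (trans (cong fourth (fourth-⊙ c e)) (fourth-⊙ (fourth c) (fourth e))) (fourth-⊙ c e))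
    (⊙-interchange (fourth (fourth c)) (fourth (fourth e)) (fourth c) (fourth e))))
  (⊙-interchange (fourth (fourth c) ⊙ fourth c) (fourth (fourth e) ⊙ fourth e) c e)

CubeRoot : V 6 → Set
CubeRoot w = w ≡ one ⊎ (w ≡ ω ⊎ w ≡ ω²)

cubeRoot? : Decidable CubeRoot
cubeRoot? w = (w ≟V one) ⊎-dec ((w ≟V ω) ⊎-dec (w ≟V ω²))

norm-cubeRoot : ∀ c → c ≢ 0v → CubeRoot (norm c)
norm-cubeRoot = does-true (∀? 6 λ c → ≢0? c →-dec cubeRoot? (norm c)) refl

private module S k = VectorSpace (space k)

take-• : ∀ k c (x : V (suc k * 6)) → take 6 (S._•_ (suc k) c x) ≡ c ⊙ take 6 x
take-• k c x = horner-intertwine (γ*-add 1) {S = γ* (suc k)} {L = take 6} (λ x y → take-zipWith _xor_ x y) step c x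
  where
  step : ∀ (x : V (suc k * 6)) → take 6 (γ* (suc k) x) ≡ γ* 1 (take 6 x)
  step (a ∷ b ∷ c ∷ d ∷ e ∷ f ∷ x) = refl

drop-• : ∀ k c (x : V (suc k * 6)) → drop 6 (S._•_ (suc k) c x) ≡ S._•_ k c (drop 6 x)
drop-• k c x = horner-intertwine (γ*-add k) {S = γ* (suc k)} {L = drop 6} (λ x y → drop-zipWith _xor_ x y) step c x
  where
  step : ∀ (x : V (suc k * 6)) → drop 6 (γ* (suc k) x) ≡ γ* k (drop 6 x)
  step (a ∷ b ∷ c ∷ d ∷ e ∷ f ∷ x) = refl

-- coord k a x is the coordinate of x at the first nonzero coordinate of a.
coord : ∀ k → V (k * 6) → V (k * 6) → V 6
coord zero    a x = 0v
coord (suc k) a x = if does (take 6 a ≟V 0v) then coord k (drop 6 a) (drop 6 x) else take 6 x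

coord-add : ∀ k a → Additive (coord k a)
coord-add zero    a x y = refl
coord-add (suc k) a x y with does (take 6 a ≟V 0v)
... | true  = trans (cong (coord k (drop 6 a)) (drop-zipWith _xor_ x y)) (coord-add k (drop 6 a) (drop 6 x) (drop 6 y))
... | false = take-zipWith _xor_ x y

coord-•ʳ : ∀ k a c x → coord k a (S._•_ k c x) ≡ c ⊙ coord k a x
coord-•ʳ zero    a c x = sym (⊙-zeroʳ c)
coord-•ʳ (suc k) a c x with does (take 6 a ≟V 0v)
... | true  = trans (cong (coord k (drop 6 a)) (drop-• k c x)) (coord-•ʳ k (drop 6 a) c (drop 6 x))
... | false = take-• k c x

-- Scaling `a` does not move its first nonzero block, so the chosen coordinate is constant on each
-- F₆₄-line.
coord-•ˡ : ∀ k {c} → c ≢ 0v → ∀ a x → coord k (S._•_ k c a) x ≡ coord k a x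
coord-•ˡ zero    c≢0 a x = refl
coord-•ˡ (suc k) {c} c≢0 a x with take 6 a ≟V 0v | take 6 (S._•_ (suc k) c a) ≟V 0v
... | yes _  | yes _   = trans (cong (λ z → coord k z (drop 6 x)) (drop-• k c a)) (coord-•ˡ k c≢0 (drop 6 a) (drop 6 x))
... | yes a₀ | no ca₀  = ⊥-elim (ca₀ (trans (take-• k c a) (trans (cong (c ⊙_) a₀) (⊙-zeroʳ c))))
... | no a₀  | yes ca₀ = ⊥-elim (⊙-nonzero c≢0 a₀ (trans (sym (take-• k c a)) ca₀))
... | no _   | no _    = refl

coord-self : ∀ k a → a ≢ 0v → coord k a a ≢ 0v
coord-self zero    [] a≢0 = ⊥-elim (a≢0 refl)
coord-self (suc k) a  a≢0 with take 6 a ≟V 0v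
... | yes a₀ = coord-self k (drop 6 a) (λ a₁ → a≢0 (trans (sym (take++drop≡id 6 a)) (cong₂ _++_ a₀ a₁)))
... | no  a₀ = a₀

module Classes (k : ℕ) where
  open VectorSpace (space k) public

  n : ℕ
  n = k * 6

  q : ℕ
  q = 2 ^ n

  -- An extension of the cubic character to nonzero vectors. It is homogeneous, as scaling by `c` ≠
  -- 0 multiplies it by `norm c`; hence 1, γ and γ² times a vector lie in three different classes.
  cls : V n → V 6
  cls a = norm (coord k a a)

  cls-• : ∀ {c} → c ≢ 0v → ∀ a → cls (c • a) ≡ norm c ⊙ cls a
  cls-• {c} c≢0 a = trans (cong norm (trans (coord-•ˡ k c≢0 a (c • a)) (coord-•ʳ k a c a))) (norm-⊙ c (coord k a a))

  cls-cubeRoot : ∀ {a} → a ≢ 0v → CubeRoot (cls a)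
  cls-cubeRoot {a} a≢0 = norm-cubeRoot (coord k a a) (coord-self k a a≢0)

  -- A linear functional normalised to 1 at `a`; its binary digits tell `a`, γ`a` and γ²`a` apart.
  φ : V n → V n → V 6
  φ a x = inv (coord k a a) ⊙ coord k a x

  φ-add : ∀ a → Additive (φ a)
  φ-add a x y = trans (cong (inv (coord k a a) ⊙_) (coord-add k a x y)) (⊙-distribˡ (inv (coord k a a)) (coord k a x) (coord k a y))

  φ-•self : ∀ {a} → a ≢ 0v → ∀ c → φ a (c • a) ≡ c
  φ-•self {a} a≢0 c = trans (cong (inv (coord k a a) ⊙_) (coord-•ʳ k a c a))
    (trans (⊙-comm₃ (inv (coord k a a)) c (coord k a a))
           (trans (cong (c ⊙_) (inv-one (coord k a a) (coord-self k a a≢0))) (S-one c)))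

  inClass? : ∀ w → Decidable (λ a → a ≢ 0v × cls a ≡ w)
  inClass? w a = ≢0? a ×-dec (cls a ≟V w)

  ofClass : V 6 → List (V n)
  ofClass w = filter (inClass? w) (allV n)

  ∈-ofClass : ∀ {a w} → a ≢ 0v → cls a ≡ w → a ∈ ofClass w
  ∈-ofClass {a} {w} a≢0 eq = ∈-filter⁺ (inClass? w) (∈-allV a) (a≢0 , eq)

  ∈-ofClass⁻ : ∀ {a w} → a ∈ ofClass w → a ≢ 0v × cls a ≡ w
  ∈-ofClass⁻ {a} {w} a∈ = proj₂ (∈-filter⁻ (inClass? w) {xs = allV n} a∈)

  K : ℕ
  K = length (ofClass one)

  -- Multiplication by `c` is a bijection between the two classes. As γ and γ² have norms `ω` and
  -- `ω²`, all three classes have `K` elements.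
  ofClass-scale : ∀ {c} → c ≢ 0v → ∀ w → length (ofClass (norm c ⊙ w)) ≡ length (ofClass w)
  ofClass-scale {c} c≢0 w = begin
    length (ofClass (norm c ⊙ w))          ≡⟨ length-filter-∑ (inClass? (norm c ⊙ w)) (allV n) ⟩
    ∑ (allV n) (𝟙in (norm c ⊙ w))          ≡⟨ sym (∑-bij (c •_) (inv c •_) (•-inverseʳ c≢0) (•-inverse c≢0) (𝟙in (norm c ⊙ w))) ⟩
    ∑ (allV n) (𝟙in (norm c ⊙ w) ∘ (c •_)) ≡⟨ ∑-cong (allV n) (λ a → 𝟙-cong (inClass? (norm c ⊙ w) (c • a)) (inClass? w a) (to a) (from a)) ⟩
    ∑ (allV n) (𝟙in w)                     ≡⟨ sym (length-filter-∑ (inClass? w) (allV n)) ⟩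
    length (ofClass w) ∎
    where
    𝟙in : V 6 → V n → ℕ
    𝟙in w a = 𝟙 (inClass? w a)
    N≢0 : norm c ≢ 0v
    N≢0 = ⊙-nonzero (⊙-nonzero (f≢0 (f≢0 c≢0)) (f≢0 c≢0)) c≢0
      where
      f≢0 : ∀ {e} → e ≢ 0v → fourth e ≢ 0v
      f≢0 e≢0 = ⊙-nonzero (⊙-nonzero e≢0 e≢0) (⊙-nonzero e≢0 e≢0)
    to : ∀ a → c • a ≢ 0v × cls (c • a) ≡ norm c ⊙ w → a ≢ 0v × cls a ≡ w
    to a (ca≢0 , eq) = (λ { refl → ca≢0 (•-zeroʳ c) }) , ⊙-injective N≢0 (trans (sym (cls-• c≢0 a)) eq)
    from : ∀ a → a ≢ 0v × cls a ≡ w → c • a ≢ 0v × cls (c • a) ≡ norm c ⊙ w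
    from a (a≢0 , eq) = •-nonzero c≢0 a≢0 , trans (cls-• c≢0 a) (cong (norm c ⊙_) eq)

  length-ofClass : ∀ {w} → CubeRoot w → length (ofClass w) ≡ K
  length-ofClass (inj₁ refl)        = refl
  length-ofClass (inj₂ (inj₁ refl)) = ofClass-scale {γ} (λ ()) one
  length-ofClass (inj₂ (inj₂ refl)) = ofClass-scale {γ²} (λ ()) one

  q≡3K+1 : q ≡ 3 * K + 1
  q≡3K+1 = sym (begin
    3 * K + 1
      ≡⟨ solve 1 (λ x → con 3 :* x :+ con 1 := con 1 :+ (x :+ (x :+ x))) refl K ⟩
    1 + (K + (K + K))
      ≡⟨ cong₂ _+_ (sym (∑-δ₁ {n} 0v)) (cong₂ _+_ (count one (inj₁ refl)) (cong₂ _+_ (count ω (inj₂ (inj₁ refl))) (count ω² (inj₂ (inj₂ refl))))) ⟩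
    ∑ (allV n) (δ 0v) + (∑ (allV n) (𝟙in one) + (∑ (allV n) (𝟙in ω) + ∑ (allV n) (𝟙in ω²)))
      ≡⟨ sym (trans (∑-+ (allV n) (δ 0v) _) (cong (∑ (allV n) (δ 0v) +_) (trans (∑-+ (allV n) (𝟙in one) _) (cong (∑ (allV n) (𝟙in one) +_) (∑-+ (allV n) (𝟙in ω) (𝟙in ω²)))))) ⟩
    ∑ (allV n) (λ a → δ 0v a + (𝟙in one a + (𝟙in ω a + 𝟙in ω² a)))
      ≡⟨ ∑-cong (allV n) (λ a → one-class a (a ≟V 0v)) ⟩
    ∑ (allV n) (λ _ → 1)
      ≡⟨ ∑-1 n ⟩
    q ∎)
    where
    𝟙in : V 6 → V n → ℕ
    𝟙in w a = 𝟙 (inClass? w a)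
    count : ∀ w → CubeRoot w → K ≡ ∑ (allV n) (𝟙in w)
    count w cr = trans (sym (length-ofClass cr)) (length-filter-∑ (inClass? w) (allV n))
    one-class : ∀ a → Dec (a ≡ 0v) → δ 0v a + (𝟙in one a + (𝟙in ω a + 𝟙in ω² a)) ≡ 1
    one-class a (yes refl) = cong₂ _+_ (𝟙-yes (0v {n} ≟V 0v) refl)
      (cong₂ _+_ (no₀ one) (cong₂ _+_ (no₀ ω) (no₀ ω²)))
      where
      no₀ : ∀ w → 𝟙in w 0v ≡ 0
      no₀ w = 𝟙-no (inClass? w 0v) (λ p → proj₁ p refl)
    one-class a (no a≢0) = cong₂ _+_ (𝟙-no (0v ≟V a) (a≢0 ∘ sym))
      (trans (cong₂ _+_ (eq one) (cong₂ _+_ (eq ω) (eq ω²))) (which (cls-cubeRoot a≢0)))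
      where
      eq : ∀ w → 𝟙in w a ≡ δ (cls a) w
      eq w = 𝟙-cong (inClass? w a) (cls a ≟V w) proj₂ (a≢0 ,_)
      which : ∀ {w} → CubeRoot w → δ w one + (δ w ω + δ w ω²) ≡ 1
      which (inj₁ refl)        = refl
      which (inj₂ (inj₁ refl)) = refl
      which (inj₂ (inj₂ refl)) = refl

-- Points and triples in a direct sum

++-⊕ : ∀ {m n} (a c : V m) (b d : V n) → (a ++ b) ⊕ (c ++ d) ≡ (a ⊕ c) ++ (b ⊕ d)
++-⊕ []      []      b d = refl
++-⊕ (s ∷ a) (t ∷ c) b d = cong ((s xor t) ∷_) (++-⊕ a c b d)

++-0 : ∀ m {n} → 0v {m} ++ 0v {n} ≡ 0v
++-0 zero    = refl
++-0 (suc m) = cong (false ∷_) (++-0 m)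

++-≡0 : ∀ {m n} (a : V m) (b : V n) → a ++ b ≡ 0v → a ≡ 0v × b ≡ 0v
++-≡0 {m} a b eq = ++-injective a 0v (trans eq (sym (++-0 m)))

𝟙-× : ∀ {P Q R : Set} (d : Dec P) (e : Dec Q) (f : Dec R) → (P → Q × R) → (Q → R → P) → 𝟙 d ≡ 𝟙 e * 𝟙 f
𝟙-× d (yes q) (yes r) to from = 𝟙-yes d (from q r)
𝟙-× d (yes q) (no ¬r) to from = 𝟙-no d (¬r ∘ proj₂ ∘ to)
𝟙-× d (no ¬q) f       to from = 𝟙-no d (¬q ∘ proj₁ ∘ to)

δ-++ : ∀ {m n} (a c : V m) (b d : V n) → δ (a ++ b) (c ++ d) ≡ δ b d * δ a c
δ-++ a c b d = 𝟙-× ((a ++ b) ≟V (c ++ d)) (b ≟V d) (a ≟V c)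
  (λ eq → proj₂ (++-injective a c eq) , proj₁ (++-injective a c eq)) (λ { refl refl → refl })

δᵇ : Bool → Bool → ℕ
δᵇ s t = 𝟙 (s ≟ᵇ t)

δ-∷ : ∀ {n} s t (x y : V n) → δ (s ∷ x) (t ∷ y) ≡ δᵇ s t * δ x y
δ-∷ s t x y = 𝟙-× ((s ∷ x) ≟V (t ∷ y)) (s ≟ᵇ t) (x ≟V y) (λ { refl → refl , refl }) (λ { refl refl → refl })

δ-shift : ∀ {n} (y x a : V n) → δ y (x ⊕ a) ≡ δ (y ⊕ a) x
δ-shift y x a = 𝟙-cong (y ≟V (x ⊕ a)) ((y ⊕ a) ≟V x) (λ { refl → ⊕-involutive a x }) (λ { refl → sym (⊕-involutive a y) })

δ-≢ : ∀ {n} {x y : V n} → x ≢ y → δ x y ≡ 0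
δ-≢ {x = x} {y} x≢y = 𝟙-no (x ≟V y) x≢y

bools : List Bool
bools = false ∷ true ∷ []

∈-bools : ∀ s → s ∈ bools
∈-bools false = here refl
∈-bools true  = there (here refl)

occurrences-expand : ∀ {n} (y p q r : V n) → occurrences y (p ∷ q ∷ r ∷ []) ≡
  δ y r + (δ y q + (δ y (q ⊕ r) + (δ y p + (δ y (p ⊕ r) + (δ y (p ⊕ q) + 0)))))
occurrences-expand y p q r =
  cong₂ _+_ (at (𝟘 ⊞ (𝟘 ⊞ (v₂ ⊞ 𝟘))) v₂ refl) (cong₂ _+_ (at (𝟘 ⊞ (v₁ ⊞ (𝟘 ⊞ 𝟘))) v₁ refl)
  (cong₂ _+_ (at (𝟘 ⊞ (v₁ ⊞ (v₂ ⊞ 𝟘))) (v₁ ⊞ v₂) refl) (cong₂ _+_ (at (v₀ ⊞ (𝟘 ⊞ (𝟘 ⊞ 𝟘))) v₀ refl)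
  (cong₂ _+_ (at (v₀ ⊞ (𝟘 ⊞ (v₂ ⊞ 𝟘))) (v₀ ⊞ v₂) refl) (cong (_+ 0) (at (v₀ ⊞ (v₁ ⊞ (𝟘 ⊞ 𝟘))) (v₀ ⊞ v₁) refl))))))
  where
  at : ∀ s t → parity s ≡ parity t → δ y (⟦ s ⟧ (p ∷ q ∷ r ∷ [])) ≡ δ y (⟦ t ⟧ (p ∷ q ∷ r ∷ []))
  at s t eq = cong (δ y) (⊕-solve s t eq (p ∷ q ∷ r ∷ []))

indep-triple : ∀ {n} {p q r : V n} → p ≢ 0v → q ≢ 0v → r ≢ 0v → p ⊕ q ≢ 0v → p ⊕ r ≢ 0v → q ⊕ r ≢ 0v → p ⊕ q ⊕ r ≢ 0v →
               Indep (p ∷ q ∷ r ∷ [])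
indep-triple {p = p} {q} {r} p≢0 q≢0 r≢0 pq≢0 pr≢0 qr≢0 pqr≢0 = go
  where
  ρ = p ∷ q ∷ r ∷ []
  via : ∀ {A : Set} s t → parity s ≡ parity t → ⟦ t ⟧ ρ ≢ 0v → ⟦ s ⟧ ρ ≡ 0v → A
  via s t eq ≢0 ≡0 = ⊥-elim (≢0 (trans (sym (⊕-solve s t eq ρ)) ≡0))
  go : Indep ρ
  go (false ∷ false ∷ false ∷ []) eq = refl
  go (false ∷ false ∷ true ∷ [])  eq = via (𝟘 ⊞ (𝟘 ⊞ (v₂ ⊞ 𝟘))) v₂ refl r≢0 eq
  go (false ∷ true ∷ false ∷ [])  eq = via (𝟘 ⊞ (v₁ ⊞ (𝟘 ⊞ 𝟘))) v₁ refl q≢0 eq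
  go (false ∷ true ∷ true ∷ [])   eq = via (𝟘 ⊞ (v₁ ⊞ (v₂ ⊞ 𝟘))) (v₁ ⊞ v₂) refl qr≢0 eq
  go (true ∷ false ∷ false ∷ [])  eq = via (v₀ ⊞ (𝟘 ⊞ (𝟘 ⊞ 𝟘))) v₀ refl p≢0 eq
  go (true ∷ false ∷ true ∷ [])   eq = via (v₀ ⊞ (𝟘 ⊞ (v₂ ⊞ 𝟘))) (v₀ ⊞ v₂) refl pr≢0 eq
  go (true ∷ true ∷ false ∷ [])   eq = via (v₀ ⊞ (v₁ ⊞ (𝟘 ⊞ 𝟘))) (v₀ ⊞ v₁) refl pq≢0 eq
  go (true ∷ true ∷ true ∷ [])    eq = via (v₀ ⊞ (v₁ ⊞ (v₂ ⊞ 𝟘))) (v₀ ⊞ v₁ ⊞ v₂) refl pqr≢0 eq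

-- Triangles with an apex in the given subspace

second : V 6 → Bool
second (_ ∷ s ∷ t ∷ _) = s xor t

second-add : ∀ x y → second (x ⊕ y) ≡ second x xor second y
second-add (_ ∷ s ∷ t ∷ _) (_ ∷ s′ ∷ t′ ∷ _) = xor-interchange s s′ t t′

concatMap-all : ∀ {A B : Set} {P : B → Set} (f : A → List B) (xs : List A) →
                (∀ {x} → x ∈ xs → ∀ {y} → y ∈ f x → P y) → ∀ {y} → y ∈ concatMap f xs → P y
concatMap-all f xs all y∈ with ∈-concatMap-inv f {xs = xs} y∈
... | x , x∈ , y∈′ = all x∈ y∈′

map-all : ∀ {A B : Set} {P : B → Set} (f : A → B) (xs : List A) → (∀ {x} → x ∈ xs → P (f x)) → ∀ {y} → y ∈ map f xs → P y
map-all f xs all y∈ with ∈-map⁻ f y∈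
... | x , x∈ , refl = all x∈

module Apexes (k : ℕ) where
  open Classes k

  -- Adding the difference `e ∷ a` flips `hbit` and preserves `fbit`; adding either apex direction
  -- flips `fbit`. Thus `hbit` selects one end of a base, and `fbit` selects its apex independently
  -- of the end.
  hbit fbit : V n → V (suc n) → Bool
  hbit a x = head (φ a (tail x))
  fbit a x = second (φ a (tail x))

  hbit-add : ∀ a x y → hbit a (x ⊕ y) ≡ hbit a x xor hbit a y
  hbit-add a (s ∷ x) (t ∷ y) = trans (cong head (φ-add a x y)) (head-add (φ a x) (φ a y))
    where
    head-add : ∀ (x y : V 6) → head (x ⊕ y) ≡ head x xor head y
    head-add (s ∷ _) (t ∷ _) = refl

  fbit-add : ∀ a x y → fbit a (x ⊕ y) ≡ fbit a x xor fbit a y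
  fbit-add a (s ∷ x) (t ∷ y) = trans (cong second (φ-add a x y)) (second-add (φ a x) (φ a y))

  -- On the plane spanned by the three differences a, γ a, γ² a, the form fbit a vanishes only at a.
  module _ {a : V n} (a≢0 : a ≢ 0v) (e : Bool) where

    φ-one : φ a a ≡ one
    φ-one = trans (cong (φ a) (sym (one-T a))) (φ-•self a≢0 one)

    hbit-self : hbit a (e ∷ a) ≡ true
    hbit-self = cong head φ-one

    fbit-self : fbit a (e ∷ a) ≡ false
    fbit-self = cong second φ-one

    fbit-γ : fbit a (e ∷ (γ • a)) ≡ true
    fbit-γ = cong second (φ-•self a≢0 γ)

    fbit-γ² : fbit a (e ∷ (γ² • a)) ≡ true
    fbit-γ² = cong second (φ-•self a≢0 γ²)

  apexScalar : Bool → V 6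
  apexScalar false = γ
  apexScalar true  = γ²

  apexScalar≢0 : ∀ s → apexScalar s ≢ 0v
  apexScalar≢0 false ()
  apexScalar≢0 true  ()

  apexScalar≢one : ∀ s → apexScalar s ≢ one
  apexScalar≢one false ()
  apexScalar≢one true  ()

  fbit-apex : ∀ {a} → a ≢ 0v → ∀ e s → fbit a (e ∷ (apexScalar s • a)) ≡ true
  fbit-apex a≢0 e false = fbit-γ a≢0 e
  fbit-apex a≢0 e true  = fbit-γ² a≢0 e

  -- The two ends of a base get the same apex. On a line with apex direction P the points `x` and
  -- `x ⊕ P` have different `fbit`, so exactly one of them is joined to P: each such line is used
  -- once.
  apex : V n → Bool → V (suc n) → V (suc n)
  apex a e x = e ∷ (apexScalar (fbit a x) • a)

  low? : ∀ a → Decidable (λ x → hbit a x ≡ false)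
  low? a x = hbit a x ≟ᵇ false

  -- One end of each pair `x`, `x ⊕ (e ∷ a)`, so that no base is listed twice.
  low : V n → List (V (suc n))
  low a = filter (low? a) (allV (suc n))

  triangle₂ : V 6 → V n → Bool → V (suc n) → Triple (suc n + 6)
  triangle₂ b a e x = (apex a e x ++ 0v) ∷ (x ++ b) ∷ ((x ⊕ (e ∷ a)) ++ b) ∷ []

  family₂-e : V 6 → V n → Bool → List (Triple (suc n + 6))
  family₂-e b a e = map (triangle₂ b a e) (low a)

  family₂-a : V 6 → V n → List (Triple (suc n + 6))
  family₂-a b a = concatMap (family₂-e b a) bools

  -- For a direction Y exactly one of Y, γ⁻¹Y, γ⁻²Y has class `norm b`. So `b` decides whether Y is
  -- a base, an apex of the form γ`a`, or one of the form γ²`a`.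
  family₂ : V 6 → List (Triple (suc n + 6))
  family₂ b = concatMap (family₂-a b) (ofClass (norm b))

  triangles₂ : List (Triple (suc n + 6))
  triangles₂ = concatMap family₂ (nonzero 6)

  ∑-triangles₂ : ∀ f → ∑ triangles₂ f ≡
    ∑ (nonzero 6) (λ b → ∑ (ofClass (norm b)) (λ a → ∑ bools (λ e → ∑ (low a) (λ x → f (triangle₂ b a e x)))))
  ∑-triangles₂ f = trans (∑-concatMap family₂ (nonzero 6) f) (∑-cong (nonzero 6) (λ b →
    trans (∑-concatMap (family₂-a b) (ofClass (norm b)) f) (∑-cong (ofClass (norm b)) (λ a →
    trans (∑-concatMap (family₂-e b a) bools f) (∑-cong bools (λ e → ∑-map (triangle₂ b a e) (low a) f))))))

  ∈-triangles₂ : ∀ {b a e x} → b ≢ 0v → a ≢ 0v → cls a ≡ norm b → hbit a x ≡ false → triangle₂ b a e x ∈ triangles₂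
  ∈-triangles₂ {b} {a} {e} {x} b≢0 a≢0 eq low-x =
    ∈-concatMap family₂ (∈-nonzero b≢0) (∈-concatMap (family₂-a b) (∈-ofClass a≢0 eq)
    (∈-concatMap (family₂-e b a) (∈-bools e) (∈-map⁺ (triangle₂ b a e) (∈-filter⁺ (low? a) (∈-allV x) low-x))))

  triangle₂-indep : ∀ {b a} → b ≢ 0v → a ≢ 0v → ∀ e x → Indep (triangle₂ b a e x)
  triangle₂-indep {b} {a} b≢0 a≢0 e x = indep-triple
    (λ eq → •-nonzero {apexScalar s} (apexScalar≢0 s) a≢0 (cong tail (proj₁ (++-≡0 (apex a e x) 0v eq))))
    (λ eq → b≢0 (proj₂ (++-≡0 x b eq)))
    (λ eq → b≢0 (proj₂ (++-≡0 (x ⊕ (e ∷ a)) b eq)))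
    (λ eq → b≢0 (trans (sym (⊕-identityˡ b)) (proj₂ (++-≡0 (apex a e x ⊕ x) (0v ⊕ b) (trans (sym (++-⊕ (apex a e x) x 0v b)) eq)))))
    (λ eq → b≢0 (trans (sym (⊕-identityˡ b)) (proj₂ (++-≡0 (apex a e x ⊕ (x ⊕ (e ∷ a))) (0v ⊕ b) (trans (sym (++-⊕ (apex a e x) (x ⊕ (e ∷ a)) 0v b)) eq)))))
    (λ eq → a≢0 (cong tail (trans (sym shift) (proj₁ (++-≡0 (x ⊕ (x ⊕ (e ∷ a))) (b ⊕ b) (trans (sym (++-⊕ x (x ⊕ (e ∷ a)) b b)) eq))))))
    (λ eq → apexScalar≢one s (•-injectiveˡ a≢0 (trans (⊕-≡0⇒≡ (cong tail (trans (sym shift₂)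
      (proj₁ (++-≡0 (apex a e x ⊕ x ⊕ (x ⊕ (e ∷ a))) (0v ⊕ b ⊕ b) (trans (sym sum₃) eq)))))) (sym (one-T a)))))
    where
    s = fbit a x
    shift : x ⊕ (x ⊕ (e ∷ a)) ≡ e ∷ a
    shift = ⊕-solve (v₀ ⊞ (v₀ ⊞ v₁)) v₁ refl (x ∷ (e ∷ a) ∷ [])
    shift₂ : apex a e x ⊕ x ⊕ (x ⊕ (e ∷ a)) ≡ apex a e x ⊕ (e ∷ a)
    shift₂ = ⊕-solve (v₀ ⊞ v₁ ⊞ (v₁ ⊞ v₂)) (v₀ ⊞ v₂) refl (apex a e x ∷ x ∷ (e ∷ a) ∷ [])
    sum₃ : (apex a e x ++ 0v) ⊕ (x ++ b) ⊕ ((x ⊕ (e ∷ a)) ++ b) ≡ (apex a e x ⊕ x ⊕ (x ⊕ (e ∷ a))) ++ (0v ⊕ b ⊕ b)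
    sum₃ = trans (cong (_⊕ ((x ⊕ (e ∷ a)) ++ b)) (++-⊕ (apex a e x) x 0v b)) (++-⊕ (apex a e x ⊕ x) (x ⊕ (e ∷ a)) (0v ⊕ b) b)

  indep₂ : ∀ {ρ} → ρ ∈ triangles₂ → Indep ρ
  indep₂ = concatMap-all {P = Indep} family₂ (nonzero 6) λ {b} b∈ → concatMap-all {P = Indep} (family₂-a b) (ofClass (norm b)) λ {a} a∈ →
    concatMap-all {P = Indep} (family₂-e b a) bools λ {e} _ → map-all {P = Indep} (triangle₂ b a e) (low a) λ {x} _ →
    triangle₂-indep (∈-nonzero⁻ b∈) (proj₁ (∈-ofClass⁻ a∈)) e x

xor-true : ∀ s → s xor true ≡ not s
xor-true false = refl
xor-true true  = refl

low-xor : ∀ s → 𝟙 (s ≟ᵇ false) + 𝟙 ((s xor true) ≟ᵇ false) ≡ 1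
low-xor false = refl
low-xor true  = refl

∑-δ-bools : ∀ {n} s (x y : V n) → ∑ bools (λ t → δ (s ∷ x) (t ∷ y)) ≡ δ x y
∑-δ-bools s x y = trans (∑-cong bools (λ t → δ-∷ s t x y)) (trans (∑-*ʳ bools (δ x y) (δᵇ s)) (go s))
  where
  go : ∀ s → ∑ bools (δᵇ s) * δ x y ≡ δ x y
  go false = *-identityˡ _
  go true  = *-identityˡ _

double-injective : ∀ {x y} → x + x ≡ y + y → x ≡ y
double-injective {x} {y} eq = *-cancelˡ-≡ x y 2 (trans (cong (x +_) (+-identityʳ x)) (trans eq (sym (cong (y +_) (+-identityʳ y)))))

∑-translate : ∀ {n} (a : V n) (f : V n → ℕ) → ∑ (allV n) (λ x → f (x ⊕ a)) ≡ ∑ (allV n) f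
∑-translate a f = ∑-bij (_⊕ a) (_⊕ a) (⊕-involutive a) (⊕-involutive a) f

norm-fibre : ∀ w → CubeRoot w → ∑ (nonzero 6) (λ b → δ w (norm b)) ≡ 21
norm-fibre w (inj₁ refl)        = refl
norm-fibre w (inj₂ (inj₁ refl)) = refl
norm-fibre w (inj₂ (inj₂ refl)) = refl

module ApexCounts (k : ℕ) where
  open Classes k
  open Apexes k

  module Difference {a : V n} (a≢0 : a ≢ 0v) (e : Bool) where

    A : V (suc n)
    A = e ∷ a

    H : V (suc n) → ℕ
    H x = 𝟙 (low? a x)

    F : Bool → V (suc n) → ℕ
    F s x = 𝟙 (fbit a x ≟ᵇ s)

    hbit-A : ∀ x → hbit a (x ⊕ A) ≡ hbit a x xor true
    hbit-A x = trans (hbit-add a x A) (cong (hbit a x xor_) (hbit-self a≢0 e))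

    fbit-A : ∀ x → fbit a (x ⊕ A) ≡ fbit a x
    fbit-A x = trans (fbit-add a x A) (trans (cong (fbit a x xor_) (fbit-self a≢0 e)) (xor-identityʳ (fbit a x)))

    H-A : ∀ x → H x + H (x ⊕ A) ≡ 1
    H-A x = trans (cong (λ s → H x + 𝟙 (s ≟ᵇ false)) (hbit-A x)) (low-xor (hbit a x))

    -- `π x` is the third point on the line from `x` to its apex. As `fbit` changes along this line,
    -- the apex used at `x` is recovered from `π x` by negating the bit.
    π π⁻ : V (suc n) → V (suc n)
    π  x = x ⊕ apex a e x
    π⁻ x = x ⊕ (e ∷ (apexScalar (not (fbit a x)) • a))

    fbit-π : ∀ x s → fbit a (x ⊕ (e ∷ (apexScalar s • a))) ≡ not (fbit a x)
    fbit-π x s = trans (fbit-add a x (e ∷ (apexScalar s • a))) (trans (cong (fbit a x xor_) (fbit-apex a≢0 e s)) (xor-true (fbit a x)))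

    π-π⁻ : ∀ x → π (π⁻ x) ≡ x
    π-π⁻ x = trans (cong (λ s → π⁻ x ⊕ (e ∷ (apexScalar s • a))) (fbit-π x (not (fbit a x))))
                   (⊕-involutive (e ∷ (apexScalar (not (fbit a x)) • a)) x)

    π⁻-π : ∀ x → π⁻ (π x) ≡ x
    π⁻-π x = trans (cong (λ s → π x ⊕ (e ∷ (apexScalar s • a))) (trans (cong not (fbit-π x (fbit a x))) (not-involutive (fbit a x))))
                   (⊕-involutive (apex a e x) x)

    π⁻-A : ∀ x → π⁻ (x ⊕ A) ≡ π⁻ x ⊕ A
    π⁻-A x = trans (cong (λ s → (x ⊕ A) ⊕ (e ∷ (apexScalar (not s) • a))) (fbit-A x))
                   (⊕-solve (v₀ ⊞ v₁ ⊞ v₂) (v₀ ⊞ v₂ ⊞ v₁) refl (x ∷ A ∷ (e ∷ (apexScalar (not (fbit a x)) • a)) ∷ []))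

    ∑-low : ∀ f → ∑ (low a) f ≡ ∑ (allV (suc n)) (λ x → H x * f x)
    ∑-low f = ∑-filter (low? a) (allV (suc n)) f

    base-count : ∀ y → ∑ (low a) (λ x → δ y x + δ y (x ⊕ A)) ≡ 1
    base-count y = begin
      ∑ (low a) (λ x → δ y x + δ y (x ⊕ A))
        ≡⟨ ∑-+ (low a) (δ y) (λ x → δ y (x ⊕ A)) ⟩
      ∑ (low a) (δ y) + ∑ (low a) (λ x → δ y (x ⊕ A))
        ≡⟨ cong₂ _+_ (at y (λ x → δ y x) (λ _ → refl)) (at (y ⊕ A) (λ x → δ y (x ⊕ A)) (λ x → δ-shift y x A)) ⟩
      H y + H (y ⊕ A)
        ≡⟨ H-A y ⟩
      1 ∎
      where
      at : ∀ z f → (∀ x → f x ≡ δ z x) → ∑ (low a) f ≡ H z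
      at z f eq = trans (∑-low f) (trans (∑-cong (allV (suc n)) (λ x → trans (*-comm (H x) (f x)) (cong (_* H x) (eq x)))) (∑-δ z H))

    -- The inverse `π⁻` commutes with the shift by `A`, so exactly one of `π⁻ y` and `π⁻ (y ⊕ A)` is
    -- low.
    side-count : ∀ y → ∑ (low a) (λ x → δ y (π x) + δ y (π x ⊕ A)) ≡ 1
    side-count y = begin
      ∑ (low a) (λ x → δ y (π x) + δ y (π x ⊕ A))
        ≡⟨ ∑-+ (low a) (δ y ∘ π) (λ x → δ y (π x ⊕ A)) ⟩
      ∑ (low a) (δ y ∘ π) + ∑ (low a) (λ x → δ y (π x ⊕ A))
        ≡⟨ cong₂ _+_ (at y (δ y ∘ π) (λ _ → refl)) (at (y ⊕ A) (λ x → δ y (π x ⊕ A)) (λ x → δ-shift y (π x) A)) ⟩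
      H (π⁻ y) + H (π⁻ (y ⊕ A))
        ≡⟨ cong (λ z → H (π⁻ y) + H z) (π⁻-A y) ⟩
      H (π⁻ y) + H (π⁻ y ⊕ A)
        ≡⟨ H-A (π⁻ y) ⟩
      1 ∎
      where
      at : ∀ z f → (∀ x → f x ≡ δ z (π x)) → ∑ (low a) f ≡ H (π⁻ z)
      at z f eq = trans (∑-low f) (trans (∑-cong (allV (suc n)) (λ x → trans (*-comm (H x) (f x)) (cong (_* H x) (eq x))))
                                         (∑-δ-bij π π⁻ π-π⁻ π⁻-π z H))

    length-low : length (low a) ≡ q
    length-low = double-injective (begin
      length (low a) + length (low a)
        ≡⟨ cong (λ m → m + m) (length-filter-∑ (low? a) (allV (suc n))) ⟩
      ∑ (allV (suc n)) H + ∑ (allV (suc n)) H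
        ≡⟨ cong (∑ (allV (suc n)) H +_) (sym (∑-translate A H)) ⟩
      ∑ (allV (suc n)) H + ∑ (allV (suc n)) (λ x → H (x ⊕ A))
        ≡⟨ sym (∑-+ (allV (suc n)) H (λ x → H (x ⊕ A))) ⟩
      ∑ (allV (suc n)) (λ x → H x + H (x ⊕ A))
        ≡⟨ ∑-cong (allV (suc n)) H-A ⟩
      ∑ (allV (suc n)) (λ _ → 1)
        ≡⟨ ∑-1 (suc n) ⟩
      q + (q + 0)
        ≡⟨ cong (q +_) (+-identityʳ q) ⟩
      q + q ∎)

    half : ℕ
    half = ∑ (low a) (F false)

    -- Translation by γ a, followed by a if necessary to return to the low half, exchanges the two values of fbit.
    half-true : ∑ (low a) (F true) ≡ half
    half-true = begin
      ∑ (low a) (F true)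
        ≡⟨ ∑-low (F true) ⟩
      ∑ (allV (suc n)) (λ x → H x * F true x)
        ≡⟨ sym (∑-bij τ τ τ-τ τ-τ (λ x → H x * F true x)) ⟩
      ∑ (allV (suc n)) (λ x → H (τ x) * F true (τ x))
        ≡⟨ ∑-cong (allV (suc n)) (λ x → cong₂ _*_ (cong (λ s → 𝟙 (s ≟ᵇ false)) (hbit-τ x))
             (trans (cong (λ s → 𝟙 (s ≟ᵇ true)) (fbit-τ x)) (𝟙-not (fbit a x)))) ⟩
      ∑ (allV (suc n)) (λ x → H x * F false x)
        ≡⟨ sym (∑-low (F false)) ⟩
      half ∎
      where
      Γ : V (suc n)
      Γ = (e ∷ (γ • a)) ⊕ (hbit a (e ∷ (γ • a)) · A)
      τ : V (suc n) → V (suc n)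
      τ x = x ⊕ Γ
      τ-τ : ∀ x → τ (τ x) ≡ x
      τ-τ = ⊕-involutive Γ
      hbit-· : ∀ s → hbit a (s · A) ≡ s
      hbit-· true  = hbit-self a≢0 e
      hbit-· false = xor-cancel (trans (cong (hbit a) (sym (⊕-self 0v))) (hbit-add a 0v 0v))
        where
        xor-cancel : ∀ {s} → s ≡ s xor s → s ≡ false
        xor-cancel {false} _ = refl
        xor-cancel {true} eq = eq
      fbit-· : ∀ s → fbit a (s · A) ≡ false
      fbit-· true  = fbit-self a≢0 e
      fbit-· false = trans (cong (fbit a) (sym (⊕-self A))) (trans (fbit-A A) (fbit-self a≢0 e))
      hbit-τ : ∀ x → hbit a (τ x) ≡ hbit a x
      hbit-τ x = trans (hbit-add a x Γ) (trans (cong (hbit a x xor_) (trans (hbit-add a (e ∷ (γ • a)) (h · A))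
        (trans (cong (h xor_) (hbit-· h)) (xor-same h)))) (xor-identityʳ (hbit a x)))
        where
        h = hbit a (e ∷ (γ • a))
      fbit-τ : ∀ x → fbit a (τ x) ≡ not (fbit a x)
      fbit-τ x = trans (fbit-add a x Γ) (trans (cong (fbit a x xor_) (trans (fbit-add a (e ∷ (γ • a)) (hbit a (e ∷ (γ • a)) · A))
        (cong₂ _xor_ (fbit-γ a≢0 e) (fbit-· (hbit a (e ∷ (γ • a))))))) (xor-true (fbit a x)))
      𝟙-not : ∀ s → 𝟙 (not s ≟ᵇ true) ≡ 𝟙 (s ≟ᵇ false)
      𝟙-not false = refl
      𝟙-not true  = refl

    half+half : half + half ≡ q
    half+half = begin
      half + half
        ≡⟨ cong (half +_) (sym half-true) ⟩
      ∑ (low a) (F false) + ∑ (low a) (F true)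
        ≡⟨ sym (∑-+ (low a) (F false) (F true)) ⟩
      ∑ (low a) (λ x → F false x + F true x)
        ≡⟨ ∑-cong (low a) (λ x → one-value (fbit a x)) ⟩
      ∑ (low a) (λ _ → 1)
        ≡⟨ sym (length-∑ (low a)) ⟩
      length (low a)
        ≡⟨ length-low ⟩
      q ∎
      where
      one-value : ∀ s → 𝟙 (s ≟ᵇ false) + 𝟙 (s ≟ᵇ true) ≡ 1
      one-value false = refl
      one-value true  = refl

    -- Each apex direction serves one half of the low points, which is the deficit against the base
    -- direction that the three roles have to even out.
    apex-count : ∀ y → ∑ (low a) (λ x → δ y (apex a e x)) ≡ half * (δ y (e ∷ (γ • a)) + δ y (e ∷ (γ² • a)))
    apex-count y = begin
      ∑ (low a) (λ x → δ y (apex a e x))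
        ≡⟨ ∑-cong (low a) (λ x → split (fbit a x)) ⟩
      ∑ (low a) (λ x → F false x * d false + F true x * d true)
        ≡⟨ ∑-+ (low a) (λ x → F false x * d false) (λ x → F true x * d true) ⟩
      ∑ (low a) (λ x → F false x * d false) + ∑ (low a) (λ x → F true x * d true)
        ≡⟨ cong₂ _+_ (∑-*ʳ (low a) (d false) (F false)) (trans (∑-*ʳ (low a) (d true) (F true)) (cong (_* d true) half-true)) ⟩
      half * d false + half * d true
        ≡⟨ sym (*-distribˡ-+ half (d false) (d true)) ⟩
      half * (d false + d true) ∎
      where
      d : Bool → ℕ
      d s = δ y (e ∷ (apexScalar s • a))
      split : ∀ s → d s ≡ 𝟙 (s ≟ᵇ false) * d false + 𝟙 (s ≟ᵇ true) * d true
      split false = sym (trans (+-identityʳ _) (*-identityˡ (d false)))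
      split true  = sym (*-identityˡ (d true))

module Class₂ (k : ℕ) where
  open Classes k
  open Apexes k
  open ApexCounts k

  ∑-ofClass : ∀ {c Y} → c ≢ 0v → Y ≢ 0v → ∀ w → ∑ (ofClass w) (λ a → δ Y (c • a)) ≡ δ (cls (inv c • Y)) w
  ∑-ofClass {c} {Y} c≢0 Y≢0 w = begin
    ∑ (ofClass w) (λ a → δ Y (c • a))
      ≡⟨ ∑-filter (inClass? w) (allV n) (λ a → δ Y (c • a)) ⟩
    ∑ (allV n) (λ a → 𝟙 (inClass? w a) * δ Y (c • a))
      ≡⟨ ∑-cong (allV n) (λ a → *-comm (𝟙 (inClass? w a)) (δ Y (c • a))) ⟩
    ∑ (allV n) (λ a → δ Y (c • a) * 𝟙 (inClass? w a))
      ≡⟨ ∑-δ-bij (c •_) (inv c •_) (•-inverseʳ c≢0) (•-inverse c≢0) Y (λ a → 𝟙 (inClass? w a)) ⟩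
    𝟙 (inClass? w (inv c • Y))
      ≡⟨ 𝟙-cong (inClass? w (inv c • Y)) (cls (inv c • Y) ≟V w) proj₂ (•-nonzero (inv-nonzero c≢0) Y≢0 ,_) ⟩
    δ (cls (inv c • Y)) w ∎

  -- The scalar `c` stands for a role: 1 for the base, γ and γ² for the apexes. `Y` plays it for a =
  -- c⁻¹Y, and the `b` that admit this a are the 21 elements whose norm is its class.
  ∑-role : ∀ {c Y} → c ≢ 0v → Y ≢ 0v → ∑ (nonzero 6) (λ b → ∑ (ofClass (norm b)) (λ a → δ Y (c • a))) ≡ 21
  ∑-role {c} {Y} c≢0 Y≢0 = trans (∑-cong (nonzero 6) (λ b → ∑-ofClass c≢0 Y≢0 (norm b)))
    (norm-fibre (cls (inv c • Y)) (cls-cubeRoot (•-nonzero (inv-nonzero c≢0) Y≢0)))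

  module _ {a : V n} (a≢0 : a ≢ 0v) where

    occurrences₂ : ∀ y d b e x → occurrences (y ++ d) (triangle₂ b a e x) ≡
      δ d b * ((δ y x + δ y (x ⊕ (e ∷ a))) + (δ y (x ⊕ apex a e x) + δ y ((x ⊕ apex a e x) ⊕ (e ∷ a)))) +
      δ d 0v * (δ y (e ∷ a) + δ y (apex a e x))
    occurrences₂ y d b e x = begin
      occurrences (y ++ d) (triangle₂ b a e x)
        ≡⟨ occurrences-expand (y ++ d) (P ++ 0v) (x ++ b) ((x ⊕ A) ++ b) ⟩
      _ ≡⟨ cong₂ _+_ (δ-++ y (x ⊕ A) d b) (cong₂ _+_ (δ-++ y x d b)
           (cong₂ _+_ (at x (x ⊕ A) b b A 0v (⊕-solve (v₀ ⊞ (v₀ ⊞ v₁)) v₁ refl (x ∷ A ∷ [])) (⊕-self b))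
           (cong₂ _+_ (δ-++ y P d 0v)
           (cong₂ _+_ (at P (x ⊕ A) 0v b ((x ⊕ P) ⊕ A) b (⊕-solve (v₀ ⊞ (v₁ ⊞ v₂)) (v₁ ⊞ v₀ ⊞ v₂) refl (P ∷ x ∷ A ∷ [])) (⊕-identityˡ b))
           (cong (_+ 0) (at P x 0v b (x ⊕ P) b (⊕-comm P x) (⊕-identityˡ b))))))) ⟩
      D * δ y (x ⊕ A) + (D * δ y x + (D₀ * δ y A + (D₀ * δ y P + (D * δ y ((x ⊕ P) ⊕ A) + (D * δ y (x ⊕ P) + 0)))))
        ≡⟨ solve 8 (λ D D₀ x₁ x₂ x₃ x₄ x₅ x₆ → D :* x₂ :+ (D :* x₁ :+ (D₀ :* x₅ :+ (D₀ :* x₆ :+ (D :* x₄ :+ (D :* x₃ :+ con 0)))))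
             := D :* ((x₁ :+ x₂) :+ (x₃ :+ x₄)) :+ D₀ :* (x₅ :+ x₆)) refl
             D D₀ (δ y x) (δ y (x ⊕ A)) (δ y (x ⊕ P)) (δ y ((x ⊕ P) ⊕ A)) (δ y A) (δ y P) ⟩
      D * ((δ y x + δ y (x ⊕ A)) + (δ y (x ⊕ P) + δ y ((x ⊕ P) ⊕ A))) + D₀ * (δ y A + δ y P) ∎
      where
      A = e ∷ a
      P = apex a e x
      D = δ d b
      D₀ = δ d 0v
      at : ∀ u v c c′ w z → u ⊕ v ≡ w → c ⊕ c′ ≡ z → δ (y ++ d) ((u ++ c) ⊕ (v ++ c′)) ≡ δ d z * δ y w
      at u v c c′ w z refl refl = trans (cong (δ (y ++ d)) (++-⊕ u v c c′)) (δ-++ y (u ⊕ v) d (c ⊕ c′))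

    -- `half` formally depends on `a` and `e`; counting with an arbitrary half of `q` makes the
    -- results uniform in both.
    module _ {s} (s+s : s + s ≡ q) where

      low-count : ∀ y d b e → ∑ (low a) (λ x → occurrences (y ++ d) (triangle₂ b a e x)) ≡
        δ d b * 2 + δ d 0v * (q * δ y (e ∷ a) + s * (δ y (e ∷ (γ • a)) + δ y (e ∷ (γ² • a))))
      low-count y d b e = begin
        ∑ (low a) (λ x → occurrences (y ++ d) (triangle₂ b a e x))
          ≡⟨ ∑-cong (low a) (occurrences₂ y d b e) ⟩
        ∑ (low a) (λ x → δ d b * (f₁ x + f₂ x) + δ d 0v * (δ y (e ∷ a) + f₃ x))
          ≡⟨ ∑-+ (low a) (λ x → δ d b * (f₁ x + f₂ x)) (λ x → δ d 0v * (δ y (e ∷ a) + f₃ x)) ⟩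
        ∑ (low a) (λ x → δ d b * (f₁ x + f₂ x)) + ∑ (low a) (λ x → δ d 0v * (δ y (e ∷ a) + f₃ x))
          ≡⟨ cong₂ _+_ (∑-*ˡ (low a) (δ d b) (λ x → f₁ x + f₂ x)) (∑-*ˡ (low a) (δ d 0v) (λ x → δ y (e ∷ a) + f₃ x)) ⟩
        δ d b * ∑ (low a) (λ x → f₁ x + f₂ x) + δ d 0v * ∑ (low a) (λ x → δ y (e ∷ a) + f₃ x)
          ≡⟨ cong₂ (λ i j → δ d b * i + δ d 0v * j)
               (trans (∑-+ (low a) f₁ f₂) (cong₂ _+_ (base-count y) (side-count y)))
               (trans (∑-+ (low a) (λ _ → δ y (e ∷ a)) f₃)
                 (cong₂ _+_ (trans (∑-const (low a) (δ y (e ∷ a))) (cong (_* δ y (e ∷ a)) length-low))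
                            (trans (apex-count y) (cong (_* (δ y (e ∷ (γ • a)) + δ y (e ∷ (γ² • a)))) (double-injective {half} {s} (trans half+half (sym s+s))))))) ⟩
        δ d b * 2 + δ d 0v * (q * δ y (e ∷ a) + s * (δ y (e ∷ (γ • a)) + δ y (e ∷ (γ² • a)))) ∎
        where
        open Difference a≢0 e
        f₁ f₂ f₃ : V (suc n) → ℕ
        f₁ x = δ y x + δ y (x ⊕ (e ∷ a))
        f₂ x = δ y (x ⊕ apex a e x) + δ y ((x ⊕ apex a e x) ⊕ (e ∷ a))
        f₃ x = δ y (apex a e x)

      -- Over `b` a point is hit twice for each `e`: once as an end of a base and once as the third
      -- point of a side through an apex. Over 0 only the directions `a`, γ`a` and γ²`a` are hit.
      bools-count : ∀ f Y d b → ∑ bools (λ e → ∑ (low a) (λ x → occurrences ((f ∷ Y) ++ d) (triangle₂ b a e x))) ≡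
        δ d b * 4 + δ d 0v * (q * δ Y a + s * (δ Y (γ • a) + δ Y (γ² • a)))
      bools-count f Y d b = begin
        ∑ bools (λ e → ∑ (low a) (λ x → occurrences ((f ∷ Y) ++ d) (triangle₂ b a e x)))
          ≡⟨ ∑-cong bools (low-count (f ∷ Y) d b) ⟩
        ∑ bools (λ e → D * 2 + D₀ * (q * g₀ e + s * (g₁ e + g₂ e)))
          ≡⟨ solve 10 (λ D D₀ q s a₀ a₁ b₀ b₁ c₀ c₁ →
               (D :* con 2 :+ D₀ :* (q :* a₀ :+ s :* (b₀ :+ c₀))) :+ ((D :* con 2 :+ D₀ :* (q :* a₁ :+ s :* (b₁ :+ c₁))) :+ con 0)
               := D :* con 4 :+ D₀ :* (q :* (a₀ :+ (a₁ :+ con 0)) :+ s :* ((b₀ :+ (b₁ :+ con 0)) :+ (c₀ :+ (c₁ :+ con 0))))) refl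
               D D₀ q s (g₀ false) (g₀ true) (g₁ false) (g₁ true) (g₂ false) (g₂ true) ⟩
        D * 4 + D₀ * (q * ∑ bools g₀ + s * (∑ bools g₁ + ∑ bools g₂))
          ≡⟨ cong₂ (λ i j → D * 4 + D₀ * (q * i + s * j)) (∑-δ-bools f Y a) (cong₂ _+_ (∑-δ-bools f Y (γ • a)) (∑-δ-bools f Y (γ² • a))) ⟩
        D * 4 + D₀ * (q * δ Y a + s * (δ Y (γ • a) + δ Y (γ² • a))) ∎
        where
        D = δ d b
        D₀ = δ d 0v
        g₀ g₁ g₂ : Bool → ℕ
        g₀ e = δ (f ∷ Y) (e ∷ a)
        g₁ e = δ (f ∷ Y) (e ∷ (γ • a))
        g₂ e = δ (f ∷ Y) (e ∷ (γ² • a))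

  length-ofNorm : ∀ {b} → b ∈ nonzero 6 → length (ofClass (norm b)) ≡ K
  length-ofNorm b∈ = length-ofClass (norm-cubeRoot _ (∈-nonzero⁻ b∈))

  half-exists : ∀ {Y} → Y ≢ 0v → ∃ λ s → s + s ≡ q
  half-exists Y≢0 = Difference.half Y≢0 false , Difference.half+half Y≢0 false

  -- The number q is odd only for n = 0, when this family is empty.
  ∑-family₂ : ∀ {b} → b ∈ nonzero 6 → ∀ {g : V n → ℕ} {h : Triple (suc n + 6) → ℕ} →
    (∀ {a s} → a ≢ 0v → s + s ≡ q → ∑ bools (λ e → ∑ (low a) (λ x → h (triangle₂ b a e x))) ≡ g a) →
    ∑ (ofClass (norm b)) (λ a → ∑ bools (λ e → ∑ (low a) (λ x → h (triangle₂ b a e x)))) ≡ ∑ (ofClass (norm b)) g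
  ∑-family₂ b∈ eq = ∑-cong-∈ (ofClass _) (λ {a} a∈ → eq {a} {proj₁ (half-exists (proj₁ (∈-ofClass⁻ a∈)))} (proj₁ (∈-ofClass⁻ a∈)) (proj₂ (half-exists (proj₁ (∈-ofClass⁻ a∈)))))

  cover₂-outside : ∀ f Y {d} → d ≢ 0v → ∑ triangles₂ (occurrences ((f ∷ Y) ++ d)) ≡ 4 * K
  cover₂-outside f Y {d} d≢0 = begin
    ∑ triangles₂ (occurrences ((f ∷ Y) ++ d))
      ≡⟨ ∑-triangles₂ (occurrences ((f ∷ Y) ++ d)) ⟩
    ∑ (nonzero 6) (λ b → ∑ (ofClass (norm b)) (λ a → ∑ bools (λ e → ∑ (low a) (λ x → occurrences ((f ∷ Y) ++ d) (triangle₂ b a e x)))))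
      ≡⟨ ∑-cong-∈ (nonzero 6) {g = λ b → δ d b * (4 * K)} (λ {b} b∈ → trans
           (∑-family₂ b∈ {g = λ _ → δ d b * 4} {h = occurrences ((f ∷ Y) ++ d)} (λ {a} {s} a≢0 s+s → trans (bools-count a≢0 {s} s+s f Y d b)
             (trans (cong (λ i → δ d b * 4 + i * _) (δ-≢ d≢0)) (+-identityʳ (δ d b * 4)))))
           (trans (∑-const (ofClass (norm b)) (δ d b * 4))
             (trans (cong (_* (δ d b * 4)) (length-ofNorm b∈)) (trans (*-comm K (δ d b * 4)) (*-assoc (δ d b) 4 K))))) ⟩
    ∑ (nonzero 6) (λ b → δ d b * (4 * K))
      ≡⟨ ∑-δ-unique d {nonzero 6} (λ _ → 4 * K) (Uniq.filter⁺ ≢0? (allV-unique 6)) (∈-nonzero d≢0) ⟩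
    4 * K ∎

  inside : ∀ f Y (g : V n → ℕ) → (∀ {a s} → a ≢ 0v → s + s ≡ q → q * δ Y a + s * (δ Y (γ • a) + δ Y (γ² • a)) ≡ g a) →
    ∑ triangles₂ (occurrences ((f ∷ Y) ++ 0v)) ≡ ∑ (nonzero 6) (λ b → ∑ (ofClass (norm b)) g)
  inside f Y g eq = trans (∑-triangles₂ (occurrences ((f ∷ Y) ++ 0v)))
    (∑-cong-∈ (nonzero 6) {g = λ b → ∑ (ofClass (norm b)) g} (λ {b} b∈ → ∑-family₂ b∈ {g = g} {h = occurrences ((f ∷ Y) ++ 0v)} (λ {a} {s} a≢0 s+s →
      trans (bools-count a≢0 {s} s+s f Y 0v b)
        (trans (cong (λ i → i * 4 + δ (0v {6}) 0v * _) (δ-≢ (∈-nonzero⁻ b∈ ∘ sym)))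
          (trans (+-identityʳ _) (eq {a} {s} a≢0 s+s))))))

  cover₂-a₀ : ∀ f → ∑ triangles₂ (occurrences ((f ∷ 0v {n}) ++ 0v {6})) ≡ 0
  cover₂-a₀ f = trans (inside f 0v (λ _ → 0) (λ {a} {s} → zeros {a} {s}))
    (trans (∑-cong (nonzero 6) {g = λ _ → 0} (λ b → ∑-0 (ofClass (norm b)))) (∑-0 (nonzero 6)))
    where
    zeros : ∀ {a s} → a ≢ 0v → s + s ≡ q → q * δ 0v a + s * (δ 0v (γ • a) + δ 0v (γ² • a)) ≡ 0
    zeros {a} {s} a≢0 _ = begin
      q * δ 0v a + s * (δ 0v (γ • a) + δ 0v (γ² • a))
        ≡⟨ cong₂ (λ i j → q * i + s * j) (δ-≢ (a≢0 ∘ sym))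
             (cong₂ _+_ (δ-≢ (•-nonzero {γ} (λ ()) a≢0 ∘ sym)) (δ-≢ (•-nonzero {γ²} (λ ()) a≢0 ∘ sym))) ⟩
      q * 0 + s * 0
        ≡⟨ cong₂ _+_ (*-zeroʳ q) (*-zeroʳ s) ⟩
      0 ∎

  cover₂-inside : ∀ f {Y} → Y ≢ 0v → ∑ triangles₂ (occurrences ((f ∷ Y) ++ 0v)) ≡ 42 * q
  cover₂-inside f {Y} Y≢0 = begin
    ∑ triangles₂ (occurrences ((f ∷ Y) ++ 0v))
      ≡⟨ inside f Y g (λ {a} {s′} a≢0 s′+s′ → cong₂ (λ i j → q * i + j * (δ Y (γ • a) + δ Y (γ² • a)))
           (cong (δ Y) (sym (one-T a))) (double-injective {s′} {s} (trans s′+s′ (sym s+s)))) ⟩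
    ∑ (nonzero 6) (λ b → ∑ (ofClass (norm b)) g)
      ≡⟨ ∑-cong (nonzero 6) (λ b → trans (∑-+ (ofClass (norm b)) (λ a → q * δ Y (one • a)) (λ a → s * (δ Y (γ • a) + δ Y (γ² • a))))
           (cong₂ _+_ (∑-*ˡ (ofClass (norm b)) q (λ a → δ Y (one • a)))
             (trans (∑-*ˡ (ofClass (norm b)) s (λ a → δ Y (γ • a) + δ Y (γ² • a)))
                    (cong (s *_) (∑-+ (ofClass (norm b)) (λ a → δ Y (γ • a)) (λ a → δ Y (γ² • a))))))) ⟩
    ∑ (nonzero 6) (λ b → q * h one b + s * (h γ b + h γ² b))
      ≡⟨ trans (∑-+ (nonzero 6) (λ b → q * h one b) (λ b → s * (h γ b + h γ² b)))
           (cong₂ _+_ (∑-*ˡ (nonzero 6) q (h one))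
             (trans (∑-*ˡ (nonzero 6) s (λ b → h γ b + h γ² b)) (cong (s *_) (∑-+ (nonzero 6) (h γ) (h γ²))))) ⟩
    q * ∑ (nonzero 6) (h one) + s * (∑ (nonzero 6) (h γ) + ∑ (nonzero 6) (h γ²))
      ≡⟨ cong₂ (λ i j → q * i + s * j) (∑-role {one} {Y} (λ ()) Y≢0) (cong₂ _+_ (∑-role {γ} {Y} (λ ()) Y≢0) (∑-role {γ²} {Y} (λ ()) Y≢0)) ⟩
    q * 21 + s * 42
      ≡⟨ cong (_+ s * 42) (cong (_* 21) (sym s+s)) ⟩
    (s + s) * 21 + s * 42
      ≡⟨ solve 1 (λ s → (s :+ s) :* con 21 :+ s :* con 42 := con 42 :* (s :+ s)) refl s ⟩
    42 * (s + s)
      ≡⟨ cong (42 *_) s+s ⟩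
    42 * q ∎
    where
    s = proj₁ (half-exists Y≢0)
    s+s = proj₂ (half-exists Y≢0)
    g : V n → ℕ
    g a = q * δ Y (one • a) + s * (δ Y (γ • a) + δ Y (γ² • a))
    h : V 6 → V 6 → ℕ
    h c b = ∑ (ofClass (norm b)) (λ a → δ Y (c • a))

  length-triangles₂ : length triangles₂ ≡ 63 * (K * (2 * q))
  length-triangles₂ = begin
    length triangles₂
      ≡⟨ trans (length-∑ triangles₂) (∑-triangles₂ (λ _ → 1)) ⟩
    ∑ (nonzero 6) (λ b → ∑ (ofClass (norm b)) (λ a → ∑ bools (λ e → ∑ (low a) (λ _ → 1))))
      ≡⟨ ∑-cong-∈ (nonzero 6) {g = λ _ → K * (2 * q)} (λ {b} b∈ → trans
           (∑-family₂ b∈ {g = λ _ → 2 * q} {h = λ _ → 1} (λ {a} {s} a≢0 _ → trans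
             (∑-cong bools (λ e → trans (sym (length-∑ (low a))) (Difference.length-low a≢0 e))) (∑-const bools q)))
           (trans (∑-const (ofClass (norm b)) (2 * q)) (cong (_* (2 * q)) (length-ofNorm b∈)))) ⟩
    ∑ (nonzero 6) (λ _ → K * (2 * q))
      ≡⟨ ∑-const (nonzero 6) (K * (2 * q)) ⟩
    63 * (K * (2 * q)) ∎

  -- The inverses of 1, γ, γ² have norms 1, `ω²`, `ω`, so one of them carries `w` to `z`.
  role : ∀ {w z} → CubeRoot w → CubeRoot z → norm (inv one) ⊙ w ≡ z ⊎ ∃ λ s → norm (inv (apexScalar s)) ⊙ w ≡ z
  role (inj₁ refl)        (inj₁ refl)        = inj₁ refl
  role (inj₁ refl)        (inj₂ (inj₁ refl)) = inj₂ (true , refl)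
  role (inj₁ refl)        (inj₂ (inj₂ refl)) = inj₂ (false , refl)
  role (inj₂ (inj₁ refl)) (inj₁ refl)        = inj₂ (false , refl)
  role (inj₂ (inj₁ refl)) (inj₂ (inj₁ refl)) = inj₁ refl
  role (inj₂ (inj₁ refl)) (inj₂ (inj₂ refl)) = inj₂ (true , refl)
  role (inj₂ (inj₂ refl)) (inj₁ refl)        = inj₂ (true , refl)
  role (inj₂ (inj₂ refl)) (inj₂ (inj₁ refl)) = inj₂ (false , refl)
  role (inj₂ (inj₂ refl)) (inj₂ (inj₂ refl)) = inj₁ refl

  Covered : V (suc n + 6) → V (suc n + 6) → Set
  Covered u v = ∃ λ ρ → ρ ∈ triangles₂ × OnSide u v ρ

  module _ {b : V 6} (b≢0 : b ≢ 0v) {a : V n} (a≢0 : a ≢ 0v) (eq : cls a ≡ norm b) (e : Bool) where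
    open Difference a≢0 e using (A; hbit-A; fbit-A)

    hbit-A-low : ∀ x → hbit a x ≢ false → hbit a (x ⊕ A) ≡ false
    hbit-A-low x ≢false = trans (hbit-A x) (cong (_xor true) (¬-not ≢false))

    covered-base : ∀ x → Covered (A ++ 0v) (x ++ b)
    covered-base x = go (low? a x)
      where
      difference : ∀ z → (z ++ b) ⊕ ((z ⊕ A) ++ b) ≡ A ++ 0v
      difference z = trans (++-⊕ z (z ⊕ A) b b) (cong₂ _++_ (⊕-solve (v₀ ⊞ (v₀ ⊞ v₁)) v₁ refl (z ∷ A ∷ [])) (⊕-self b))
      go : Dec (hbit a x ≡ false) → Covered (A ++ 0v) (x ++ b)
      go (yes low-x) = triangle₂ b a e x , ∈-triangles₂ b≢0 a≢0 eq low-x ,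
        subst (λ z → OnSide z (x ++ b) (triangle₂ b a e x)) (difference x) (onSide-swap (onSide-add side₁₂))
      -- A high end is listed under the opposite, low end, where it occurs as the third vertex.
      go (no high-x) = triangle₂ b a e (x ⊕ A) , ∈-triangles₂ b≢0 a≢0 eq (hbit-A-low x high-x) ,
        subst (λ z → OnSide (A ++ 0v) (z ++ b) (triangle₂ b a e (x ⊕ A))) (⊕-involutive A x)
          (subst (λ z → OnSide z (((x ⊕ A) ⊕ A) ++ b) (triangle₂ b a e (x ⊕ A)))
            (trans (⊕-comm (((x ⊕ A) ⊕ A) ++ b) ((x ⊕ A) ++ b)) (difference (x ⊕ A)))
            (onSide-swap (onSide-add (onSide-swap side₁₂))))

    covered-apex : ∀ s x → Covered ((e ∷ (apexScalar s • a)) ++ 0v) (x ++ b)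
    covered-apex s x = choose (fbit a x ≟ᵇ s)
      where
      P = e ∷ (apexScalar s • a)
      at : ∀ z → fbit a z ≡ s → Dec (hbit a z ≡ false) → Covered (P ++ 0v) (z ++ b)
      at z refl (yes low-z) = triangle₂ b a e z , ∈-triangles₂ b≢0 a≢0 eq low-z , side₀₁
      at z refl (no high-z) = triangle₂ b a e (z ⊕ A) , ∈-triangles₂ b≢0 a≢0 eq (hbit-A-low z high-z) ,
        subst (λ w → OnSide ((e ∷ (apexScalar w • a)) ++ 0v) (z ++ b) (triangle₂ b a e (z ⊕ A))) (fbit-A z)
          (subst (λ w → OnSide (apex a e (z ⊕ A) ++ 0v) (w ++ b) (triangle₂ b a e (z ⊕ A))) (⊕-involutive A z)
            (onSide-swap side₂₀))
      choose : Dec (fbit a x ≡ s) → Covered (P ++ 0v) (x ++ b)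
      choose (yes f≡s) = at x f≡s (low? a x)
      -- Here `x` is joined to the other apex, so the line is found in the triangle at its second
      -- point `x ⊕ P`.
      choose (no f≢s)  = shift (at (x ⊕ P) flipped (low? a (x ⊕ P)))
        where
        flipped : fbit a (x ⊕ P) ≡ s
        flipped = trans (Difference.fbit-π a≢0 e x s) (sym (¬-not (f≢s ∘ sym)))
        shift : Covered (P ++ 0v) ((x ⊕ P) ++ b) → Covered (P ++ 0v) (x ++ b)
        shift (ρ , ρ∈ , on) = ρ , ρ∈ , subst (λ z → OnSide (P ++ 0v) z ρ)
          (trans (++-⊕ P (x ⊕ P) 0v b) (cong₂ _++_ (⊕-solve (v₀ ⊞ (v₁ ⊞ v₀)) v₁ refl (P ∷ x ∷ [])) (⊕-identityˡ b)))
          (onSide-add on)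

  covered₂ : ∀ {b Y} → b ≢ 0v → Y ≢ 0v → ∀ e x → Covered ((e ∷ Y) ++ 0v) (x ++ b)
  covered₂ {b} {Y} b≢0 Y≢0 e x = go (role (cls-cubeRoot Y≢0) (norm-cubeRoot b b≢0))
    where
    go : norm (inv one) ⊙ cls Y ≡ norm b ⊎ (∃ λ s → norm (inv (apexScalar s)) ⊙ cls Y ≡ norm b) → Covered ((e ∷ Y) ++ 0v) (x ++ b)
    go (inj₁ eq)       = covered-base b≢0 Y≢0 (trans (sym (one-S (cls Y))) eq) e x
    go (inj₂ (s , eq)) = subst (λ z → Covered ((e ∷ z) ++ 0v) (x ++ b)) (•-inverseʳ c≢0 Y)
      (covered-apex b≢0 (•-nonzero (inv-nonzero c≢0) Y≢0) (trans (cls-• (inv-nonzero c≢0) Y) eq) e s x)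
      where c≢0 = apexScalar≢0 s

-- Lines of F₂⁶ and the triangles over them

_<ᵛ_ : ∀ {n} → V n → V n → Bool
[]          <ᵛ []          = false
(false ∷ x) <ᵛ (true ∷ y)  = true
(true ∷ x)  <ᵛ (false ∷ y) = false
(false ∷ x) <ᵛ (false ∷ y) = x <ᵛ y
(true ∷ x)  <ᵛ (true ∷ y)  = x <ᵛ y

-- Each line of F₂⁶ has a single increasing enumeration b₁ < b₂ < b₁ ⊕ b₂.
Increasing : V 6 × V 6 → Set
Increasing (b₁ , b₂) = Good (b₁ , b₂) × (b₁ <ᵛ b₂) ∧ (b₂ <ᵛ (b₁ ⊕ b₂)) ≡ true

increasing? : Decidable Increasing
increasing? (b₁ , b₂) = good? (b₁ , b₂) ×-dec ((b₁ <ᵛ b₂) ∧ (b₂ <ᵛ (b₁ ⊕ b₂))) ≟ᵇ true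

incidences : V 6 → V 6 × V 6 → ℕ
incidences b (b₁ , b₂) = δ b b₁ + (δ b b₂ + δ b (b₁ ⊕ b₂))

abstract

  -- There are 63 · 62 / 6 = 651 lines, 62 / 2 = 31 of them through each point. The block is
  -- abstract so that later proofs rest on these facts without unfolding the list.
  lines : List (V 6 × V 6)
  lines = filter increasing? (cartesianProduct (allV 6) (allV 6))

  ∈-lines : ∀ {ℓ} → Increasing ℓ → ℓ ∈ lines
  ∈-lines {b₁ , b₂} inc = ∈-filter⁺ increasing? (∈-cartesianProduct⁺ (∈-allV b₁) (∈-allV b₂)) inc

  ∈-lines⁻ : ∀ {b₁ b₂} → (b₁ , b₂) ∈ lines → Good (b₁ , b₂)
  ∈-lines⁻ ℓ∈ = proj₁ (proj₂ (∈-filter⁻ increasing? {xs = cartesianProduct (allV 6) (allV 6)} ℓ∈))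

  length-lines : length lines ≡ 651
  length-lines = refl

  lines-through : ∀ b → b ≢ 0v → ∑ lines (incidences b) ≡ 31
  lines-through = does-true (regular? lines) refl
    where
    regular? : ∀ ls → Dec (∀ b → b ≢ 0v → ∑ ls (incidences b) ≡ 31)
    regular? ls = ∀? 6 λ b → ≢0? b →-dec (∑ ls (incidences b) ≟ 31)

-- The alternatives are the six ordered pairs of points on the line; `covered₃` reads off which of
-- them to work with.
sorted : ∀ b b′ → Good (b , b′) →
  Increasing (b , b′) ⊎ Increasing (b′ , b) ⊎ Increasing (b , b ⊕ b′) ⊎ Increasing (b ⊕ b′ , b) ⊎
  Increasing (b′ , b ⊕ b′) ⊎ Increasing (b ⊕ b′ , b′)
sorted = does-true (∀? 6 λ b → ∀? 6 λ b′ → good? (b , b′) →-dec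
  (increasing? (b , b′) ⊎-dec (increasing? (b′ , b) ⊎-dec (increasing? (b , b ⊕ b′) ⊎-dec (increasing? (b ⊕ b′ , b) ⊎-dec
  (increasing? (b′ , b ⊕ b′) ⊎-dec increasing? (b ⊕ b′ , b′))))))) refl

-- For each ratio τ ∉ {0, 1} there are α and β of norms ω² and ω with 1 + α = τ (1 + β); the six candidates for β suffice.
βCandidates : List (V 6)
βCandidates = map (binary 6) (2 ∷ 6 ∷ 16 ∷ 44 ∷ 50 ∷ 55 ∷ [])

suits? : ∀ τ → Decidable (λ β → norm (one ⊕ (τ ⊙ (one ⊕ β))) ≡ ω²)
suits? τ β = norm (one ⊕ (τ ⊙ (one ⊕ β))) ≟V ω²

firstSuiting : V 6 → List (V 6) → V 6
firstSuiting τ []       = 0v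
firstSuiting τ (β ∷ βs) = if does (suits? τ β) then β else firstSuiting τ βs

βOf : V 6 → V 6
βOf τ = firstSuiting τ βCandidates

βOf-norm : ∀ τ → Good (one , τ) → norm (βOf τ) ≡ ω × norm (one ⊕ (τ ⊙ (one ⊕ βOf τ))) ≡ ω²
βOf-norm = does-true (∀? 6 λ τ → good? (one , τ) →-dec ((norm (βOf τ) ≟V ω) ×-dec suits? τ (βOf τ))) refl

module Class₃ (k : ℕ) where
  open Classes k

  ∑₃ : (Bool → Bool → V n → ℕ) → ℕ
  ∑₃ f = ∑ bools (λ e₁ → ∑ bools (λ e₂ → ∑ (allV n) (f e₁ e₂)))

  ∑₃-+ : ∀ f g → ∑₃ (λ e₁ e₂ x → f e₁ e₂ x + g e₁ e₂ x) ≡ ∑₃ f + ∑₃ g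
  ∑₃-+ f g = trans (∑-cong bools (λ e₁ → trans (∑-cong bools (λ e₂ → ∑-+ (allV n) (f e₁ e₂) (g e₁ e₂)))
               (∑-+ bools (λ e₂ → ∑ (allV n) (f e₁ e₂)) (λ e₂ → ∑ (allV n) (g e₁ e₂)))))
             (∑-+ bools (λ e₁ → ∑ bools (λ e₂ → ∑ (allV n) (f e₁ e₂))) (λ e₁ → ∑ bools (λ e₂ → ∑ (allV n) (g e₁ e₂))))

  ∑₃-cong : ∀ {f g} → (∀ e₁ e₂ x → f e₁ e₂ x ≡ g e₁ e₂ x) → ∑₃ f ≡ ∑₃ g
  ∑₃-cong eq = ∑-cong bools (λ e₁ → ∑-cong bools (λ e₂ → ∑-cong (allV n) (eq e₁ e₂)))

  module Line (b₁ b₂ : V 6) where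

    -- The third vertex is displaced by `coefficient • d` from the line of the first two. Then the
    -- sides have determinants `d`, `α • d` (second and third vertex) and `β • d` (first and third).
    -- Eliminating the coefficient gives 1 + α = (b₂/b₁)(1 + β), so it is determined by prescribing
    -- β.
    b₃ coefficient α β : V 6
    b₃ = b₁ ⊕ b₂
    coefficient = inv b₁ ⊙ (one ⊕ βOf (b₂ ⊙ inv b₁))
    α = one ⊕ (b₂ ⊙ coefficient)
    β = one ⊕ (b₁ ⊙ coefficient)

    -- The solution y of b₂x + b₁y = d: the second vertex is placed so that the first side has
    -- determinant `d`.
    Q : V n → V n → V n
    Q d x = inv b₁ • (d ⊕ b₂ • x)

    lift₁ lift₂ : V n → Bool → Bool → V n → V (suc n + 6)
    lift₁ d e₁ e₂ x = (e₁ ∷ x) ++ b₁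
    lift₂ d e₁ e₂ x = (e₂ ∷ Q d x) ++ b₂

    twist : V n → V (suc n + 6)
    twist d = (false ∷ (coefficient • d)) ++ 0v

    add-twist : ∀ d e x b → ((e ∷ x) ++ b) ⊕ twist d ≡ (e ∷ (x ⊕ coefficient • d)) ++ b
    add-twist d e x b = trans (++-⊕ (e ∷ x) (false ∷ (coefficient • d)) b 0v)
      (cong₂ _++_ (cong (_∷ (x ⊕ coefficient • d)) (xor-identityʳ e)) (⊕-identityʳ b))

    triangle₃ : V n → Bool → Bool → V n → Triple (suc n + 6)
    triangle₃ d e₁ e₂ x =
      lift₁ d e₁ e₂ x ∷ lift₂ d e₁ e₂ x ∷ (lift₁ d e₁ e₂ x ⊕ lift₂ d e₁ e₂ x ⊕ twist d) ∷ []

    module Nondegenerate (good : Good (b₁ , b₂)) where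

      b₁≢0 : b₁ ≢ 0v
      b₁≢0 = proj₁ good

      b₂≢0 : b₂ ≢ 0v
      b₂≢0 = proj₁ (proj₂ good)

      b₃≢0 : b₃ ≢ 0v
      b₃≢0 = proj₂ (proj₂ good) ∘ ⊕-≡0⇒≡

      τ : V 6
      τ = b₂ ⊙ inv b₁

      τ-good : Good (one , τ)
      τ-good = (λ ()) , ⊙-nonzero b₂≢0 (inv-nonzero b₁≢0) , λ eq → proj₂ (proj₂ good) (begin
        b₁                  ≡⟨ sym (S-one b₁) ⟩
        b₁ ⊙ one            ≡⟨ cong (b₁ ⊙_) eq ⟩
        b₁ ⊙ (b₂ ⊙ inv b₁)  ≡⟨ cong (b₁ ⊙_) (⊙-comm b₂ (inv b₁)) ⟩
        b₁ ⊙ (inv b₁ ⊙ b₂)  ≡⟨ ⊙-inverseʳ b₁≢0 b₂ ⟩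
        b₂ ∎)

      β≡ : β ≡ βOf τ
      β≡ = trans (cong (one ⊕_) (⊙-inverseʳ b₁≢0 (one ⊕ βOf τ))) (⊕-solve (v₀ ⊞ (v₀ ⊞ v₁)) v₁ refl (one ∷ βOf τ ∷ []))

      norm-β : norm β ≡ ω
      norm-β = trans (cong norm β≡) (proj₁ (βOf-norm τ τ-good))

      norm-α : norm α ≡ ω²
      norm-α = trans (cong (λ z → norm (one ⊕ z)) (sym (⊙-assoc b₂ (inv b₁) (one ⊕ βOf τ)))) (proj₂ (βOf-norm τ τ-good))

      nonzero-of-norm : ∀ {c} → norm c ≢ 0v → c ≢ 0v
      nonzero-of-norm N≢0 refl = N≢0 refl

      α≢0 : α ≢ 0v
      α≢0 = nonzero-of-norm (λ eq → case (trans (sym norm-α) eq))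
        where
        case : ω² ≡ 0v → ⊥
        case ()

      β≢0 : β ≢ 0v
      β≢0 = nonzero-of-norm (λ eq → case (trans (sym norm-β) eq))
        where
        case : ω ≡ 0v → ⊥
        case ()

      coefficient≢0 : coefficient ≢ 0v
      coefficient≢0 eq = case (trans (sym norm-β) (cong norm (trans (cong (λ z → one ⊕ (b₁ ⊙ z)) eq) (cong (one ⊕_) (⊙-zeroʳ b₁)))))
        where
        case : ω ≡ one → ⊥
        case ()

      triangle₃-indep : ∀ {d} → d ≢ 0v → ∀ e₁ e₂ x → Indep (triangle₃ d e₁ e₂ x)
      triangle₃-indep {d} d≢0 e₁ e₂ x = indep-triple
        (λ eq → b₁≢0 (proj₂ (++-≡0 (e₁ ∷ x) b₁ eq)))
        (λ eq → b₂≢0 (proj₂ (++-≡0 (e₂ ∷ Q d x) b₂ eq)))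
        (λ eq → b₃≢0 (trans (sym (⊕-identityʳ b₃)) (proj₂ (++-≡0 (p ⊕ r ⊕ t) (b₁ ⊕ b₂ ⊕ 0v) (trans (sym sum₃) eq)))))
        (λ eq → b₃≢0 (proj₂ (++-≡0 (p ⊕ r) (b₁ ⊕ b₂) (trans (sym (++-⊕ p r b₁ b₂)) eq))))
        (λ eq → b₂≢0 (trans (sym (⊕-identityʳ b₂)) (proj₂ (++-≡0 (r ⊕ t) (b₂ ⊕ 0v) (trans (sym (++-⊕ r t b₂ 0v)) (trans (sym (⊕-solve (v₀ ⊞ (v₀ ⊞ v₁ ⊞ v₂)) (v₁ ⊞ v₂) refl vs)) eq))))))
        (λ eq → b₁≢0 (trans (sym (⊕-identityʳ b₁)) (proj₂ (++-≡0 (p ⊕ t) (b₁ ⊕ 0v) (trans (sym (++-⊕ p t b₁ 0v)) (trans (sym (⊕-solve (v₁ ⊞ (v₀ ⊞ v₁ ⊞ v₂)) (v₀ ⊞ v₂) refl vs)) eq))))))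
        (λ eq → •-nonzero coefficient≢0 d≢0 (cong tail (proj₁ (++-≡0 t 0v (trans (sym (⊕-solve (v₀ ⊞ v₁ ⊞ (v₀ ⊞ v₁ ⊞ v₂)) v₂ refl vs)) eq)))))
        where
        p r t : V (suc n)
        p = e₁ ∷ x
        r = e₂ ∷ Q d x
        t = false ∷ (coefficient • d)
        vs = lift₁ d e₁ e₂ x ∷ lift₂ d e₁ e₂ x ∷ twist d ∷ []
        sum₃ : lift₁ d e₁ e₂ x ⊕ lift₂ d e₁ e₂ x ⊕ twist d ≡ (p ⊕ r ⊕ t) ++ (b₁ ⊕ b₂ ⊕ 0v)
        sum₃ = trans (cong (_⊕ twist d) (++-⊕ p r b₁ b₂)) (++-⊕ (p ⊕ r) t (b₁ ⊕ b₂) 0v)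

      -- Each of the six points of the triangle runs over its fibre exactly once as x varies.
      Sweeps : (V n → V n) → Set
      Sweeps g = ∀ Y → ∑ (allV n) (λ x → δ Y (g x)) ≡ 1

      sweeps-id : Sweeps id
      sweeps-id = ∑-δ₁

      sweeps-shift : ∀ {g} → Sweeps g → ∀ t → Sweeps (λ x → g x ⊕ t)
      sweeps-shift {g} sw t Y = trans (∑-cong (allV n) (λ x → δ-shift Y (g x) t)) (sw (Y ⊕ t))

      sweeps-scale : ∀ {g c} → c ≢ 0v → Sweeps g → Sweeps (λ x → c • g x)
      sweeps-scale {g} {c} c≢0 sw Y = trans (∑-cong (allV n) (λ x → 𝟙-cong (Y ≟V (c • g x)) ((inv c • Y) ≟V g x)
        (λ { refl → •-inverse c≢0 (g x) }) (λ eq → trans (sym (•-inverseʳ c≢0 Y)) (cong (c •_) eq)))) (sw (inv c • Y))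

      sweeps-ext : ∀ {g h} → (∀ x → g x ≡ h x) → Sweeps g → Sweeps h
      sweeps-ext eq sw Y = trans (∑-cong (allV n) (λ x → cong (δ Y) (sym (eq x)))) (sw Y)

      sweeps-Q : ∀ d → Sweeps (Q d)
      sweeps-Q d = sweeps-scale (inv-nonzero b₁≢0) (sweeps-ext (λ x → ⊕-comm (b₂ • x) d) (sweeps-shift (sweeps-scale b₂≢0 sweeps-id) d))

      sweeps-P⊕Q : ∀ d → Sweeps (λ x → x ⊕ Q d x)
      sweeps-P⊕Q d = sweeps-ext eq (sweeps-scale (inv-nonzero b₁≢0) (sweeps-ext (λ x → ⊕-comm (b₃ • x) d) (sweeps-shift (sweeps-scale b₃≢0 sweeps-id) d)))
        where
        eq : ∀ x → inv b₁ • (d ⊕ b₃ • x) ≡ x ⊕ Q d x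
        eq x = begin
          inv b₁ • (d ⊕ b₃ • x)                 ≡⟨ cong (λ z → inv b₁ • (d ⊕ z)) (•-distribʳ b₁ b₂ x) ⟩
          inv b₁ • (d ⊕ (b₁ • x ⊕ b₂ • x))      ≡⟨ cong (inv b₁ •_) (⊕-solve (v₀ ⊞ (v₁ ⊞ v₂)) (v₁ ⊞ (v₀ ⊞ v₂)) refl (d ∷ b₁ • x ∷ b₂ • x ∷ [])) ⟩
          inv b₁ • (b₁ • x ⊕ (d ⊕ b₂ • x))      ≡⟨ •-distribˡ (inv b₁) (b₁ • x) (d ⊕ b₂ • x) ⟩
          inv b₁ • (b₁ • x) ⊕ Q d x             ≡⟨ cong (_⊕ Q d x) (•-inverse b₁≢0 x) ⟩
          x ⊕ Q d x ∎

      -- The 4q choices of `e₁`, `e₂`, `x` are spread evenly over the 2q points above `b`.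
      fibre-count : ∀ (ε : Bool → Bool → Bool) {g : V n → V n} → (∀ f → ∑ bools (λ e₁ → ∑ bools (λ e₂ → δᵇ f (ε e₁ e₂))) ≡ 2) → Sweeps g →
        ∀ f Y (d b : V 6) → ∑ bools (λ e₁ → ∑ bools (λ e₂ → ∑ (allV n) (λ x → δ ((f ∷ Y) ++ d) ((ε e₁ e₂ ∷ g x) ++ b)))) ≡ 2 * δ d b
      fibre-count ε {g} two sw f Y d b = begin
        ∑ bools (λ e₁ → ∑ bools (λ e₂ → ∑ (allV n) (λ x → δ ((f ∷ Y) ++ d) ((ε e₁ e₂ ∷ g x) ++ b))))
          ≡⟨ ∑-cong bools (λ e₁ → ∑-cong bools (λ e₂ → inner (ε e₁ e₂))) ⟩
        ∑ bools (λ e₁ → ∑ bools (λ e₂ → δᵇ f (ε e₁ e₂) * δ d b))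
          ≡⟨ trans (∑-cong bools (λ e₁ → ∑-*ʳ bools (δ d b) (λ e₂ → δᵇ f (ε e₁ e₂)))) (∑-*ʳ bools (δ d b) (λ e₁ → ∑ bools (λ e₂ → δᵇ f (ε e₁ e₂)))) ⟩
        ∑ bools (λ e₁ → ∑ bools (λ e₂ → δᵇ f (ε e₁ e₂))) * δ d b
          ≡⟨ cong (_* δ d b) (two f) ⟩
        2 * δ d b ∎
        where
        inner : ∀ e → ∑ (allV n) (λ x → δ ((f ∷ Y) ++ d) ((e ∷ g x) ++ b)) ≡ δᵇ f e * δ d b
        inner e = begin
          ∑ (allV n) (λ x → δ ((f ∷ Y) ++ d) ((e ∷ g x) ++ b))
            ≡⟨ ∑-cong (allV n) (λ x → trans (δ-++ (f ∷ Y) (e ∷ g x) d b) (cong (δ d b *_) (δ-∷ f e Y (g x)))) ⟩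
          ∑ (allV n) (λ x → δ d b * (δᵇ f e * δ Y (g x)))
            ≡⟨ trans (∑-*ˡ (allV n) (δ d b) (λ x → δᵇ f e * δ Y (g x))) (cong (δ d b *_) (∑-*ˡ (allV n) (δᵇ f e) (λ x → δ Y (g x)))) ⟩
          δ d b * (δᵇ f e * ∑ (allV n) (λ x → δ Y (g x)))
            ≡⟨ cong (λ s → δ d b * (δᵇ f e * s)) (sw Y) ⟩
          δ d b * (δᵇ f e * 1)
            ≡⟨ trans (cong (δ d b *_) (*-identityʳ (δᵇ f e))) (*-comm (δ d b) (δᵇ f e)) ⟩
          δᵇ f e * δ d b ∎

      -- Above each of b₁, b₂, b₃ lie two of the six covered points: a vertex and the third point of
      -- the opposite side, which differ by `twist d`. Each of them meets every point of its fibre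
      -- twice.
      cover-line : ∀ d f Y c → ∑₃ (λ e₁ e₂ x → occurrences ((f ∷ Y) ++ c) (triangle₃ d e₁ e₂ x)) ≡ 4 * incidences c (b₁ , b₂)
      cover-line d f Y c = begin
        ∑₃ (λ e₁ e₂ x → occurrences y (triangle₃ d e₁ e₂ x))
          ≡⟨ ∑₃-cong (λ e₁ e₂ x → trans (occurrences-expand y (lift₁ d e₁ e₂ x) (lift₂ d e₁ e₂ x) (lift₁ d e₁ e₂ x ⊕ lift₂ d e₁ e₂ x ⊕ twist d)) (points e₁ e₂ x)) ⟩
        ∑₃ (λ e₁ e₂ x → h₁ e₁ e₂ x + (h₂ e₁ e₂ x + (h₃ e₁ e₂ x + (h₄ e₁ e₂ x + (h₅ e₁ e₂ x + h₆ e₁ e₂ x)))))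
          ≡⟨ trans (∑₃-+ h₁ (λ e₁ e₂ x → h₂ e₁ e₂ x + (h₃ e₁ e₂ x + (h₄ e₁ e₂ x + (h₅ e₁ e₂ x + h₆ e₁ e₂ x))))) (cong (∑₃ h₁ +_)
             (trans (∑₃-+ h₂ (λ e₁ e₂ x → h₃ e₁ e₂ x + (h₄ e₁ e₂ x + (h₅ e₁ e₂ x + h₆ e₁ e₂ x)))) (cong (∑₃ h₂ +_)
             (trans (∑₃-+ h₃ (λ e₁ e₂ x → h₄ e₁ e₂ x + (h₅ e₁ e₂ x + h₆ e₁ e₂ x))) (cong (∑₃ h₃ +_)
             (trans (∑₃-+ h₄ (λ e₁ e₂ x → h₅ e₁ e₂ x + h₆ e₁ e₂ x)) (cong (∑₃ h₄ +_) (∑₃-+ h₅ h₆)))))))) ⟩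
        ∑₃ h₁ + (∑₃ h₂ + (∑₃ h₃ + (∑₃ h₄ + (∑₃ h₅ + ∑₃ h₆))))
          ≡⟨ cong₂ _+_ (fibre-count (λ e₁ e₂ → e₁ xor e₂) xor-two (sweeps-shift (sweeps-P⊕Q d) (coefficient • d)) f Y c b₃)
            (cong₂ _+_ (fibre-count (λ e₁ e₂ → e₂) snd-two (sweeps-Q d) f Y c b₂)
            (cong₂ _+_ (fibre-count (λ e₁ e₂ → e₁) fst-two (sweeps-shift sweeps-id (coefficient • d)) f Y c b₁)
            (cong₂ _+_ (fibre-count (λ e₁ e₂ → e₁) fst-two sweeps-id f Y c b₁)
            (cong₂ _+_ (fibre-count (λ e₁ e₂ → e₂) snd-two (sweeps-shift (sweeps-Q d) (coefficient • d)) f Y c b₂)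
                       (fibre-count (λ e₁ e₂ → e₁ xor e₂) xor-two (sweeps-P⊕Q d) f Y c b₃))))) ⟩
        2 * δ c b₃ + (2 * δ c b₂ + (2 * δ c b₁ + (2 * δ c b₁ + (2 * δ c b₂ + 2 * δ c b₃))))
          ≡⟨ solve 3 (λ x y z → con 2 :* z :+ (con 2 :* y :+ (con 2 :* x :+ (con 2 :* x :+ (con 2 :* y :+ con 2 :* z)))) := con 4 :* (x :+ (y :+ z))) refl
               (δ c b₁) (δ c b₂) (δ c b₃) ⟩
        4 * (δ c b₁ + (δ c b₂ + δ c b₃)) ∎
        where
        y = (f ∷ Y) ++ c
        t = coefficient • d
        h₁ h₂ h₃ h₄ h₅ h₆ : Bool → Bool → V n → ℕ
        h₁ e₁ e₂ x = δ y (((e₁ xor e₂) ∷ ((x ⊕ Q d x) ⊕ t)) ++ b₃)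
        h₂ e₁ e₂ x = δ y ((e₂ ∷ Q d x) ++ b₂)
        h₃ e₁ e₂ x = δ y ((e₁ ∷ (x ⊕ t)) ++ b₁)
        h₄ e₁ e₂ x = δ y ((e₁ ∷ x) ++ b₁)
        h₅ e₁ e₂ x = δ y ((e₂ ∷ (Q d x ⊕ t)) ++ b₂)
        h₆ e₁ e₂ x = δ y (((e₁ xor e₂) ∷ (x ⊕ Q d x)) ++ b₃)
        xor-two : ∀ f → ∑ bools (λ e₁ → ∑ bools (λ e₂ → δᵇ f (e₁ xor e₂))) ≡ 2
        xor-two false = refl
        xor-two true  = refl
        fst-two : ∀ f → ∑ bools (λ e₁ → ∑ bools (λ e₂ → δᵇ f e₁)) ≡ 2
        fst-two false = refl
        fst-two true  = refl
        snd-two : ∀ f → ∑ bools (λ e₁ → ∑ bools (λ e₂ → δᵇ f e₂)) ≡ 2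
        snd-two false = refl
        snd-two true  = refl
        points : ∀ e₁ e₂ x → _ ≡ _
        points e₁ e₂ x = cong₂ _+_ (cong (δ y) (trans (cong (_⊕ twist d) p⊕r) (add-twist d (e₁ xor e₂) (x ⊕ Q d x) b₃)))
          (cong (h₂ e₁ e₂ x +_)
          (cong₂ _+_ (cong (δ y) (trans (⊕-solve (v₁ ⊞ (v₀ ⊞ v₁ ⊞ v₂)) (v₀ ⊞ v₂) refl vs) (add-twist d e₁ x b₁)))
          (cong (h₄ e₁ e₂ x +_)
          (cong₂ _+_ (cong (δ y) (trans (⊕-solve (v₀ ⊞ (v₀ ⊞ v₁ ⊞ v₂)) (v₁ ⊞ v₂) refl vs) (add-twist d e₂ (Q d x) b₂)))
          (trans (+-identityʳ _) (cong (δ y) p⊕r))))))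
          where
          vs = lift₁ d e₁ e₂ x ∷ lift₂ d e₁ e₂ x ∷ twist d ∷ []
          p⊕r : lift₁ d e₁ e₂ x ⊕ lift₂ d e₁ e₂ x ≡ ((e₁ xor e₂) ∷ (x ⊕ Q d x)) ++ b₃
          p⊕r = ++-⊕ (e₁ ∷ x) (e₂ ∷ Q d x) b₁ b₂

CoveredBy : ∀ {n} → List (Triple n) → V n → V n → Set
CoveredBy L u v = ∃ λ ρ → ρ ∈ L × OnSide u v ρ

coveredBy-swap : ∀ {n} {L : List (Triple n)} {u v} → CoveredBy L u v → CoveredBy L v u
coveredBy-swap (ρ , ρ∈ , on) = ρ , ρ∈ , onSide-swap on

coveredBy-add : ∀ {n} {L : List (Triple n)} {u v w} → u ⊕ v ≡ w → CoveredBy L u v → CoveredBy L u w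
coveredBy-add refl (ρ , ρ∈ , on) = ρ , ρ∈ , onSide-add on

module Family₃ (k : ℕ) where
  open Classes k
  open Class₃ k

  family₃-ee : V 6 × V 6 → V n → Bool → Bool → List (Triple (suc n + 6))
  family₃-ee (b₁ , b₂) d e₁ e₂ = map (Line.triangle₃ b₁ b₂ d e₁ e₂) (allV n)

  family₃-e : V 6 × V 6 → V n → Bool → List (Triple (suc n + 6))
  family₃-e ℓ d e₁ = concatMap (family₃-ee ℓ d e₁) bools

  family₃-d : V 6 × V 6 → V n → List (Triple (suc n + 6))
  family₃-d ℓ d = concatMap (family₃-e ℓ d) bools

  family₃ : V 6 × V 6 → List (Triple (suc n + 6))
  family₃ ℓ = concatMap (family₃-d ℓ) (ofClass one)

  triangles₃ : List (Triple (suc n + 6))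
  triangles₃ = concatMap family₃ lines

  ∑-family₃ : ∀ ℓ f → ∑ (family₃ ℓ) f ≡ ∑ (ofClass one) (λ d → ∑₃ (λ e₁ e₂ x → f (Line.triangle₃ (proj₁ ℓ) (proj₂ ℓ) d e₁ e₂ x)))
  ∑-family₃ ℓ@(b₁ , b₂) f =
    trans (∑-concatMap (family₃-d ℓ) (ofClass one) f) (∑-cong (ofClass one) (λ d →
    trans (∑-concatMap (family₃-e ℓ d) bools f) (∑-cong bools (λ e₁ →
    trans (∑-concatMap (family₃-ee ℓ d e₁) bools f) (∑-cong bools (λ e₂ →
    ∑-map (Line.triangle₃ b₁ b₂ d e₁ e₂) (allV n) f))))))

  ∈-triangles₃ : ∀ {b₁ b₂ d} → (b₁ , b₂) ∈ lines → d ≢ 0v → cls d ≡ one → ∀ e₁ e₂ x → Line.triangle₃ b₁ b₂ d e₁ e₂ x ∈ triangles₃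
  ∈-triangles₃ {b₁} {b₂} {d} ℓ∈ d≢0 eq e₁ e₂ x =
    ∈-concatMap family₃ ℓ∈ (∈-concatMap (family₃-d (b₁ , b₂)) (∈-ofClass d≢0 eq) (∈-concatMap (family₃-e (b₁ , b₂) d) (∈-bools e₁)
    (∈-concatMap (family₃-ee (b₁ , b₂) d e₁) (∈-bools e₂) (∈-map⁺ (Line.triangle₃ b₁ b₂ d e₁ e₂) (∈-allV x)))))

  indep₃ : ∀ {ρ} → ρ ∈ triangles₃ → Indep ρ
  indep₃ = concatMap-all {P = Indep} family₃ lines λ { {ℓ@(b₁ , b₂)} ℓ∈ →
    concatMap-all {P = Indep} (family₃-d ℓ) (ofClass one) λ {d} d∈ →
    concatMap-all {P = Indep} (family₃-e ℓ d) bools λ {e₁} _ →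
    concatMap-all {P = Indep} (family₃-ee ℓ d e₁) bools λ {e₂} _ →
    map-all {P = Indep} (Line.triangle₃ b₁ b₂ d e₁ e₂) (allV n) λ {x} _ →
    Line.Nondegenerate.triangle₃-indep b₁ b₂ (∈-lines⁻ ℓ∈) (proj₁ (∈-ofClass⁻ d∈)) e₁ e₂ x }

  cover-family₃ : ∀ f Y c {ℓ} → ℓ ∈ lines → ∑ (family₃ ℓ) (occurrences ((f ∷ Y) ++ c)) ≡ incidences c ℓ * (4 * K)
  cover-family₃ f Y c {ℓ@(b₁ , b₂)} ℓ∈ = begin
    ∑ (family₃ ℓ) (occurrences ((f ∷ Y) ++ c))
      ≡⟨ ∑-family₃ ℓ (occurrences ((f ∷ Y) ++ c)) ⟩
    ∑ (ofClass one) (λ d → ∑₃ (λ e₁ e₂ x → occurrences ((f ∷ Y) ++ c) (Line.triangle₃ b₁ b₂ d e₁ e₂ x)))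
      ≡⟨ ∑-cong (ofClass one) (λ d → Line.Nondegenerate.cover-line b₁ b₂ (∈-lines⁻ ℓ∈) d f Y c) ⟩
    ∑ (ofClass one) (λ _ → 4 * incidences c ℓ)
      ≡⟨ ∑-const (ofClass one) (4 * incidences c ℓ) ⟩
    K * (4 * incidences c ℓ)
      ≡⟨ solve 2 (λ x i → x :* (con 4 :* i) := i :* (con 4 :* x)) refl K (incidences c ℓ) ⟩
    incidences c ℓ * (4 * K) ∎

  cover₃ : ∀ f Y c → ∑ triangles₃ (occurrences ((f ∷ Y) ++ c)) ≡ ∑ lines (incidences c) * (4 * K)
  cover₃ f Y c = begin
    ∑ triangles₃ (occurrences ((f ∷ Y) ++ c))
      ≡⟨ ∑-concatMap family₃ lines (occurrences ((f ∷ Y) ++ c)) ⟩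
    ∑ lines (λ ℓ → ∑ (family₃ ℓ) (occurrences ((f ∷ Y) ++ c)))
      ≡⟨ ∑-cong-∈ lines {g = λ ℓ → incidences c ℓ * (4 * K)} (λ {ℓ} → cover-family₃ f Y c {ℓ}) ⟩
    ∑ lines (λ ℓ → incidences c ℓ * (4 * K))
      ≡⟨ ∑-*ʳ lines (4 * K) (incidences c) ⟩
    ∑ lines (incidences c) * (4 * K) ∎

  cover₃-outside : ∀ f Y {c} → c ≢ 0v → ∑ triangles₃ (occurrences ((f ∷ Y) ++ c)) ≡ 31 * (4 * K)
  cover₃-outside f Y {c} c≢0 = trans (cover₃ f Y c) (cong (_* (4 * K)) (lines-through c c≢0))

  no-incidence : ∀ {ℓ} → ℓ ∈ lines → incidences 0v ℓ ≡ 0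
  no-incidence {b₁ , b₂} ℓ∈ = cong₂ _+_ (δ-≢ (b₁≢0 ∘ sym)) (cong₂ _+_ (δ-≢ (b₂≢0 ∘ sym)) (δ-≢ (b₃≢0 ∘ sym)))
    where open Line.Nondegenerate b₁ b₂ (∈-lines⁻ ℓ∈)

  cover₃-inside : ∀ f Y → ∑ triangles₃ (occurrences ((f ∷ Y) ++ 0v)) ≡ 0
  cover₃-inside f Y = trans (cover₃ f Y 0v)
    (cong (_* (4 * K)) (trans (∑-cong-∈ lines {f = incidences 0v} {g = λ _ → 0} no-incidence) (∑-0 lines)))

  -- Of the 4q² lines over ℓ exactly 4q have determinant 0. The other 4q(q - 1) = 3 · 4qK are to be
  -- the sides of these triangles.
  length-family₃ : ∀ ℓ → length (family₃ ℓ) ≡ K * (4 * q)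
  length-family₃ ℓ = begin
    length (family₃ ℓ)
      ≡⟨ trans (length-∑ (family₃ ℓ)) (∑-family₃ ℓ (λ _ → 1)) ⟩
    ∑ (ofClass one) (λ _ → ∑₃ (λ _ _ _ → 1))
      ≡⟨ ∑-const (ofClass one) (∑₃ (λ _ _ _ → 1)) ⟩
    K * ∑₃ (λ _ _ _ → 1)
      ≡⟨ cong (K *_) (trans (∑-cong bools (λ _ → trans (∑-cong bools (λ _ → ∑-1 n)) (∑-const bools q))) (∑-const bools (2 * q))) ⟩
    K * (2 * (2 * q))
      ≡⟨ cong (K *_) (sym (*-assoc 2 2 q)) ⟩
    K * (4 * q) ∎

  length-triangles₃ : length triangles₃ ≡ 651 * (K * (4 * q))
  length-triangles₃ = begin
    length triangles₃                      ≡⟨ length-concatMap family₃ lines ⟩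
    ∑ lines (λ ℓ → length (family₃ ℓ))     ≡⟨ ∑-cong lines length-family₃ ⟩
    ∑ lines (λ _ → K * (4 * q))            ≡⟨ ∑-const lines (K * (4 * q)) ⟩
    length lines * (K * (4 * q))           ≡⟨ cong (_* (K * (4 * q))) length-lines ⟩
    651 * (K * (4 * q)) ∎

  -- The value is the same for any two of the three points on a line, which makes it an invariant of
  -- the line.
  det : V n → V 6 → V n → V 6 → V n
  det X b Y c = c • X ⊕ b • Y

  norm-inverse : ∀ {c} → c ≢ 0v → norm (inv c) ⊙ norm c ≡ one
  norm-inverse {c} c≢0 = trans (sym (norm-⊙ (inv c) c)) (cong norm (inv-one c c≢0))

  module _ {b₁ b₂ : V 6} (ℓ∈ : (b₁ , b₂) ∈ lines) (e₁ e₂ : Bool) (X₁ X₂ : V n) (det≢0 : det X₁ b₁ X₂ b₂ ≢ 0v) where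
    open Line b₁ b₂
    open Nondegenerate (∈-lines⁻ ℓ∈)

    D U₁ U₂ : _
    D  = det X₁ b₁ X₂ b₂
    U₁ = (e₁ ∷ X₁) ++ b₁
    U₂ = (e₂ ∷ X₂) ++ b₂

    Q-unique : ∀ {d x z} → d ⊕ b₂ • x ≡ b₁ • z → Q d x ≡ z
    Q-unique {z = z} eq = trans (cong (inv b₁ •_) eq) (•-inverse b₁≢0 z)

    class-one : cls D ≡ one → CoveredBy triangles₃ U₁ U₂
    class-one eq = triangle₃ D e₁ e₂ X₁ , ∈-triangles₃ ℓ∈ det≢0 eq e₁ e₂ X₁ ,
      subst (λ z → OnSide U₁ ((e₂ ∷ z) ++ b₂) (triangle₃ D e₁ e₂ X₁)) QX side₀₁
      where
      QX : Q D X₁ ≡ X₂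
      QX = Q-unique (⊕-solve ((v₀ ⊞ v₁) ⊞ v₀) v₁ refl (b₂ • X₁ ∷ b₁ • X₂ ∷ []))

    scaled-class : ∀ {c} → c ≢ 0v → cls D ≡ norm c → cls (inv c • D) ≡ one
    scaled-class {c} c≢0 eq = trans (cls-• (inv-nonzero c≢0) D) (trans (cong (norm (inv c) ⊙_) eq) (norm-inverse c≢0))

    -- The line becomes the side opposite to the first vertex: `U₂` and `U₁ ⊕ U₂` are the other two
    -- vertices. Then the first vertex is `U₁` shifted by `twist d`, whence the choice of `x`, and
    -- the determinant `α • d` must be `D`.
    class-α : cls D ≡ norm α → CoveredBy triangles₃ U₁ U₂
    class-α eq = coveredBy-swap (coveredBy-add (⊕-solve (v₁ ⊞ (v₀ ⊞ v₁)) v₀ refl (U₁ ∷ U₂ ∷ []))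
      (triangle₃ d e₁ e₂ x , ∈-triangles₃ ℓ∈ (•-nonzero (inv-nonzero α≢0) det≢0) (scaled-class α≢0 eq) e₁ e₂ x ,
       subst (λ z → OnSide z (U₁ ⊕ U₂) (triangle₃ d e₁ e₂ x)) lift₂≡
         (subst (λ z → OnSide (lift₂ d e₁ e₂ x) z (triangle₃ d e₁ e₂ x)) R≡ side₁₂)))
      where
      d x : V n
      d = inv α • D
      x = X₁ ⊕ coefficient • d
      b₂c : b₂ • (coefficient • d) ≡ d ⊕ D
      b₂c = begin
        b₂ • (coefficient • d)      ≡⟨ sym (•-assoc b₂ coefficient d) ⟩
        (b₂ ⊙ coefficient) • d      ≡⟨ cong (_• d) (⊕-solve v₁ (v₀ ⊞ (v₀ ⊞ v₁)) refl (one ∷ b₂ ⊙ coefficient ∷ [])) ⟩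
        (one ⊕ α) • d               ≡⟨ •-distribʳ one α d ⟩
        one • d ⊕ α • d             ≡⟨ cong₂ _⊕_ (one-T d) (•-inverseʳ α≢0 D) ⟩
        d ⊕ D ∎
      QX : Q d x ≡ X₂
      QX = Q-unique (begin
        d ⊕ b₂ • (X₁ ⊕ coefficient • d)          ≡⟨ cong (d ⊕_) (trans (•-distribˡ b₂ X₁ (coefficient • d)) (cong (b₂ • X₁ ⊕_) b₂c)) ⟩
        d ⊕ (b₂ • X₁ ⊕ (d ⊕ (b₂ • X₁ ⊕ b₁ • X₂)))  ≡⟨ ⊕-solve (v₀ ⊞ (v₁ ⊞ (v₀ ⊞ (v₁ ⊞ v₂)))) v₂ refl (d ∷ b₂ • X₁ ∷ b₁ • X₂ ∷ []) ⟩
        b₁ • X₂ ∎)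
      lift₂≡ : lift₂ d e₁ e₂ x ≡ U₂
      lift₂≡ = cong (λ z → (e₂ ∷ z) ++ b₂) QX
      R≡ : lift₁ d e₁ e₂ x ⊕ lift₂ d e₁ e₂ x ⊕ twist d ≡ U₁ ⊕ U₂
      R≡ = trans (cong₂ (λ y z → y ⊕ z ⊕ twist d) (sym (add-twist d e₁ X₁ b₁)) lift₂≡)
        (⊕-solve (v₀ ⊞ v₂ ⊞ v₁ ⊞ v₂) (v₀ ⊞ v₁) refl (U₁ ∷ U₂ ∷ twist d ∷ []))

    -- Now `U₁` and `U₁ ⊕ U₂` are the first and third vertices, so the second one is `U₂` shifted by
    -- `twist d`, and `β • d` must be `D`.
    class-β : cls D ≡ norm β → CoveredBy triangles₃ U₁ U₂
    class-β eq = coveredBy-add (⊕-solve (v₀ ⊞ (v₀ ⊞ v₁)) v₁ refl (U₁ ∷ U₂ ∷ []))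
      (triangle₃ d e₁ e₂ X₁ , ∈-triangles₃ ℓ∈ (•-nonzero (inv-nonzero β≢0) det≢0) (scaled-class β≢0 eq) e₁ e₂ X₁ ,
       subst (λ z → OnSide U₁ z (triangle₃ d e₁ e₂ X₁)) R≡ (onSide-swap side₂₀))
      where
      d : V n
      d = inv β • D
      b₁c : b₁ • (coefficient • d) ≡ d ⊕ D
      b₁c = begin
        b₁ • (coefficient • d)      ≡⟨ sym (•-assoc b₁ coefficient d) ⟩
        (b₁ ⊙ coefficient) • d      ≡⟨ cong (_• d) (⊕-solve v₁ (v₀ ⊞ (v₀ ⊞ v₁)) refl (one ∷ b₁ ⊙ coefficient ∷ [])) ⟩
        (one ⊕ β) • d               ≡⟨ •-distribʳ one β d ⟩
        one • d ⊕ β • d             ≡⟨ cong₂ _⊕_ (one-T d) (•-inverseʳ β≢0 D) ⟩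
        d ⊕ D ∎
      QX : Q d X₁ ≡ X₂ ⊕ coefficient • d
      QX = Q-unique (sym (begin
        b₁ • (X₂ ⊕ coefficient • d)               ≡⟨ trans (•-distribˡ b₁ X₂ (coefficient • d)) (cong (b₁ • X₂ ⊕_) b₁c) ⟩
        b₁ • X₂ ⊕ (d ⊕ (b₂ • X₁ ⊕ b₁ • X₂))       ≡⟨ ⊕-solve (v₂ ⊞ (v₀ ⊞ (v₁ ⊞ v₂))) (v₀ ⊞ v₁) refl (d ∷ b₂ • X₁ ∷ b₁ • X₂ ∷ []) ⟩
        d ⊕ b₂ • X₁ ∎))
      R≡ : lift₁ d e₁ e₂ X₁ ⊕ lift₂ d e₁ e₂ X₁ ⊕ twist d ≡ U₁ ⊕ U₂
      R≡ = trans (cong (λ z → U₁ ⊕ z ⊕ twist d) (trans (cong (λ z → (e₂ ∷ z) ++ b₂) QX) (sym (add-twist d e₂ X₂ b₂))))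
        (⊕-solve (v₀ ⊞ (v₁ ⊞ v₂) ⊞ v₂) (v₀ ⊞ v₁) refl (U₁ ∷ U₂ ∷ twist d ∷ []))

    covered-line : CoveredBy triangles₃ U₁ U₂
    covered-line = go (cls-cubeRoot det≢0)
      where
      go : CubeRoot (cls D) → CoveredBy triangles₃ U₁ U₂
      go (inj₁ eq)        = class-one eq
      go (inj₂ (inj₁ eq)) = class-β (trans eq (sym norm-β))
      go (inj₂ (inj₂ eq)) = class-α (trans eq (sym norm-α))

  -- Only the increasing enumeration of a line occurs in `lines`. Since the determinant does not
  -- depend on the chosen points, the pair is exchanged for the increasing one and recovered by
  -- `coveredBy-swap` and `coveredBy-add`.
  covered₃ : ∀ {b c} → Good (b , c) → ∀ e f X Y → det X b Y c ≢ 0v → CoveredBy triangles₃ ((e ∷ X) ++ b) ((f ∷ Y) ++ c)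
  covered₃ {b} {c} good e f X Y D≢0 = go (sorted b c good)
    where
    u = (e ∷ X) ++ b
    v = (f ∷ Y) ++ c
    w = ((e xor f) ∷ (X ⊕ Y)) ++ (b ⊕ c)
    w≡ : u ⊕ v ≡ w
    w≡ = ++-⊕ (e ∷ X) (f ∷ Y) b c
    from : ∀ {D′} → det X b Y c ≡ D′ → D′ ≢ 0v
    from refl = D≢0
    det-vu : det X b Y c ≡ det Y c X b
    det-vu = ⊕-comm (c • X) (b • Y)
    det-uw : det X b Y c ≡ det X b (X ⊕ Y) (b ⊕ c)
    det-uw = sym (trans (cong₂ _⊕_ (•-distribʳ b c X) (•-distribˡ b X Y))
      (⊕-solve ((v₀ ⊞ v₁) ⊞ (v₀ ⊞ v₂)) (v₁ ⊞ v₂) refl (b • X ∷ c • X ∷ b • Y ∷ [])))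
    det-vw : det X b Y c ≡ det Y c (X ⊕ Y) (b ⊕ c)
    det-vw = sym (trans (cong₂ _⊕_ (•-distribʳ b c Y) (•-distribˡ c X Y))
      (⊕-solve ((v₀ ⊞ v₁) ⊞ (v₂ ⊞ v₁)) (v₂ ⊞ v₀) refl (b • Y ∷ c • Y ∷ c • X ∷ [])))
    det-wu : det X b Y c ≡ det (X ⊕ Y) (b ⊕ c) X b
    det-wu = trans det-uw (⊕-comm ((b ⊕ c) • X) (b • (X ⊕ Y)))
    det-wv : det X b Y c ≡ det (X ⊕ Y) (b ⊕ c) Y c
    det-wv = trans det-vw (⊕-comm ((b ⊕ c) • Y) (c • (X ⊕ Y)))
    u⊕w : u ⊕ w ≡ v
    u⊕w = trans (cong (u ⊕_) (sym w≡)) (⊕-solve (v₀ ⊞ (v₀ ⊞ v₁)) v₁ refl (u ∷ v ∷ []))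
    v⊕w : v ⊕ w ≡ u
    v⊕w = trans (cong (v ⊕_) (sym w≡)) (⊕-solve (v₁ ⊞ (v₀ ⊞ v₁)) v₀ refl (u ∷ v ∷ []))
    go : _ → CoveredBy triangles₃ u v
    go (inj₁ i) = covered-line (∈-lines i) e f X Y D≢0
    go (inj₂ (inj₁ i)) = coveredBy-swap (covered-line (∈-lines i) f e Y X (from det-vu))
    go (inj₂ (inj₂ (inj₁ i))) = coveredBy-add u⊕w (covered-line (∈-lines i) e (e xor f) X (X ⊕ Y) (from det-uw))
    go (inj₂ (inj₂ (inj₂ (inj₁ i)))) = coveredBy-add u⊕w (coveredBy-swap (covered-line (∈-lines i) (e xor f) e (X ⊕ Y) X (from det-wu)))
    go (inj₂ (inj₂ (inj₂ (inj₂ (inj₁ i))))) = coveredBy-swap (coveredBy-add v⊕w (covered-line (∈-lines i) f (e xor f) Y (X ⊕ Y) (from det-vw)))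
    go (inj₂ (inj₂ (inj₂ (inj₂ (inj₂ i))))) = coveredBy-swap (coveredBy-add v⊕w (coveredBy-swap (covered-line (∈-lines i) (e xor f) f (X ⊕ Y) Y (from det-wv))))

-- Assembly of the extended design

module Extension (k : ℕ) {triangles₇ : List (Triple 7)} (D₇ : Design 7 triangles₇ 42) where
  open Classes k
  open Apexes k using (triangles₂; indep₂)
  open Class₂ k using (cover₂-outside; cover₂-inside; cover₂-a₀; length-triangles₂; covered₂)
  open Family₃ k using (triangles₃; indep₃; cover₃-outside; cover₃-inside; length-triangles₃; covered₃; det)

  embed₀ : ⊤ → V (suc n) → V (suc n + 6)
  embed₀ _ a = a ++ 0v

  embed₀-add : ∀ i → Additive (embed₀ i)
  embed₀-add _ a b = sym (trans (++-⊕ a b 0v 0v) (cong ((a ⊕ b) ++_) (⊕-self 0v)))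

  -- The images of embed₁ partition the points outside F₂ⁿ⁺¹ and share the point a₀ = (1, 0, 0).
  embed₁ : V n → V 7 → V (suc n + 6)
  embed₁ i (e ∷ d) = (e ∷ (d • i)) ++ d

  embed₁-add : ∀ i → Additive (embed₁ i)
  embed₁-add i (e ∷ d) (e′ ∷ d′) = sym (trans (++-⊕ (e ∷ (d • i)) (e′ ∷ (d′ • i)) d d′)
    (cong (λ z → ((e xor e′) ∷ z) ++ (d ⊕ d′)) (sym (•-distribʳ d d′ i))))

  embed₁-kernel : ∀ i {x} → embed₁ i x ≡ 0v → x ≡ 0v
  embed₁-kernel i {e ∷ d} eq = cong₂ _∷_ (cong head (proj₁ split)) (proj₂ split)
    where split = ++-≡0 (e ∷ (d • i)) d eq

  triangles₁ : List (Triple (suc n + 6))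
  triangles₁ = images embed₁ (allV n) triangles₇

  indep₁ : ∀ {ρ} → ρ ∈ triangles₁ → Indep ρ
  indep₁ = images-indep embed₁ embed₁-add (allV n) triangles₇ (λ {i} _ → embed₁-kernel i) (Design.independent D₇)

  length-triangles₇ : length triangles₇ ≡ 889
  length-triangles₇ = *-cancelʳ-≡ (length triangles₇) 889 18 (+-cancelʳ-≡ (2 ^ 7 * 2 + 2 ^ 7) _ _ (Design.size D₇))

  length-triangles₁ : length triangles₁ ≡ q * 889
  length-triangles₁ = trans (length-images embed₁ (allV n) triangles₇) (cong₂ _*_ (length-allV n) length-triangles₇)

  ∑-scaled : ∀ (ts : List (Triple 7)) (es : List (V 3)) (f g : V 7 → ℕ) s → (∀ z → g z ≡ f z * s) →
    ∑ ts (λ ρ → ∑ es (λ e → g (lc e ρ))) ≡ ∑ ts (λ ρ → ∑ es (λ e → f (lc e ρ))) * s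
  ∑-scaled ts es f g s eq = trans (∑-cong ts (λ ρ → trans (∑-cong es (λ e → eq (lc e ρ))) (∑-*ʳ es s (λ e → f (lc e ρ)))))
    (∑-*ʳ ts s (λ ρ → ∑ es (λ e → f (lc e ρ))))

  -- Here `s` is the number of copies in which the point has a preimage. It is 1 over `c` ≠ 0; over
  -- `c` = 0 it is `q` when `Y` = 0, because all copies share a₀, and 0 otherwise.
  cover₁ : ∀ f Y c s → (∀ {d} → c ≡ d → ∑ (allV n) (λ i → δ Y (d • i)) ≡ s) →
    ∑ triangles₁ (occurrences ((f ∷ Y) ++ c)) ≡ ∑ triangles₇ (occurrences (f ∷ c)) * s
  cover₁ f Y c s fibre = trans (∑-images embed₁ embed₁-add (allV n) triangles₇ ((f ∷ Y) ++ c))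
    (∑-scaled triangles₇ coveredPoints (δ (f ∷ c)) (λ z → ∑ (allV n) (λ i → δ ((f ∷ Y) ++ c) (embed₁ i z))) s pointwise)
    where
    pointwise : ∀ z → ∑ (allV n) (λ i → δ ((f ∷ Y) ++ c) (embed₁ i z)) ≡ δ (f ∷ c) z * s
    pointwise (e ∷ d) = begin
      ∑ (allV n) (λ i → δ ((f ∷ Y) ++ c) ((e ∷ (d • i)) ++ d))
        ≡⟨ ∑-cong (allV n) (λ i → trans (δ-++ (f ∷ Y) (e ∷ (d • i)) c d)
             (trans (cong (δ c d *_) (δ-∷ f e Y (d • i))) (sym (*-assoc (δ c d) (δᵇ f e) (δ Y (d • i)))))) ⟩
      ∑ (allV n) (λ i → (δ c d * δᵇ f e) * δ Y (d • i))
        ≡⟨ ∑-*ˡ (allV n) (δ c d * δᵇ f e) (λ i → δ Y (d • i)) ⟩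
      (δ c d * δᵇ f e) * ∑ (allV n) (λ i → δ Y (d • i))
        ≡⟨ at (c ≟V d) ⟩
      (δ c d * δᵇ f e) * s
        ≡⟨ cong (_* s) (trans (*-comm (δ c d) (δᵇ f e)) (sym (δ-∷ f e c d))) ⟩
      δ (f ∷ c) (e ∷ d) * s ∎
      where
      at : Dec (c ≡ d) → (δ c d * δᵇ f e) * ∑ (allV n) (λ i → δ Y (d • i)) ≡ (δ c d * δᵇ f e) * s
      at (yes c≡d) = cong ((δ c d * δᵇ f e) *_) (fibre c≡d)
      at (no c≢d)  = trans (cong (λ z → (z * δᵇ f e) * ∑ (allV n) (λ i → δ Y (d • i))) (δ-≢ c≢d))
                           (sym (cong (λ z → (z * δᵇ f e) * s) (δ-≢ c≢d)))

  cover₁-outside : ∀ f Y {c} → c ≢ 0v → ∑ triangles₁ (occurrences ((f ∷ Y) ++ c)) ≡ 42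
  cover₁-outside f Y {c} c≢0 = trans (cover₁ f Y c 1 once)
    (trans (*-identityʳ _) (Design.balanced D₇ {f ∷ c} (λ eq → c≢0 (cong tail eq))))
    where
    once : ∀ {d} → c ≡ d → ∑ (allV n) (λ i → δ Y (d • i)) ≡ 1
    once refl = trans (∑-cong (allV n) (λ i → sym (*-identityʳ (δ Y (c • i)))))
      (∑-δ-bij (c •_) (inv c •_) (•-inverseʳ c≢0) (•-inverse c≢0) Y (λ _ → 1))

  cover₁-fibre : ∀ Y {d : V 6} → 0v ≡ d → ∑ (allV n) (λ i → δ Y (d • i)) ≡ q * δ Y 0v
  cover₁-fibre Y refl = trans (∑-cong (allV n) (λ i → cong (δ Y) (•-zeroˡ i)))
    (trans (∑-const (allV n) (δ Y 0v)) (cong (_* δ Y 0v) (length-allV n)))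

  cover₁-inside : ∀ f {Y} → Y ≢ 0v → ∑ triangles₁ (occurrences ((f ∷ Y) ++ 0v)) ≡ 0
  cover₁-inside f {Y} Y≢0 = trans (cover₁ f Y 0v (q * δ Y 0v) (cover₁-fibre Y))
    (trans (cong (λ z → ∑ triangles₇ (occurrences (f ∷ 0v)) * (q * z)) (δ-≢ Y≢0))
      (trans (cong (∑ triangles₇ (occurrences (f ∷ 0v)) *_) (*-zeroʳ q)) (*-zeroʳ (∑ triangles₇ (occurrences (f ∷ 0v))))))

  cover₁-a₀ : ∑ triangles₁ (occurrences ((true ∷ 0v {n}) ++ 0v {6})) ≡ 42 * q
  cover₁-a₀ = trans (cover₁ true (0v {n}) 0v (q * δ (0v {n}) 0v) (cover₁-fibre (0v {n})))
    (cong₂ _*_ (Design.balanced D₇ {true ∷ 0v} (λ ())) (trans (cong (q *_) (𝟙-yes (0v {n} ≟V 0v) refl)) (*-identityʳ q)))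

  covered₁ : ∀ i {x y} → Good (x , y) → CoveredBy triangles₁ (embed₁ i x) (embed₁ i y)
  covered₁ i good = lift (Design.covering D₇ good)
    where
    lift : ∀ {x y} → CoveredBy triangles₇ x y → CoveredBy triangles₁ (embed₁ i x) (embed₁ i y)
    lift (ρ , ρ∈ , on) = Vec.map (embed₁ i) ρ , ∈-images embed₁ (∈-allV i) ρ∈ , onSide-map (embed₁-add i) on

  covered₁-a₀ : ∀ e X {b} → b ≢ 0v → CoveredBy triangles₁ ((true ∷ 0v {n}) ++ 0v {6}) ((e ∷ X) ++ b)
  covered₁-a₀ e X {b} b≢0 = subst (λ z → CoveredBy triangles₁ ((true ∷ z) ++ 0v) ((e ∷ X) ++ b)) (•-zeroˡ (inv b • X))
    (subst (λ z → CoveredBy triangles₁ (embed₁ (inv b • X) (true ∷ 0v)) ((e ∷ z) ++ b)) (•-inverseʳ b≢0 X)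
      (covered₁ (inv b • X) {true ∷ 0v} {e ∷ b} ((λ ()) , (λ eq → b≢0 (cong tail eq)) , (λ eq → b≢0 (sym (cong tail eq))))))

  -- A vanishing determinant means cX = bY, so both points belong to the copy with index b⁻¹X.
  covered₁-degenerate : ∀ {b c} → Good (b , c) → ∀ e f X Y → det X b Y c ≡ 0v →
    CoveredBy triangles₁ ((e ∷ X) ++ b) ((f ∷ Y) ++ c)
  covered₁-degenerate {b} {c} (b≢0 , c≢0 , b≢c) e f X Y D≡0 =
    subst (λ z → CoveredBy triangles₁ ((e ∷ z) ++ b) ((f ∷ Y) ++ c)) (•-inverseʳ b≢0 X)
      (subst (λ z → CoveredBy triangles₁ (embed₁ (inv b • X) (e ∷ b)) ((f ∷ z) ++ c)) cX≡Y
        (covered₁ (inv b • X) {e ∷ b} {f ∷ c} ((λ eq → b≢0 (cong tail eq)) , (λ eq → c≢0 (cong tail eq)) , (λ eq → b≢c (cong tail eq)))))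
    where
    cX≡Y : c • (inv b • X) ≡ Y
    cX≡Y = trans (•-comm c (inv b) X) (trans (cong (inv b •_) (⊕-≡0⇒≡ D≡0)) (•-inverse b≢0 Y))

  module _ {L r} (D : Design (suc n) L r) where

    r≡2K : r ≡ 2 * K
    r≡2K = *-cancelˡ-≡ r (2 * K) 3 (+-cancelʳ-≡ 2 (3 * r) (3 * (2 * K)) (begin
      3 * r + 2           ≡⟨ sym (balance-value {suc n} (s≤s z≤n) D) ⟩
      2 * q               ≡⟨ cong (2 *_) q≡3K+1 ⟩
      2 * (3 * K + 1)     ≡⟨ solve 1 (λ K → con 2 :* (con 3 :* K :+ con 1) := con 3 :* (con 2 :* K) :+ con 2) refl K ⟩
      3 * (2 * K) + 2 ∎))

    triangles₀ : List (Triple (suc n + 6))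
    triangles₀ = images embed₀ (tt ∷ []) L

    indep₀ : ∀ {ρ} → ρ ∈ triangles₀ → Indep ρ
    indep₀ = images-indep embed₀ embed₀-add (tt ∷ []) L (λ _ {a} eq → proj₁ (++-≡0 a 0v eq)) (Design.independent D)

    length-triangles₀ : length triangles₀ ≡ length L
    length-triangles₀ = trans (length-images embed₀ (tt ∷ []) L) (*-identityˡ (length L))

    cover₀ : ∀ a c → ∑ triangles₀ (occurrences (a ++ c)) ≡ δ c 0v * ∑ L (occurrences a)
    cover₀ a c = trans (∑-images embed₀ embed₀-add (tt ∷ []) L (a ++ c)) (trans
      (∑-cong L (λ ρ → trans (∑-cong coveredPoints {g = λ e → δ c 0v * δ a (lc e ρ)} (λ e → trans (+-identityʳ _) (δ-++ a (lc e ρ) c 0v)))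
                             (∑-*ˡ coveredPoints (δ c 0v) (λ e → δ a (lc e ρ)))))
      (∑-*ˡ L (δ c 0v) (occurrences a)))

    covered₀ : ∀ {a a′} → Good (a , a′) → CoveredBy triangles₀ (a ++ 0v) (a′ ++ 0v)
    covered₀ good = lift (Design.covering D good)
      where
      lift : ∀ {a a′} → CoveredBy L a a′ → CoveredBy triangles₀ (a ++ 0v) (a′ ++ 0v)
      lift (ρ , ρ∈ , on) = Vec.map (embed₀ tt) ρ , ∈-images embed₀ {is = tt ∷ []} (here refl) ρ∈ , onSide-map (embed₀-add tt) on

    triangles : List (Triple (suc n + 6))
    triangles = triangles₀ List.++ (triangles₁ List.++ (triangles₂ List.++ triangles₃))

    Covered : V (suc n + 6) → V (suc n + 6) → Set
    Covered = CoveredBy triangles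

    in₀ : ∀ {u v} → CoveredBy triangles₀ u v → Covered u v
    in₀ (ρ , ρ∈ , on) = ρ , ∈-++⁺ˡ ρ∈ , on

    in₁ : ∀ {u v} → CoveredBy triangles₁ u v → Covered u v
    in₁ (ρ , ρ∈ , on) = ρ , ∈-++⁺ʳ triangles₀ (∈-++⁺ˡ ρ∈) , on

    in₂ : ∀ {u v} → CoveredBy triangles₂ u v → Covered u v
    in₂ (ρ , ρ∈ , on) = ρ , ∈-++⁺ʳ triangles₀ (∈-++⁺ʳ triangles₁ (∈-++⁺ˡ ρ∈)) , on

    in₃ : ∀ {u v} → CoveredBy triangles₃ u v → Covered u v
    in₃ (ρ , ρ∈ , on) = ρ , ∈-++⁺ʳ triangles₀ (∈-++⁺ʳ triangles₁ (∈-++⁺ʳ triangles₂ ρ∈)) , on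

    independent : ∀ {ρ} → ρ ∈ triangles → Indep ρ
    independent ρ∈ = [ indep₀ , [ indep₁ , [ indep₂ , indep₃ ]′ ∘ ∈-++⁻ triangles₂ ]′ ∘ ∈-++⁻ triangles₁ ]′ (∈-++⁻ triangles₀ ρ∈)

    meets : ∀ {a : V (suc n)} {b : V 6} → a ≢ 0v → b ≢ 0v → ∀ (x : V (suc n)) → Covered (a ++ 0v) (x ++ b)
    meets {e ∷ Y} {b} a≢0 b≢0 (f ∷ X) = go (Y ≟V 0v) e a≢0
      where
      go : Dec (Y ≡ 0v) → ∀ e → e ∷ Y ≢ 0v → Covered ((e ∷ Y) ++ 0v) ((f ∷ X) ++ b)
      go (no Y≢0)   e     _   = in₂ (covered₂ b≢0 Y≢0 e (f ∷ X))
      go (yes refl) true  _   = in₁ (covered₁-a₀ f X b≢0)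
      go (yes refl) false a≢0 = ⊥-elim (a≢0 refl)

    skew : ∀ {b c : V 6} → Good (b , c) → ∀ (x y : V (suc n)) → Covered (x ++ b) (y ++ c)
    skew {b} {c} good (e ∷ X) (f ∷ Y) = go (det X b Y c ≟V 0v)
      where
      go : Dec (det X b Y c ≡ 0v) → Covered ((e ∷ X) ++ b) ((f ∷ Y) ++ c)
      go (yes D≡0) = in₁ (covered₁-degenerate good e f X Y D≡0)
      go (no D≢0)  = in₃ (covered₃ good e f X Y D≢0)

    left≢0 : ∀ {x : V (suc n)} {b : V 6} → x ++ b ≢ 0v → b ≡ 0v → x ≢ 0v
    left≢0 ≢0 refl refl = ≢0 (++-0 (suc n))

    covering-++ : ∀ (x y : V (suc n)) (b c : V 6) → Dec (b ≡ 0v) → Dec (c ≡ 0v) → Dec (b ≡ c) →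
                  Good (x ++ b , y ++ c) → Covered (x ++ b) (y ++ c)
    covering-++ x y b c (yes refl) (yes refl) _         (u≢0 , v≢0 , u≢v) = in₀ (covered₀ (left≢0 u≢0 refl , left≢0 v≢0 refl , λ { refl → u≢v refl }))
    covering-++ x y b c (yes refl) (no c≢0)   _         (u≢0 , v≢0 , u≢v) = meets (left≢0 u≢0 refl) c≢0 y
    covering-++ x y b c (no b≢0)   (yes refl) _         (u≢0 , v≢0 , u≢v) = coveredBy-swap (meets (left≢0 v≢0 refl) b≢0 x)
    covering-++ x y b c (no b≢0)   (no c≢0)   (no b≢c)  (u≢0 , v≢0 , u≢v) = skew (b≢0 , c≢0 , b≢c) x y
    -- Two points over the same `b`: the third point of their line, `x ⊕ y`, is a nonzero point of
    -- the given subspace.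
    covering-++ x y b c (no b≢0)   (no c≢0)   (yes refl) (u≢0 , v≢0 , u≢v) =
      coveredBy-add (trans (++-⊕ x (x ⊕ y) b 0v) (cong₂ _++_ (⊕-solve (v₀ ⊞ (v₀ ⊞ v₁)) v₁ refl (x ∷ y ∷ [])) (⊕-identityʳ b)))
        (coveredBy-swap (meets (λ eq → u≢v (cong (_++ b) (⊕-≡0⇒≡ eq))) b≢0 x))

    covering : ∀ {u v} → Good (u , v) → Covered u v
    covering {u} {v} = from (splitAt (suc n) u) (splitAt (suc n) v)
      where
      from : ∀ {u v} → (∃ λ x → ∃ λ b → u ≡ x ++ b) → (∃ λ y → ∃ λ c → v ≡ y ++ c) → Good (u , v) → Covered u v
      from (x , b , refl) (y , c , refl) = covering-++ x y b c (b ≟V 0v) (c ≟V 0v) (b ≟V c)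

    ∑-triangles : ∀ f → ∑ triangles f ≡ ∑ triangles₀ f + (∑ triangles₁ f + (∑ triangles₂ f + ∑ triangles₃ f))
    ∑-triangles f = trans (∑-++ triangles₀ _ f) (cong (∑ triangles₀ f +_)
      (trans (∑-++ triangles₁ _ f) (cong (∑ triangles₁ f +_) (∑-++ triangles₂ triangles₃ f))))

    inner : ∀ f Y → f ∷ Y ≢ 0v → ∑ triangles₀ (occurrences ((f ∷ Y) ++ 0v)) ≡ 2 * K
    inner f Y ≢0 = trans (cover₀ (f ∷ Y) 0v)
      (trans (cong (δ (0v {6}) 0v *_) (Design.balanced D {f ∷ Y} ≢0)) (trans (*-identityˡ r) r≡2K))

    2K+42q : 2 * K + 42 * q ≡ 128 * K + 42
    2K+42q = trans (cong (λ z → 2 * K + 42 * z) q≡3K+1)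
      (solve 1 (λ K → con 2 :* K :+ con 42 :* (con 3 :* K :+ con 1) := con 128 :* K :+ con 42) refl K)

    balanced-++ : ∀ f Y c → Dec (c ≡ 0v) → Dec (Y ≡ 0v) → (f ∷ Y) ++ c ≢ 0v →
                  ∑ triangles (occurrences ((f ∷ Y) ++ c)) ≡ 128 * K + 42
    balanced-++ f Y c (no c≢0) _ _ = begin
      ∑ triangles (occurrences ((f ∷ Y) ++ c))
        ≡⟨ ∑-triangles (occurrences ((f ∷ Y) ++ c)) ⟩
      -- The given design contributes nothing, the copies of the design of F₂⁷ contribute 42, the
      -- second kind 4K, and the third kind 4K for each of the 31 lines through `c`.
      _ ≡⟨ cong₂ _+_ (trans (cover₀ (f ∷ Y) c) (cong (_* ∑ L (occurrences (f ∷ Y))) (δ-≢ c≢0)))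
             (cong₂ _+_ (cover₁-outside f Y c≢0) (cong₂ _+_ (cover₂-outside f Y c≢0) (cover₃-outside f Y c≢0))) ⟩
      42 + (4 * K + 31 * (4 * K))
        ≡⟨ solve 1 (λ K → con 42 :+ (con 4 :* K :+ con 31 :* (con 4 :* K)) := con 128 :* K :+ con 42) refl K ⟩
      128 * K + 42 ∎
    balanced-++ f Y c (yes refl) (no Y≢0) _ = begin
      ∑ triangles (occurrences ((f ∷ Y) ++ 0v))
        ≡⟨ ∑-triangles (occurrences ((f ∷ Y) ++ 0v)) ⟩
      _ ≡⟨ cong₂ _+_ (inner f Y (λ eq → Y≢0 (cong tail eq)))
             (cong₂ _+_ (cover₁-inside f Y≢0) (cong₂ _+_ (cover₂-inside f Y≢0) (cover₃-inside f Y))) ⟩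
      2 * K + (42 * q + 0)
        ≡⟨ trans (cong (2 * K +_) (+-identityʳ (42 * q))) 2K+42q ⟩
      128 * K + 42 ∎
    balanced-++ true Y c (yes refl) (yes refl) _ = begin
      ∑ triangles (occurrences ((true ∷ 0v {n}) ++ 0v {6}))
        ≡⟨ ∑-triangles (occurrences ((true ∷ 0v {n}) ++ 0v {6})) ⟩
      _ ≡⟨ cong₂ _+_ (inner true (0v {n}) (λ ()))
             (cong₂ _+_ cover₁-a₀ (cong₂ _+_ (cover₂-a₀ true) (cover₃-inside true (0v {n})))) ⟩
      2 * K + (42 * q + 0)
        ≡⟨ trans (cong (2 * K +_) (+-identityʳ (42 * q))) 2K+42q ⟩
      128 * K + 42 ∎
    balanced-++ false Y c (yes refl) (yes refl) ≢0 = ⊥-elim (≢0 (++-0 (suc n)))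

    balanced : ∀ {x} → x ≢ 0v → ∑ triangles (occurrences x) ≡ 128 * K + 42
    balanced {x} = from (splitAt (suc n) x)
      where
      from : ∀ {x} → (∃ λ a → ∃ λ c → x ≡ a ++ c) → x ≢ 0v → ∑ triangles (occurrences x) ≡ 128 * K + 42
      from (f ∷ Y , c , refl) = balanced-++ f Y c (c ≟V 0v) (Y ≟V 0v)

    length-triangles : length triangles ≡ length L + (q * 889 + (63 * (K * (2 * q)) + 651 * (K * (4 * q))))
    length-triangles = trans (length-++ triangles₀) (cong₂ _+_ length-triangles₀
      (trans (length-++ triangles₁) (cong₂ _+_ length-triangles₁
      (trans (length-++ triangles₂) (cong₂ _+_ length-triangles₂ length-triangles₃)))))

    size : length triangles * 18 + (2 ^ (suc n + 6) * 2 + 2 ^ (suc n + 6)) ≡ 2 ^ (suc n + 6) * 2 ^ (suc n + 6) + 2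
    size = begin
      length triangles * 18 + (2 ^ (suc n + 6) * 2 + 2 ^ (suc n + 6))
        ≡⟨ cong₂ (λ l N → l * 18 + (N * 2 + N)) length-triangles N≡ ⟩
      (length L + (q * 889 + (63 * (K * (2 * q)) + 651 * (K * (4 * q))))) * 18 + (2 * q * 64 * 2 + 2 * q * 64)
        -- The coefficient is 16380 = 128² - 4: it arises from the copies as 18 · 889 + 3 · 128 - 6,
        -- and from the other two kinds as a third of 18 · (63 · 2 + 651 · 4).
        ≡⟨ solve 3 (λ l q K → (l :+ (q :* con 889 :+ (con 63 :* (K :* (con 2 :* q)) :+ con 651 :* (K :* (con 4 :* q))))) :* con 18
                              :+ (con 2 :* q :* con 64 :* con 2 :+ con 2 :* q :* con 64)
             := (l :* con 18 :+ (con 2 :* q :* con 2 :+ con 2 :* q)) :+ q :* (con 16380 :* (con 3 :* K :+ con 1))) refl (length L) q K ⟩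
      (length L * 18 + (2 * q * 2 + 2 * q)) + q * (16380 * (3 * K + 1))
        ≡⟨ cong₂ (λ i j → i + q * (16380 * j)) (Design.size D) (sym q≡3K+1) ⟩
      (2 * q * (2 * q) + 2) + q * (16380 * q)
        ≡⟨ solve 1 (λ q → (con 2 :* q :* (con 2 :* q) :+ con 2) :+ q :* (con 16380 :* q) := con 2 :* q :* con 64 :* (con 2 :* q :* con 64) :+ con 2) refl q ⟩
      2 * q * 64 * (2 * q * 64) + 2
        ≡⟨ cong (λ N → N * N + 2) (sym N≡) ⟩
      2 ^ (suc n + 6) * 2 ^ (suc n + 6) + 2 ∎
      where
      N≡ : 2 ^ (suc n + 6) ≡ 2 * q * 64
      N≡ = ^-distribˡ-+-* 2 (suc n) 6

    extended : Design (suc n + 6) triangles (128 * K + 42)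
    extended = record { independent = independent ; covering = covering ; size = size ; balanced = balanced }

theorem7 : ∀ (m : ℕ) → 7 ≤ m → HasBalancedTriangleDesign m → HasBalancedTriangleDesign (m + 6)
theorem7 m 7≤m H = extend (balanced⇒design H)
  where
  1≤m : 1 ≤ m
  1≤m = ≤-trans (s≤s z≤n) 7≤m
  extend-by : ∀ {L r} → Design m L r → (∃ λ k → m ≡ 1 + k * 6) → HasBalancedTriangleDesign (m + 6)
  extend-by D (k , refl) = design⇒balanced (Extension.extended k design₇ D)
  extend : (∃ λ L → ∃ λ r → Design m L r) → HasBalancedTriangleDesign (m + 6)
  extend (L , r , D) = extend-by D (design-dimension 1≤m D)
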